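{- Let $\mathcal{A}_H$ be the Hall affine plane of order $q^2$ (see context). Let $(\ell_1,\ell_2)$ be an ordered pair of distinct lines of $\mathcal{A}_H$ such that either both lines belong to $BF$, or both belong to $NBF$, or $\ell_1$ belongs to $NBF$ and $\ell_2$ belongs to $BF$. Then for every three distinct points $A_1,B_1,C_1$ on $\ell_1$, none of which lies on $\ell_2$, there exist three points $A_2,B_2,C_2$ on $\ell_2$ such that $A_1,B_1,C_1,A_2,B_2,C_2$ define a Pappus configuration.
   Context: Let $F=F_q$ be the finite field of prime power order $q$, and let $f(x)=x^2-rx-s$ with $r,s\in F$ be irreducible over $F$. The Hall system is $H=F^2$ with componentwise addition and multiplication defined, for $\mathbf a=(a_1,a_2)$, $\mathbf b=(b_1,b_2)\in H$, by $\mathbf a\mathbf b=(a_1b_1,a_2b_1)$ if $b_2=0$, and $\mathbf a\mathbf b=(a_1b_1-a_2b_2^{ -1}f(b_1),\,a_1b_2-a_2b_1+a_2r)$ if $b_2\neq 0$. We identify $b\in F$ with $(b,0)\in H$. The Hall affine plane $\mathcal{A}_H$ has point set $H\times H$; its lines are the sets $\{(\mathbf x,\mathbf x\mathbf m+\mathbf k):\mathbf x\in H\}$ for fixed $\mathbf m,\mathbf k\in H$ (non-vertical lines $\mathbf y=\mathbf x\mathbf m+\mathbf k$; of type 1 if $\mathbf m\in F$, i.e. $m_2=0$, and of type 2 if $m_2\neq 0$) and the vertical lines $\{(\mathbf c,\mathbf y):\mathbf y\in H\}$ for fixed $\mathbf c\in H$. $BF$ denotes the set of all type 1 lines and vertical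 lines; $NBF$ denotes the set of all type 2 lines. Six points $A_1,B_1,C_1$ on a line $\ell_1$ and $A_2,B_2,C_2$ on a line $\ell_2\neq\ell_1$, where the points on each line are pairwise distinct and none of the six points lies on both lines, define a Pappus configuration if the three points $A_1B_2\cap A_2B_1$, $A_1C_2\cap A_2C_1$, $B_1C_2\cap B_2C_1$ are collinear, where intersections and collinearity are taken in the projective completion of $\mathcal{A}_H$ (parallel lines meet in the point at infinity of their parallel class; the points at infinity form the line at infinity). -}

module Defs where

open import Data.Nat using (ℕ)
open import Data.Fin using (Fin)
import Data.Fin.Properties as FinP
open import Data.Product using (Σ; ∃; ∃-syntax; _×_; _,_)
open import Data.Sum using (_⊎_; inj₁; inj₂)
open import Data.Empty using (⊥)
open import Relation.Nullary using (¬_; Dec; yes; no)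
open import Relation.Nullary.Decidable using (map′)
open import Relation.Binary.PropositionalEquality using (_≡_; _≢_; cong; trans; sym)
open import Relation.Binary.Definitions using (DecidableEquality)
open import Algebra.Structures using (IsCommutativeRing)
open import Function.Bundles using (Inverse; _↔_)

record FiniteField : Set₁ where
  infixl 7 _*_
  infixl 6 _+_ _-_
  infix  8 -_
  infix  9 _⁻¹
  field
    Carrier : Set
    _+_ _*_ : Carrier → Carrier → Carrier
    -_      : Carrier → Carrier
    0# 1#   : Carrier
    _⁻¹     : Carrier → Carrier
    isCommutativeRing : IsCommutativeRing _≡_ _+_ _*_ -_ 0# 1#
    0≢1     : 0# ≢ 1#
    ⁻¹-inverse : ∀ x → x ≢ 0# → x * x ⁻¹ ≡ 1#
    size    : ℕ
    enum    : Carrier ↔ Fin size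

  _-_ : Carrier → Carrier → Carrier
  x - y = x + (- y)

  _≟_ : DecidableEquality Carrier
  x ≟ y = map′ (λ e → trans (sym (Inverse.strictlyInverseʳ enum x)) (trans (cong (Inverse.from enum) e) (Inverse.strictlyInverseʳ enum y))) (cong (Inverse.to enum)) (Inverse.to enum x FinP.≟ Inverse.to enum y)


-- Irreducibility of f(x) = x² - r x - s: f is not a product of two
-- polynomials of degree 1, i.e. there are no c,d,c',d' with
-- (c x + d)(c' x + d') = x² - r x - s (coefficientwise).

module _ (K : FiniteField) where
  open FiniteField K renaming (Carrier to F)

  Irreducible : F → F → Set
  Irreducible r s = ¬ (Σ F λ c → Σ F λ d → Σ F λ c' → Σ F λ d' →
                        (c * c' ≡ 1#) × (c * d' + d * c' ≡ - r) × (d * d' ≡ - s))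

module _ (K : FiniteField) (r s : FiniteField.Carrier K) where
  open FiniteField K renaming (Carrier to F)

  H : Set
  H = F × F

  emb : F → H
  emb b = (b , 0#)

  fpoly : F → F
  fpoly x = x * x - r * x - s

  _⊕_ : H → H → H
  (a₁ , a₂) ⊕ (b₁ , b₂) = (a₁ + b₁ , a₂ + b₂)

  _⊗_ : H → H → H
  (a₁ , a₂) ⊗ (b₁ , b₂) with b₂ ≟ 0#
  ... | yes _ = (a₁ * b₁ , a₂ * b₁)
  ... | no  _ = (a₁ * b₁ - a₂ * (b₂ ⁻¹) * fpoly b₁ , a₁ * b₂ - a₂ * b₁ + a₂ * r)

  Point : Set
  Point = H × H

  data Line : Set where
    nonVert : H → H → Line
    vert    : H → Line

  _∈L_ : Point → Line → Set
  (x , y) ∈L nonVert m k = y ≡ (x ⊗ m) ⊕ k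
  (x , y) ∈L vert c      = x ≡ c

  -- BF: type 1 lines (slope in F, i.e. m₂ = 0) and vertical lines;
  -- NBF: type 2 lines (m₂ ≠ 0).
  InBF : Line → Set
  InBF (nonVert (m₁ , m₂) k) = m₂ ≡ 0#
  InBF (vert c)              = Data.Unit.⊤
    where import Data.Unit

  InNBF : Line → Set
  InNBF (nonVert (m₁ , m₂) k) = m₂ ≢ 0#
  InNBF (vert c)              = ⊥

  -- projective completion: points at infinity are parallel classes,
  -- namely a slope m ∈ H (lines y = x m + k) or the vertical class.
  data PPoint : Set where
    aff    : Point → PPoint
    slope  : H → PPoint
    vertInf : PPoint

  data PLine : Set where
    affL  : Line → PLine
    lInf  : PLine

  _∈P_ : PPoint → PLine → Set
  aff P   ∈P affL ℓ           = P ∈L ℓ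
  slope m ∈P affL (nonVert m' k) = m ≡ m'
  slope m ∈P affL (vert c)    = ⊥
  vertInf ∈P affL (nonVert m k) = ⊥
  vertInf ∈P affL (vert c)    = Data.Unit.⊤
    where import Data.Unit
  aff P   ∈P lInf             = ⊥
  slope m ∈P lInf             = Data.Unit.⊤
    where import Data.Unit
  vertInf ∈P lInf             = Data.Unit.⊤
    where import Data.Unit

  -- the (projective) lines X Y and Z W meet in a point lying on n:
  -- L is the line through X,Y and M the line through Z,W (these are
  -- unique when X ≠ Y, Z ≠ W), and P is a common point of L and M.
  MeetOn : PPoint → PPoint → PPoint → PPoint → PLine → Set
  MeetOn X Y Z W n = Σ PLine λ L → Σ PLine λ M → Σ PPoint λ P →
    (X ∈P L) × (Y ∈P L) × (Z ∈P M) × (W ∈P M) × (P ∈P L) × (P ∈P M) × (P ∈P n)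

  PappusConfig : Line → Line → Point → Point → Point → Point → Point → Point → Set
  PappusConfig ℓ₁ ℓ₂ A₁ B₁ C₁ A₂ B₂ C₂ =
    (ℓ₁ ≢ ℓ₂) ×
    (A₁ ∈L ℓ₁) × (B₁ ∈L ℓ₁) × (C₁ ∈L ℓ₁) ×
    (A₂ ∈L ℓ₂) × (B₂ ∈L ℓ₂) × (C₂ ∈L ℓ₂) ×
    (A₁ ≢ B₁) × (A₁ ≢ C₁) × (B₁ ≢ C₁) ×
    (A₂ ≢ B₂) × (A₂ ≢ C₂) × (B₂ ≢ C₂) ×
    ¬ (A₁ ∈L ℓ₂) × ¬ (B₁ ∈L ℓ₂) × ¬ (C₁ ∈L ℓ₂) ×
    ¬ (A₂ ∈L ℓ₁) × ¬ (B₂ ∈L ℓ₁) × ¬ (C₂ ∈L ℓ₁) ×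
    (Σ PLine λ n →
       MeetOn (aff A₁) (aff B₂) (aff A₂) (aff B₁) n ×
       MeetOn (aff A₁) (aff C₂) (aff A₂) (aff C₁) n ×
       MeetOn (aff B₁) (aff C₂) (aff B₂) (aff C₁) n)

{-# OPTIONS --safe #-}

-- Let K = F[θ] be the quadratic extension defined by f, with conjugation x ↦ x̄ and norm N. Encoding the point (X , Y)
-- of the Hall plane by (x , y), where x̄ = Y - θ̄ X and y = Y - θ X in K, the lines of NBF become the lines
-- p x + q y = κ of the plane over K with N p ≠ N q, and those of BF become the sets y = ε x̄ + κ with N ε = 1.
--
-- Parallel lines: a point reflection exchanging them gives A′ = T - A with all intersections at infinity.
-- Two crossing lines are brought into normal form by affine maps that preserve both kinds of lines.
--   BF, BF:   y = x̄ and the line of the points (λ x , λ x̄). With A′ = λ (T - a) all intersections lie on a third line of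
--             BF through the common point, for a suitable T.
--   NBF, NBF: y = 0 and x = 0 are exchanged by (x , y) ↦ (ȳ , x̄). For y = 0 and y = k x choose A′, B′, C′ as s b c,
--             s a c, s a b: the intersections are at infinity, and for |F| ≥ 5 some s makes all joins belong to NBF.
--   NBF, BF:  y = 0 and y = x̄. If a, b, c are proportional over F, the intersections can be put at infinity. Otherwise,
--             say, A B′ and B A′ are taken parallel and C′ collinear over F with A′ and B′; for |F| ≥ 5 this can be done with
--             all joins in NBF, so that Pappus's theorem over K applies.
-- For |F| ≤ 4 the last two cases are decided by exhaustive search over a concrete model of F.

module Submission where

open import Defs
open import Data.Product using (Σ; _×_)
open import Data.Sum using (_⊎_)
open import Relation.Nullary using (¬_)
open import Relation.Binary.PropositionalEquality using (_≢_)
open import Level using (0ℓ)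
open import Algebra.Bundles using (CommutativeRing; RawRing)

-- The coordinates exhibit the Hall plane as a derived plane: of the |F|² + 1 directions of the
-- affine plane over K, the |F| + 1 with N p = N q are removed, and their lines are replaced by Baer
-- subplanes, the sets y = ε x̄ + κ. Two distinct points with difference (d , e) are joined by a
-- line of NBF iff N d ≠ N e, so comparing two norms tells the kind of a join. The maps behind the
-- normal forms are similitudes of the hermitian form N x - N y; they permute its null vectors and
-- so respect both kinds of lines. The obstacle is a join that turns out semilinear, for then
-- arguments over K break down. Such a join corresponds to an element of norm 1, so each join to be
-- kept linear excludes at most |F| + 1 values of the parameter. Three such lists and the value 0
-- make 3 (|F| + 1) + 1 exclusions among |F|² elements: this leaves a choice once |F| ≥ 5, but
-- guarantees none for |F| = 4, where both numbers are 16. The parameter t in F of the mixed case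
-- has four excluded values, which gives the same bound.

module DifferenceSolver (R : CommutativeRing 0ℓ 0ℓ) where
  open import Data.Nat as ℕ using (ℕ)
  import Data.Nat.Properties as ℕₚ
  open import Data.Product using (_×_; _,_; proj₁; proj₂)
  open import Data.Maybe using (Maybe; just; nothing)
  open import Relation.Nullary using (yes; no)
  open import Relation.Binary.PropositionalEquality as ≡ using (_≡_)
  open import Algebra.Solver.Ring.AlmostCommutativeRing
  import Algebra.Solver.Ring
  open import Data.Vec.N-ary using (N-ary; Eq; Eqʰ; curryⁿ)
  open CommutativeRing R
  import Algebra.Properties.Ring ring as RP
  open import Algebra.Properties.Semiring.Mult semiring using (×1-homo-*; ×-homo-+) renaming (_×_ to _·_)
  import Tactic.RingSolver.NonReflective as NR
  import Tactic.RingSolver.Core.AlmostCommutativeRing as TA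

  private
    module Weak = NR (TA.fromCommutativeRing R (λ _ → nothing))
    open Weak using (_⊜_) renaming (_⊕_ to _⊞_)

    -- The coefficients of the solver are integers, written as differences of naturals with one
    -- component reduced to 0. They let opposite terms cancel by computation in every commutative
    -- ring.
    reduce : ℕ × ℕ → ℕ × ℕ
    reduce (ℕ.suc a , ℕ.suc b) = reduce (a , b)
    reduce p                   = p

    coefficients : RawRing 0ℓ 0ℓ
    coefficients = record
      { Carrier = ℕ × ℕ
      ; _≈_ = _≡_
      ; _+_ = λ (a , b) (c , d) → reduce (a ℕ.+ c , b ℕ.+ d)
      ; _*_ = λ (a , b) (c , d) → reduce (a ℕ.* c ℕ.+ b ℕ.* d , a ℕ.* d ℕ.+ b ℕ.* c)
      ; -_  = λ (a , b) → (b , a)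
      ; 0#  = (0 , 0)
      ; 1#  = (1 , 0)
      }

    nat : ℕ → Carrier
    nat n = n · 1#

    difference′ : ℕ × ℕ → Carrier
    difference′ (m , n) = nat m + - nat n

    -- Special cases make the constants 0 and 1 of the solver definitionally those of the ring.
    difference : ℕ × ℕ → Carrier
    difference (0 , 0) = 0#
    difference (1 , 0) = 1#
    difference p       = difference′ p

    difference-correct : ∀ p → difference p ≈ difference′ p
    difference-correct (0 , 0)                 = sym (trans (+-congˡ RP.-0#≈0#) (+-identityʳ 0#))
    difference-correct (1 , 0)                 = sym (trans (+-congˡ RP.-0#≈0#) (trans (+-identityʳ _) (+-identityʳ 1#)))
    difference-correct (ℕ.suc (ℕ.suc _) , 0)   = refl
    difference-correct (0 , ℕ.suc _)           = refl
    difference-correct (1 , ℕ.suc _)           = refl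
    difference-correct (ℕ.suc (ℕ.suc _) , ℕ.suc _) = refl

    regroup : ∀ p q r s → (p + q) + (r + s) ≈ (p + s) + (r + q)
    regroup = Weak.solve 4 (λ p q r s → ((p ⊞ q) ⊞ (r ⊞ s)) ⊜ ((p ⊞ s) ⊞ (r ⊞ q))) refl

    reduce-correct : ∀ p → difference (reduce p) ≈ difference′ p
    reduce-correct (0 , 0)             = difference-correct (0 , 0)
    reduce-correct (0 , ℕ.suc b)       = refl
    reduce-correct (ℕ.suc a , 0)       = difference-correct (ℕ.suc a , 0)
    reduce-correct (ℕ.suc a , ℕ.suc b) = trans (reduce-correct (a , b)) (sym (trans
      (+-congˡ (trans (sym (RP.-‿+-comm 1# (nat b))) (+-comm _ _)))
      (trans (regroup 1# (nat a) (- nat b) (- 1#)) (trans (+-congʳ (-‿inverseʳ 1#)) (trans (+-identityˡ _) (+-comm _ _))))))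

    expand : ∀ a b c d → (a * c + b * d) + - (a * d + b * c) ≈ (a + - b) * (c + - d)
    expand a b c d = sym (trans (distribʳ _ a (- b)) (trans (+-cong
      (trans (distribˡ a c (- d)) (+-congˡ (sym (RP.-‿distribʳ-* a d))))
      (trans (distribˡ (- b) c (- d)) (+-cong (sym (RP.-‿distribˡ-* b c))
        (trans (sym (RP.-‿distribˡ-* b (- d))) (trans (-‿cong (sym (RP.-‿distribʳ-* b d))) (RP.-‿involutive (b * d)))))))
      (trans (regroup (a * c) (- (a * d)) (- (b * c)) (b * d))
             (+-congˡ (trans (+-comm _ _) (RP.-‿+-comm (a * d) (b * c)))))))

    morphism : coefficients -Raw-AlmostCommutative⟶ fromCommutativeRing R
    morphism = record
      { ⟦_⟧    = difference
      ; +-homo = λ (a , b) (c , d) → trans (reduce-correct (a ℕ.+ c , b ℕ.+ d)) (trans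
          (trans (+-cong (×-homo-+ 1# a c) (trans (-‿cong (×-homo-+ 1# b d)) (trans (sym (RP.-‿+-comm _ _)) (+-comm _ _))))
                (regroup (nat a) (nat c) (- nat d) (- nat b) ⟨ trans ⟩ +-congˡ (+-comm _ _)))
          (sym (+-cong (difference-correct (a , b)) (difference-correct (c , d)))))
      ; *-homo = λ (a , b) (c , d) → trans (reduce-correct (a ℕ.* c ℕ.+ b ℕ.* d , a ℕ.* d ℕ.+ b ℕ.* c)) (trans
          (trans (+-cong (trans (×-homo-+ 1# (a ℕ.* c) (b ℕ.* d)) (+-cong (×1-homo-* a c) (×1-homo-* b d)))
                        (-‿cong (trans (×-homo-+ 1# (a ℕ.* d) (b ℕ.* c)) (+-cong (×1-homo-* a d) (×1-homo-* b c)))))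
                (expand (nat a) (nat b) (nat c) (nat d)))
          (sym (*-cong (difference-correct (a , b)) (difference-correct (c , d)))))
      ; -‿homo = λ (a , b) → trans (difference-correct (b , a)) (trans (trans (+-comm (nat b) (- nat a))
                  (trans (+-congˡ (sym (RP.-‿involutive (nat b)))) (RP.-‿+-comm (nat a) (- nat b))))
                  (-‿cong (sym (difference-correct (a , b)))))
      ; 0-homo = refl
      ; 1-homo = refl
      }
      where open import Function using (_⟨_⟩_)

    cross : ∀ a b c d → a + d ≈ c + b → a + - b ≈ c + - d
    cross a b c d h = RP.+-cancelʳ (b + d) _ _
      (trans (regroup a (- b) b d) (trans (cancel (a + d) b) (trans h (sym
        (trans (+-congˡ (+-comm b d)) (trans (regroup c (- d) d b) (cancel (c + b) d)))))))
      where
      cancel : ∀ x y → x + (y + - y) ≈ x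
      cancel x y = trans (+-congˡ (-‿inverseʳ y)) (+-identityʳ x)

    decide : ∀ x y → Maybe (difference x ≈ difference y)
    decide (a , b) (c , d) with a ℕ.+ d ℕₚ.≟ c ℕ.+ b
    ... | no _ = nothing
    ... | yes e = just (trans (difference-correct (a , b)) (trans
      (cross (nat a) (nat b) (nat c) (nat d)
        (trans (sym (×-homo-+ 1# a d)) (trans (reflexive (≡.cong nat e)) (×-homo-+ 1# c b))))
      (sym (difference-correct (c , d)))))

  module Full = Algebra.Solver.Ring coefficients (fromCommutativeRing R) morphism decide
  open import Relation.Binary.Reflection setoid Full.var Full.⟦_⟧ Full.⟦_⟧↓ Full.correct using (close)
  open Full public using (Polynomial; _:=_; _:+_; _:*_; _:-_; :-_; con)

  -- Abstract, so that proofs are not unfolded when other terms are normalised.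
  abstract
    solve : ∀ n (f : N-ary n (Polynomial n) (Polynomial n × Polynomial n)) →
      Eqʰ n _≈_ (curryⁿ (Full.⟦ proj₁ (close n f) ⟧↓)) (curryⁿ (Full.⟦ proj₂ (close n f) ⟧↓)) →
      Eq n _≈_ (curryⁿ (Full.⟦ proj₁ (close n f) ⟧)) (curryⁿ (Full.⟦ proj₂ (close n f) ⟧))
    solve = Full.solve

  :0 :1 : ∀ {n} → Polynomial n
  :0 = con (0 , 0)
  :1 = con (1 , 0)

  ≡⇒-≡0 : ∀ {x y} → x ≈ y → x - y ≈ 0#
  ≡⇒-≡0 {x} {y} h = trans (+-congʳ h) (-‿inverseʳ y)

  -≡0⇒≡ : ∀ {x y} → x - y ≈ 0# → x ≈ y
  -≡0⇒≡ {x} {y} h = trans (solve 2 (λ x y → x := (x :- y) :+ y) refl x y) (trans (+-congʳ h) (+-identityˡ y))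

  -- `by₁`, `by₂` and `by₃` derive an equation from hypotheses g ≈ h by writing x - y as a
  -- combination of the differences g - h. The coefficients are the whole content of such a proof;
  -- the remaining identity is left to the solver.
  by₁ : ∀ {x y} k {g h} → g ≈ h → x - y ≈ k * (g - h) → x ≈ y
  by₁ k p e = -≡0⇒≡ (trans e (trans (*-congˡ (≡⇒-≡0 p)) (zeroʳ k)))

  by₂ : ∀ {x y} k {g h} → g ≈ h → ∀ k′ {g′ h′} → g′ ≈ h′ → x - y ≈ k * (g - h) + k′ * (g′ - h′) → x ≈ y
  by₂ k p k′ p′ e = by₁ k p (trans e (trans (+-congˡ (trans (*-congˡ (≡⇒-≡0 p′)) (zeroʳ k′))) (+-identityʳ _)))

  by₃ : ∀ {x y} k {g h} → g ≈ h → ∀ k′ {g′ h′} → g′ ≈ h′ → ∀ k″ {g″ h″} → g″ ≈ h″ →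
        x - y ≈ k * (g - h) + k′ * (g′ - h′) + k″ * (g″ - h″) → x ≈ y
  by₃ k p k′ p′ k″ p″ e = by₂ k p k′ p′ (trans e (trans (+-congˡ (trans (*-congˡ (≡⇒-≡0 p″)) (zeroʳ k″))) (+-identityʳ _)))

open import Algebra.Structures using (IsCommutativeRing)
open import Data.Bool using (Bool; true; false; not; _∧_; _∨_; _xor_; if_then_else_)
open import Data.Bool.ListAction using (all; any)
open import Data.Empty using (⊥; ⊥-elim)
open import Data.Fin as Fin using (Fin; zero; suc)
open import Data.Fin.Patterns
import Data.Fin.Properties as Finₚ
open import Data.List as List using (List; []; _∷_; length; concatMap)
import Data.List.Properties as Listₚ
open import Data.List.Membership.Propositional using (_∈_; _∉_)
open import Data.List.Membership.Propositional.Properties using (∈-map⁺; ∈-++⁺ˡ; ∈-++⁺ʳ; ∈-concatMap⁺; ∈-tabulate⁺; ∈-lookup)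
import Data.List.Membership.DecPropositional as DecMembership
open import Data.List.Membership.Setoid.Properties using (index-injective)
open import Data.List.Relation.Unary.All as All using (All; []; _∷_)
open import Data.List.Relation.Unary.All.Properties using (¬Any⇒All¬)
open import Data.List.Relation.Unary.AllPairs using ([]; _∷_)
open import Data.List.Relation.Unary.Any as Any using (here; there; index)
open import Data.List.Relation.Unary.Unique.Propositional using (Unique)
open import Data.Nat as ℕ using (ℕ)
import Data.Nat.Properties as ℕₚ
import Data.Nat.Solver
open import Data.Product using (_,_; proj₁; proj₂)
open import Data.Product.Properties using (≡-dec)
open import Data.Sum using (inj₁; inj₂)
open import Data.Unit using (⊤; tt)
open import Data.Vec as Vec using (Vec; []; _∷_; lookup; _++_)
import Data.Vec.Properties as Vecₚ
open import Data.Vec.N-ary using (N-ary; Eq; Eqʰ; curryⁿ)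
open import Function.Bundles using (Inverse)
open import Function.Definitions using (Injective)
open import Relation.Binary.Definitions using (DecidableEquality)
open import Relation.Binary.PropositionalEquality using (_≡_; refl; sym; trans; cong; cong₂; subst; subst₂; setoid; isEquivalence)
import Relation.Binary.Reflection
open import Relation.Nullary using (Dec; yes; no; ¬?)
open import Relation.Nullary.Decidable using (decidable-stable)

-- Pigeonhole arguments

module _ {A : Set} (_≟_ : DecidableEquality A) {n} (elements : Fin n → A) (elements-injective : Injective _≡_ _≡_ elements) where
  open DecMembership _≟_ using (_∈?_)

  -- Otherwise the positions of the elements in xs would inject `Fin n` into fewer than n positions.
  short-list-misses : ∀ xs → length xs ℕ.< n → Σ A (_∉ xs)
  short-list-misses xs short with Finₚ.any? (λ i → ¬? (elements i ∈? xs))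
  ... | yes (i , i∉) = elements i , i∉
  ... | no  all∈     = ⊥-elim (ℕₚ.<⇒≱ short (Finₚ.injective⇒≤ {f = λ i → index (member i)} position-injective))
    where
    member : ∀ i → elements i ∈ xs
    member i = decidable-stable (elements i ∈? xs) (λ i∉ → all∈ (i , i∉))
    position-injective : Injective _≡_ _≡_ (λ i → index (member i))
    position-injective {i} {j} e = elements-injective (index-injective (setoid A) (member i) (member j) e)

-- A missed value, taken as the image of one additional point, would give an injection of n + 1
-- points into n.
injective⇒surjective : ∀ {n} (f : Fin n → Fin n) → Injective _≡_ _≡_ f → ∀ y → Σ (Fin n) λ x → f x ≡ y
injective⇒surjective {n} f f-injective y with Finₚ.any? (λ x → f x Finₚ.≟ y)
... | yes found = found
... | no  none  = ⊥-elim (ℕₚ.1+n≰n (Finₚ.injective⇒≤ {f = extended} extended-injective))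
  where
  extended : Fin (ℕ.suc n) → Fin n
  extended zero    = y
  extended (suc i) = f i
  extended-injective : Injective _≡_ _≡_ extended
  extended-injective {zero}  {zero}  _ = refl
  extended-injective {zero}  {suc j} e = ⊥-elim (none (j , sym e))
  extended-injective {suc i} {zero}  e = ⊥-elim (none (i , e))
  extended-injective {suc i} {suc j} e = cong suc (f-injective e)

-- Fields with an involution

data Term (n : ℕ) : Set where
  var          : Fin n → Term n
  _∔_ _·_ _⊖_  : Term n → Term n → Term n
  ⊝_ conj      : Term n → Term n
  `0 `1        : Term n

infixl 6 _∔_ _⊖_
infixl 7 _·_
infix  8 ⊝_

norm : ∀ {n} → Term n → Term n
norm t = t · conj t

record StarField : Set₁ where
  infixl 7 _*_
  infixl 6 _+_ _-_
  infix  8 -_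
  infix  9 _⁻¹
  field
    K       : Set
    _+_ _*_ : K → K → K
    -_      : K → K
    0# 1#   : K
    _⁻¹     : K → K
    bar     : K → K
    isCommutativeRing : IsCommutativeRing _≡_ _+_ _*_ -_ 0# 1#
    0≢1       : 0# ≢ 1#
    *-inverse : ∀ {x} → x ≢ 0# → x * x ⁻¹ ≡ 1#
    bar-+     : ∀ x y → bar (x + y) ≡ bar x + bar y
    bar-*     : ∀ x y → bar (x * y) ≡ bar x * bar y
    bar--     : ∀ x → bar (- x) ≡ - bar x
    bar-1     : bar 1# ≡ 1#
    bar-bar   : ∀ x → bar (bar x) ≡ x
    _≟_       : DecidableEquality K
    θ         : K
    θ-moved   : bar θ ≢ θ

  _-_ : K → K → K
  x - y = x + (- y)

  N : K → K
  N x = x * bar x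

  commutativeRing : CommutativeRing 0ℓ 0ℓ
  commutativeRing = record { isCommutativeRing = isCommutativeRing }

-- Identities between terms with conjugation

module StarSolver (S : StarField) where
  open StarField S
  module CR = CommutativeRing commutativeRing
  module D = DifferenceSolver commutativeRing
  open D using (Polynomial)
  open import Algebra.Properties.Ring CR.ring using (-0#≈0#)

  bar-0 : bar 0# ≡ 0#
  bar-0 = trans (sym (CR.+-identityʳ (bar 0#))) (trans (cong (bar 0# +_) (sym (CR.-‿inverseʳ (bar 0#))))
    (trans (sym (CR.+-assoc (bar 0#) (bar 0#) (- bar 0#))) (trans (cong (_+ - bar 0#) (trans (sym (bar-+ 0# 0#)) (cong bar (CR.+-identityʳ 0#)))) (CR.-‿inverseʳ (bar 0#)))))

  ⟦_⟧ : ∀ {n} → Term n → Vec K n → K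
  ⟦ var i ⟧ ρ  = lookup ρ i
  ⟦ s ∔ t ⟧ ρ  = ⟦ s ⟧ ρ + ⟦ t ⟧ ρ
  ⟦ s · t ⟧ ρ  = ⟦ s ⟧ ρ * ⟦ t ⟧ ρ
  ⟦ s ⊖ t ⟧ ρ  = ⟦ s ⟧ ρ - ⟦ t ⟧ ρ
  ⟦ ⊝ t ⟧ ρ    = - ⟦ t ⟧ ρ
  ⟦ conj t ⟧ ρ = bar (⟦ t ⟧ ρ)
  ⟦ `0 ⟧ ρ     = 0#
  ⟦ `1 ⟧ ρ     = 1#

  private
    module RS = D.Full

    pick : Bool → K → K
    pick false x = x
    pick true  x = bar x

    -- Variable i and its conjugate become the variables i and n + i.
    push : ∀ {n} → Bool → Term n → Polynomial (n ℕ.+ n)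
    push {n} false (var i) = RS.var (i Fin.↑ˡ n)
    push {n} true  (var i) = RS.var (n Fin.↑ʳ i)
    push b (s ∔ t)  = push b s D.:+ push b t
    push b (s · t)  = push b s D.:* push b t
    push b (s ⊖ t)  = push b s D.:- push b t
    push b (⊝ t)    = D.:- push b t
    push b (conj t) = push (not b) t
    push b `0       = D.:0
    push b `1       = D.:1

    double : ∀ {n} → Vec K n → Vec K (n ℕ.+ n)
    double ρ = ρ ++ Vec.map bar ρ

    push-correct : ∀ {n} b (t : Term n) ρ → RS.⟦ push b t ⟧ (double ρ) ≡ pick b (⟦ t ⟧ ρ)
    push-correct false (var i) ρ = Vecₚ.lookup-++ˡ ρ (Vec.map bar ρ) i
    push-correct true  (var i) ρ = trans (Vecₚ.lookup-++ʳ ρ (Vec.map bar ρ) i) (Vecₚ.lookup-map i bar ρ)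
    push-correct false (s ∔ t) ρ = cong₂ _+_ (push-correct false s ρ) (push-correct false t ρ)
    push-correct true  (s ∔ t) ρ = trans (cong₂ _+_ (push-correct true s ρ) (push-correct true t ρ)) (sym (bar-+ _ _))
    push-correct false (s · t) ρ = cong₂ _*_ (push-correct false s ρ) (push-correct false t ρ)
    push-correct true  (s · t) ρ = trans (cong₂ _*_ (push-correct true s ρ) (push-correct true t ρ)) (sym (bar-* _ _))
    push-correct false (s ⊖ t) ρ = cong₂ _-_ (push-correct false s ρ) (push-correct false t ρ)
    push-correct true  (s ⊖ t) ρ = trans (cong₂ _-_ (push-correct true s ρ) (push-correct true t ρ))
                                         (sym (trans (bar-+ _ _) (cong (bar (⟦ s ⟧ ρ) +_) (bar-- _))))
    push-correct false (⊝ t) ρ = cong -_ (push-correct false t ρ)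
    push-correct true  (⊝ t) ρ = trans (cong -_ (push-correct true t ρ)) (sym (bar-- _))
    push-correct false (conj t) ρ = push-correct true t ρ
    push-correct true  (conj t) ρ = trans (push-correct false t ρ) (sym (bar-bar _))
    push-correct false `0 ρ = refl
    push-correct true  `0 ρ = sym bar-0
    push-correct false `1 ρ = refl
    push-correct true  `1 ρ = sym bar-1

    normal : ∀ {n} → Term n → Vec K n → K
    normal t ρ = RS.⟦ push false t ⟧↓ (double ρ)

    normal-correct : ∀ {n} (t : Term n) ρ → normal t ρ ≡ ⟦ t ⟧ ρ
    normal-correct t ρ = trans (RS.correct (push false t) (double ρ)) (push-correct false t ρ)

    module Reflective = Relation.Binary.Reflection (setoid K) var ⟦_⟧ normal normal-correct

  infix 4 _≋_
  _≋_ : ∀ {n} → Term n → Term n → Term n × Term n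
  _≋_ = _,_

  -- Abstract, so that proofs are not unfolded when other terms are normalised.
  abstract
    solve : ∀ n (f : N-ary n (Term n) (Term n × Term n)) →
      Eqʰ n _≡_ (curryⁿ (normal (proj₁ (Reflective.close n f)))) (curryⁿ (normal (proj₂ (Reflective.close n f)))) →
      Eq n _≡_ (curryⁿ ⟦ proj₁ (Reflective.close n f) ⟧) (curryⁿ ⟦ proj₂ (Reflective.close n f) ⟧)
    solve = Reflective.solve

module FieldLemmas (S : StarField) where
  open StarField S
  open StarSolver S

  open D public using (≡⇒-≡0; -≡0⇒≡; by₁; by₂; by₃)

  no-zero-divisors : ∀ {x y} → x ≢ 0# → x * y ≡ 0# → y ≡ 0#
  no-zero-divisors {x} {y} x≢0 h = by₂ (- y) (*-inverse x≢0) (x ⁻¹) h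
    (solve 3 (λ x y i → y ⊖ `0 ≋ ⊝ y · (x · i ⊖ `1) ∔ i · (x · y ⊖ `0)) refl x y (x ⁻¹))

  *-≢0 : ∀ {x y} → x ≢ 0# → y ≢ 0# → x * y ≢ 0#
  *-≢0 x≢0 y≢0 h = y≢0 (no-zero-divisors x≢0 h)

  *-cancelˡ : ∀ {x y z} → x ≢ 0# → x * y ≡ x * z → y ≡ z
  *-cancelˡ {x} {y} {z} x≢0 h = -≡0⇒≡ (no-zero-divisors x≢0
    (trans (solve 3 (λ x y z → x · (y ⊖ z) ≋ x · y ⊖ x · z) refl x y z) (≡⇒-≡0 h)))

  -≢0 : ∀ {x y} → x ≢ y → x - y ≢ 0#
  -≢0 x≢y h = x≢y (-≡0⇒≡ h)

  neg-≢0 : ∀ {x} → x ≢ 0# → - x ≢ 0#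
  neg-≢0 {x} x≢0 h = x≢0 (by₁ (- 1#) h (solve 1 (λ x → x ⊖ `0 ≋ ⊝ `1 · (⊝ x ⊖ `0)) refl x))

  ⁻¹-≢0 : ∀ {x} → x ≢ 0# → x ⁻¹ ≢ 0#
  ⁻¹-≢0 {x} x≢0 h = 0≢1 (trans (sym (CR.zeroʳ x)) (trans (cong (x *_) (sym h)) (*-inverse x≢0)))

  bar-≢0 : ∀ {x} → x ≢ 0# → bar x ≢ 0#
  bar-≢0 {x} x≢0 h = x≢0 (trans (sym (bar-bar x)) (trans (cong bar h) bar-0))

  N-≢0 : ∀ {x} → x ≢ 0# → N x ≢ 0#
  N-≢0 x≢0 = *-≢0 x≢0 (bar-≢0 x≢0)

  N≡0⇒≡0 : ∀ {x} → N x ≡ 0# → x ≡ 0#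
  N≡0⇒≡0 {x} h with x ≟ 0#
  ... | yes e = e
  ... | no ¬e = ⊥-elim (N-≢0 ¬e h)

  N0≡0 : N 0# ≡ 0#
  N0≡0 = CR.zeroˡ _

  1≢0 : 1# ≢ 0#
  1≢0 h = 0≢1 (sym h)

  unit-≢0 : ∀ {x} → N x ≡ 1# → x ≢ 0#
  unit-≢0 h refl = 0≢1 (trans (sym N0≡0) h)

-- The Hall plane in coordinates; the lines of NBF are the linear ones, those of BF the semilinear ones.
module Plane (S : StarField) where
  open StarField S
  open StarSolver S
  open FieldLemmas S

  -- The vector (q , - p) spans the line p x + q y = κ, so N p ≠ N q says that it is not null for N
  -- x - N y. Differences of points on a semilinear line are always null.
  data Direction : Set where
    linear     : (p q : K) → N p ≢ N q → Direction
    semilinear : (ε : K) → N ε ≡ 1# → Direction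

  On : K × K → Direction → K → Set
  On (x , y) (linear p q _)   κ = p * x + q * y ≡ κ
  On (x , y) (semilinear ε _) κ = y ≡ ε * bar x + κ

  data ProjectiveLine : Set where
    affine   : Direction → K → ProjectiveLine
    infinity : ProjectiveLine

  PointOn : K × K → ProjectiveLine → Set
  PointOn P (affine d κ) = On P d κ
  PointOn P infinity     = ⊥

  -- Coefficients are compared literally, not up to a factor: an affine axis is always written with
  -- the coefficients of the joins parallel to it.
  DirectionOn : Direction → ProjectiveLine → Set
  DirectionOn d                (infinity)                    = ⊤
  DirectionOn (linear p q _)   (affine (linear p′ q′ _) _)   = p ≡ p′ × q ≡ q′
  DirectionOn (semilinear ε _) (affine (semilinear ε′ _) _)  = ε ≡ ε′
  DirectionOn (linear _ _ _)   (affine (semilinear _ _) _)   = ⊥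
  DirectionOn (semilinear _ _) (affine (linear _ _ _) _)     = ⊥

  data Meet (X Y Z W : K × K) (n : ProjectiveLine) : Set where
    at-point : ∀ d κ e l P → On X d κ → On Y d κ → On Z e l → On W e l → On P d κ → On P e l → PointOn P n → Meet X Y Z W n
    parallel : ∀ d κ l → On X d κ → On Y d κ → On Z d l → On W d l → DirectionOn d n → Meet X Y Z W n

  Meet-swap : ∀ {X Y Z W n} → Meet X Y Z W n → Meet W Z Y X n
  Meet-swap (at-point d κ e l P x y z w p p′ n) = at-point e l d κ P w z y x p′ p n
  Meet-swap (parallel d κ l x y z w n)         = parallel d l κ w z y x n

  -- `Q` collects the demands on A′, B′, C′, namely to lie on the second line and off the first. A
  -- map that respects joins then transports a configuration as soon as it respects `Q`.
  record Config (Q : K × K → Set) (A B C : K × K) : Set where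
    constructor config
    field
      A′ B′ C′    : K × K
      A′∈ : Q A′
      B′∈ : Q B′
      C′∈ : Q C′
      A′≢B′ : A′ ≢ B′
      A′≢C′ : A′ ≢ C′
      B′≢C′ : B′ ≢ C′
      axis : ProjectiveLine
      AB : Meet A B′ A′ B axis
      AC : Meet A C′ A′ C axis
      BC : Meet B C′ B′ C axis

  swap₁₂ : ∀ {Q A B C} → Config Q A B C → Config Q B A C
  swap₁₂ (config A′ B′ C′ a b c ab ac bc n AB AC BC) =
    config B′ A′ C′ b a c (λ e → ab (sym e)) bc ac n (Meet-swap AB) BC AC

  swap₂₃ : ∀ {Q A B C} → Config Q A B C → Config Q A C B
  swap₂₃ (config A′ B′ C′ a b c ab ac bc n AB AC BC) =
    config A′ C′ B′ a c b ac ab (λ e → bc (sym e)) n AC AB (Meet-swap BC)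

  parallel-linear : ∀ {x y x′ y′ z w z′ w′ n} → N (x′ - x) ≢ N (y′ - y) →
    (x′ - x) * (w′ - w) ≡ (y′ - y) * (z′ - z) → (∀ nr → DirectionOn (linear (y′ - y) (- (x′ - x)) nr) n) → Meet (x , y) (x′ , y′) (z , w) (z′ , w′) n
  parallel-linear {x} {y} {x′} {y′} {z} {w} {z′} {w′} D∉ prop n∋ =
    parallel (linear (y′ - y) (- (x′ - x)) N≢) ((y′ - y) * x + (- (x′ - x)) * y) ((y′ - y) * z + (- (x′ - x)) * w)
      refl
      (solve 4 (λ x y x′ y′ → (y′ ⊖ y) · x′ ∔ (⊝ (x′ ⊖ x)) · y′ ≋ (y′ ⊖ y) · x ∔ (⊝ (x′ ⊖ x)) · y) refl x y x′ y′)
      refl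
      (by₁ (- 1#) prop (solve 6 (λ d e z w z′ w′ → (e · z′ ∔ (⊝ d) · w′) ⊖ (e · z ∔ (⊝ d) · w) ≋ ⊝ `1 · (d · (w′ ⊖ w) ⊖ e · (z′ ⊖ z))) refl (x′ - x) (y′ - y) z w z′ w′))
      (n∋ _)
    where
    N≢ : N (y′ - y) ≢ N (- (x′ - x))
    N≢ h = D∉ (trans (solve 1 (λ d → norm d ≋ norm (⊝ d)) refl (x′ - x)) (sym h))

  parallel-semilinear : ∀ {x y x′ y′ z w z′ w′ n} ε → N ε ≡ 1# →
    y′ - y ≡ ε * bar (x′ - x) → w′ - w ≡ ε * bar (z′ - z) → (∀ u → DirectionOn (semilinear ε u) n) → Meet (x , y) (x′ , y′) (z , w) (z′ , w′) n
  parallel-semilinear {x} {y} {x′} {y′} {z} {w} {z′} {w′} ε unit D E n∋ =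
    parallel (semilinear ε unit) (y - ε * bar x) (w - ε * bar z) (start-on x y) (end-on x y x′ y′ D) (start-on z w) (end-on z w z′ w′ E) (n∋ _)
    where
    start-on : ∀ x y → y ≡ ε * bar x + (y - ε * bar x)
    start-on x y = solve 3 (λ x y ε → y ≋ ε · conj x ∔ (y ⊖ ε · conj x)) refl x y ε
    end-on : ∀ x y x′ y′ → y′ - y ≡ ε * bar (x′ - x) → y′ ≡ ε * bar x′ + (y - ε * bar x)
    end-on x y x′ y′ h = by₁ 1# h (solve 5 (λ x y x′ y′ ε → y′ ⊖ (ε · conj x′ ∔ (y ⊖ ε · conj x)) ≋ `1 · ((y′ ⊖ y) ⊖ ε · conj (x′ ⊖ x))) refl x y x′ y′ ε)

  meet-linear : ∀ {x y x′ y′ z w z′ w′ n} ρ σ px py → N (x′ - x) ≢ N (y′ - y) → N (z′ - z) ≢ N (w′ - w) →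
    px ≡ x + ρ * (x′ - x) → py ≡ y + ρ * (y′ - y) → px ≡ z + σ * (z′ - z) → py ≡ w + σ * (w′ - w) →
    PointOn (px , py) n → Meet (x , y) (x′ , y′) (z , w) (z′ , w′) n
  meet-linear {x} {y} {x′} {y′} {z} {w} {z′} {w′} ρ σ px py D∉ E∉ e₁ e₂ e₃ e₄ n∋ =
    at-point (linear (y′ - y) (- (x′ - x)) (N≢ D∉)) _ (linear (w′ - w) (- (z′ - z)) (N≢ E∉)) _ (px , py)
      refl (end x y x′ y′) refl (end z w z′ w′) (mid x y x′ y′ ρ e₁ e₂) (mid z w z′ w′ σ e₃ e₄) n∋
    where
    N≢ : ∀ {d e} → N d ≢ N e → N e ≢ N (- d)
    N≢ {d} D∉ h = D∉ (trans (solve 1 (λ d → norm d ≋ norm (⊝ d)) refl d) (sym h))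
    end : ∀ x y x′ y′ → (y′ - y) * x′ + (- (x′ - x)) * y′ ≡ (y′ - y) * x + (- (x′ - x)) * y
    end = solve 4 (λ x y x′ y′ → (y′ ⊖ y) · x′ ∔ (⊝ (x′ ⊖ x)) · y′ ≋ (y′ ⊖ y) · x ∔ (⊝ (x′ ⊖ x)) · y) refl
    mid : ∀ x y x′ y′ ρ → px ≡ x + ρ * (x′ - x) → py ≡ y + ρ * (y′ - y) →
          (y′ - y) * px + (- (x′ - x)) * py ≡ (y′ - y) * x + (- (x′ - x)) * y
    mid x y x′ y′ ρ e₁ e₂ rewrite e₁ | e₂ =
      solve 5 (λ x y x′ y′ ρ → (y′ ⊖ y) · (x ∔ ρ · (x′ ⊖ x)) ∔ (⊝ (x′ ⊖ x)) · (y ∔ ρ · (y′ ⊖ y)) ≋ (y′ ⊖ y) · x ∔ (⊝ (x′ ⊖ x)) · y) refl x y x′ y′ ρ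

-- Pappus configurations for lines in normal form

module Configurations (S : StarField) where
  open StarField S
  open StarSolver S
  open FieldLemmas S
  open Plane S

  fst-≢ : ∀ {x y x′ y′ : K} → x ≢ x′ → (x , y) ≢ (x′ , y′)
  fst-≢ h e = h (cong proj₁ e)

  snd-≢ : ∀ {x y x′ y′ : K} → y ≢ y′ → (x , y) ≢ (x′ , y′)
  snd-≢ h e = h (cong proj₂ e)

  -- The quotient e / d̄ has norm N e / N d = 1. Hence points whose difference (d , e) is null lie
  -- on a common semilinear line.
  equal-norms : ∀ {d e} → d ≢ 0# → N d ≡ N e → Σ K λ ε → N ε ≡ 1# × e ≡ ε * bar d
  equal-norms {d} {e} d≢0 h = e * i , unit , by₁ (- e) inv
      (solve 3 (λ d e i → e ⊖ (e · i) · conj d ≋ ⊝ e · (conj d · i ⊖ `1)) refl d e i)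
    where
    i = bar d ⁻¹
    inv = *-inverse (bar-≢0 d≢0)
    unit : N (e * i) ≡ 1#
    unit = by₃ (- N i) h (d * bar i) inv 1# (trans (cong bar inv) bar-1)
      (solve 3 (λ d e i → norm (e · i) ⊖ `1 ≋ ⊝ norm i · (norm d ⊖ norm e) ∔ (d · conj i) · (conj d · i ⊖ `1) ∔ `1 · (conj (conj d · i) ⊖ `1)) refl d e i)

  bar-⁻¹ : ∀ {d i} → bar d ≡ d → d * i ≡ 1# → bar i ≡ i
  bar-⁻¹ {d} {i} fixed inv = by₃ (- bar i) inv i (trans (cong bar inv) bar-1) (- (i * bar i)) fixed
    (solve 2 (λ d i → conj i ⊖ i ≋ ⊝ conj i · (d · i ⊖ `1) ∔ i · (conj (d · i) ⊖ `1) ∔ ⊝ (i · conj i) · (conj d ⊖ d)) refl d i)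

  -- The point reflection A ↦ T - A exchanges the lines A B′ and A′ B, so these are parallel.
  reflected-meet : ∀ {a₁ a₂ b₁ b₂ t₁ t₂} → (a₁ , a₂) ≢ (t₁ - b₁ , t₂ - b₂) →
    Meet (a₁ , a₂) (t₁ - b₁ , t₂ - b₂) (t₁ - a₁ , t₂ - a₂) (b₁ , b₂) infinity
  reflected-meet {a₁} {a₂} {b₁} {b₂} {t₁} {t₂} A≢B′ with N ((t₁ - b₁) - a₁) ≟ N ((t₂ - b₂) - a₂)
  ... | no  D∉ = parallel-linear D∉
          (solve 6 (λ a b t a′ b′ t′ → ((t ⊖ b) ⊖ a) · (b′ ⊖ (t′ ⊖ a′)) ≋ ((t′ ⊖ b′) ⊖ a′) · (b ⊖ (t ⊖ a))) refl a₁ b₁ t₁ a₂ b₂ t₂) (λ _ → tt)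
  ... | yes h with ((t₁ - b₁) - a₁) ≟ 0#
  ...   | yes z = ⊥-elim (A≢B′ (cong₂ _,_ (sym (-≡0⇒≡ z)) (sym (-≡0⇒≡ (N≡0⇒≡0 (trans (sym h) (trans (cong N z) N0≡0)))))))
  ...   | no D≢0 with ε , unit , e ← equal-norms D≢0 h =
          parallel-semilinear ε unit e (by₁ (- 1#) e
            (solve 7 (λ a b t a′ b′ t′ ε → (b′ ⊖ (t′ ⊖ a′)) ⊖ ε · conj (b ⊖ (t ⊖ a)) ≋ ⊝ `1 · (((t′ ⊖ b′) ⊖ a′) ⊖ ε · conj ((t ⊖ b) ⊖ a))) refl a₁ b₁ t₁ a₂ b₂ t₂ ε))
            (λ _ → tt)

  reflected : ∀ {Q a₁ a₂ b₁ b₂ c₁ c₂} t₁ t₂ → ¬ Q (a₁ , a₂) → ¬ Q (b₁ , b₂) → ¬ Q (c₁ , c₂) →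
    Q (t₁ - a₁ , t₂ - a₂) → Q (t₁ - b₁ , t₂ - b₂) → Q (t₁ - c₁ , t₂ - c₂) →
    (a₁ , a₂) ≢ (b₁ , b₂) → (a₁ , a₂) ≢ (c₁ , c₂) → (b₁ , b₂) ≢ (c₁ , c₂) →
    Config Q (a₁ , a₂) (b₁ , b₂) (c₁ , c₂)
  reflected {Q} t₁ t₂ a∉ b∉ c∉ a∈ b∈ c∈ ab ac bc = config _ _ _ a∈ b∈ c∈ (diff ab) (diff ac) (diff bc) infinity
      (reflected-meet (λ e → a∉ (subst Q (sym e) b∈))) (reflected-meet (λ e → a∉ (subst Q (sym e) c∈)))
      (reflected-meet (λ e → b∉ (subst Q (sym e) c∈)))
    where
    undo : ∀ t x y → t - x ≡ t - y → x ≡ y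
    undo t x y h = by₁ (- 1#) h (solve 3 (λ t x y → x ⊖ y ≋ ⊝ `1 · ((t ⊖ x) ⊖ (t ⊖ y))) refl t x y)
    diff : ∀ {x₁ x₂ y₁ y₂} → (x₁ , x₂) ≢ (y₁ , y₂) → (t₁ - x₁ , t₂ - x₂) ≢ (t₁ - y₁ , t₂ - y₂)
    diff xy e = xy (cong₂ _,_ (undo t₁ _ _ (cong proj₁ e)) (undo t₂ _ _ (cong proj₂ e)))

  -- The lines y = 0 and x = 0 are exchanged by (x , y) ↦ (ȳ , x̄), whose fixed points form the line y = x̄.
  module Conjugate where
    1-unit : N 1# ≡ 1#
    1-unit = trans (CR.*-identityˡ (bar 1#)) bar-1

    axis : ProjectiveLine
    axis = affine (semilinear 1# 1-unit) 0#

    on-axis : ∀ p → PointOn (p , bar p) axis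
    on-axis p = solve 1 (λ p → conj p ≋ `1 · conj p ∔ `0) refl p

    -- The exchange takes (a , 0) to (0 , ā) and (0 , b̄) to (b , 0), so it swaps A B′ with A′ B,
    -- and a common point that it fixes lies on the axis. The joins are linear if N a ≠ N b and
    -- semilinear otherwise; in the latter case a + b = 0 makes them parallel to the axis.
    meet : ∀ {a b} → a ≢ 0# → b ≢ 0# → Meet (a , 0#) (0# , bar b) (0# , bar a) (b , 0#) axis
    meet {a} {b} a≢0 b≢0 with N a ≟ N b
    ... | no Na≢Nb = meet-linear (bar a * (b - a) * bar j) (a * (bar b - bar a) * j) p (bar p)
          (λ h → Na≢Nb (trans (solve 1 (λ a → norm a ≋ norm (`0 ⊖ a)) refl a) (trans h (solve 1 (λ b → norm (conj b ⊖ `0) ≋ norm b) refl b))))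
          (λ h → Na≢Nb (trans (solve 1 (λ a → norm a ≋ norm (`0 ⊖ conj a)) refl a) (trans (sym h) (solve 1 (λ b → norm (b ⊖ `0) ≋ norm b) refl b))))
          (by₂ a inv (a * bar a * (b - a)) j-fixed
            (solve 3 (λ a b j → a · b · (conj b ⊖ conj a) · j ⊖ (a ∔ conj a · (b ⊖ a) · conj j · (`0 ⊖ a)) ≋
              a · ((norm b ⊖ norm a) · j ⊖ `1) ∔ a · conj a · (b ⊖ a) · (conj j ⊖ j)) refl a b j))
          (solve 3 (λ a b j → conj (a · b · (conj b ⊖ conj a) · j) ≋ `0 ∔ conj a · (b ⊖ a) · conj j · (conj b ⊖ `0)) refl a b j)
          (solve 3 (λ a b j → a · b · (conj b ⊖ conj a) · j ≋ `0 ∔ a · (conj b ⊖ conj a) · j · (b ⊖ `0)) refl a b j)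
          (by₂ (bar a) inv (bar a * bar b * (b - a)) j-fixed
            (solve 3 (λ a b j → conj (a · b · (conj b ⊖ conj a) · j) ⊖ (conj a ∔ a · (conj b ⊖ conj a) · j · (`0 ⊖ conj a)) ≋
              conj a · ((norm b ⊖ norm a) · j ⊖ `1) ∔ conj a · conj b · (b ⊖ a) · (conj j ⊖ j)) refl a b j))
          (on-axis p)
        where
        j = (N b - N a) ⁻¹
        -- The solution of x / a + y / b̄ = 1 and x / b + y / ā = 1, the equations of the two joins.
        p = a * b * (bar b - bar a) * j
        inv : (N b - N a) * j ≡ 1#
        inv = *-inverse (-≢0 (λ h → Na≢Nb (sym h)))
        j-fixed : bar j ≡ j
        j-fixed = bar-⁻¹ (solve 2 (λ a b → conj (norm b ⊖ norm a) ≋ norm b ⊖ norm a) refl a b) inv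
    ... | yes Na≡Nb with (a + b) ≟ 0#
    ...   | yes a+b≡0 = parallel-semilinear 1# 1-unit
            (by₁ 1# (cong bar a+b≡0) (solve 2 (λ a b → (conj b ⊖ `0) ⊖ `1 · conj (`0 ⊖ a) ≋ `1 · (conj (a ∔ b) ⊖ conj `0)) refl a b))
            (by₁ (- 1#) (cong bar a+b≡0) (solve 2 (λ a b → (`0 ⊖ conj a) ⊖ `1 · conj (b ⊖ `0) ≋ ⊝ `1 · (conj (a ∔ b) ⊖ conj `0)) refl a b))
            (λ _ → refl)
    ...   | no a+b≢0 = at-point
              (semilinear (ε a b) (ε-unit a≢0 Na≡Nb)) (bar b) (semilinear (ε b a) (ε-unit b≢0 (sym Na≡Nb))) (bar a) (p , bar p)
              (first a≢0) second second (first b≢0)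
              (third a≢0)
              (trans (cong bar p-comm) (trans (third′ b≢0) (cong (λ z → ε b a * z + bar a) (cong bar (sym p-comm)))))
              (on-axis p)
        where
        s = (a + b) ⁻¹
        -- At a point (p , p̄) both semilinear equations reduce to p (a + b) = a b.
        p = a * b * s
        ε : K → K → K
        ε x y = - (bar y * bar x ⁻¹)
        ε-unit : ∀ {x y} → x ≢ 0# → N x ≡ N y → N (ε x y) ≡ 1#
        ε-unit {x} {y} x≢0 h = by₃ (- N i) h (x * bar i) inv 1# (trans (cong bar inv) bar-1)
          (solve 3 (λ x y i → norm (⊝ (conj y · i)) ⊖ `1 ≋ ⊝ norm i · (norm x ⊖ norm y) ∔ (x · conj i) · (conj x · i ⊖ `1) ∔ `1 · (conj (conj x · i) ⊖ `1)) refl x y i)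
          where
          i = bar x ⁻¹
          inv = *-inverse (bar-≢0 x≢0)
        first : ∀ {x y} → x ≢ 0# → 0# ≡ ε x y * bar x + bar y
        first {x} {y} x≢0 = by₁ (bar y) (*-inverse (bar-≢0 x≢0))
          (solve 3 (λ x y i → `0 ⊖ (⊝ (conj y · i) · conj x ∔ conj y) ≋ conj y · (conj x · i ⊖ `1)) refl x y (bar x ⁻¹))
        second : ∀ {x y} → bar y ≡ ε x y * bar 0# + bar y
        second {x} {y} = solve 2 (λ y e → conj y ≋ e · conj `0 ∔ conj y) refl y (ε x y)
        on-line : ∀ {x y s} → x ≢ 0# → (x + y) * s ≡ 1# → bar (x * y * s) ≡ ε x y * bar (x * y * s) + bar y
        on-line {x} {y} {s} x≢0 inv = by₂ (bar y) (trans (cong bar inv) bar-1) (bar y * bar y * bar s) (*-inverse (bar-≢0 x≢0))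
          (solve 4 (λ x y s i → conj (x · y · s) ⊖ (⊝ (conj y · i) · conj (x · y · s) ∔ conj y) ≋
             conj y · (conj ((x ∔ y) · s) ⊖ `1) ∔ conj y · conj y · conj s · (conj x · i ⊖ `1)) refl x y s (bar x ⁻¹))
        third : a ≢ 0# → bar p ≡ ε a b * bar p + bar b
        third a≢0 = on-line a≢0 (*-inverse a+b≢0)
        third′ : b ≢ 0# → bar (b * a * s) ≡ ε b a * bar (b * a * s) + bar a
        third′ b≢0 = on-line b≢0 (trans (cong (_* s) (CR.+-comm b a)) (*-inverse a+b≢0))
        p-comm : p ≡ b * a * s
        p-comm = cong (_* s) (CR.*-comm a b)

    conjugate : ∀ {a b c} → a ≢ 0# → b ≢ 0# → c ≢ 0# → a ≢ b → a ≢ c → b ≢ c →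
      Config (λ (x , y) → x ≡ 0# × y ≢ 0#) (a , 0#) (b , 0#) (c , 0#)
    conjugate a≢0 b≢0 c≢0 ab ac bc = config _ _ _ (refl , bar-≢0 a≢0) (refl , bar-≢0 b≢0) (refl , bar-≢0 c≢0)
        (snd-≢ (bar-≢ ab)) (snd-≢ (bar-≢ ac)) (snd-≢ (bar-≢ bc)) axis (meet a≢0 b≢0) (meet a≢0 c≢0) (meet b≢0 c≢0)
      where
      bar-≢ : ∀ {x y} → x ≢ y → bar x ≢ bar y
      bar-≢ {x} {y} h e = h (trans (sym (bar-bar x)) (trans (cong bar e) (bar-bar y)))

  open Conjugate public using (conjugate)

  -- Vanishes iff x and y are proportional over the fixed field.
  bracket : K → K → K
  bracket x y = x * bar y - bar x * y

  proportional : ∀ {x y} → x ≢ 0# → bracket x y ≡ 0# → Σ K λ α → bar α ≡ α × y ≡ α * x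
  proportional {x} {y} x≢0 h = y * i , fixed , by₁ (- y) inv (solve 3 (λ x y i → y ⊖ y · i · x ≋ ⊝ y · (x · i ⊖ `1)) refl x y i)
    where
    i = x ⁻¹
    inv = *-inverse x≢0
    fixed : bar (y * i) ≡ y * i
    fixed = by₃ (i * bar i) h (- (bar y * bar i)) inv (y * i) (trans (cong bar inv) bar-1)
      (solve 3 (λ x y i → conj (y · i) ⊖ y · i ≋ (i · conj i) · ((x · conj y ⊖ conj x · y) ⊖ `0) ∔ ⊝ (conj y · conj i) · (x · i ⊖ `1) ∔ (y · i) · (conj (x · i) ⊖ `1)) refl x y i)

  -- T is the centre of the map a ↦ λ₀ (T - a) between two semilinear lines; it is admissible if it makes all joins linear.
  Admissible : K → K → K → K → Set
  Admissible T a b c = (bracket (T - a) b ≢ 0# × bracket (T - a) c ≢ 0#) × (bracket (T - b) a ≢ 0# × bracket (T - b) c ≢ 0#) ×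
                       (bracket (T - c) a ≢ 0# × bracket (T - c) b ≢ 0#)

  private
    multiple : ∀ {x k y} → k ≢ 0# → y ≢ 0# → x ≡ k * y → x ≢ 0#
    multiple k≢0 y≢0 e h = *-≢0 k≢0 y≢0 (trans (sym e) h)

    bracket-flip : ∀ {x y} → bracket x y ≢ 0# → bracket y x ≢ 0#
    bracket-flip {x} {y} h = multiple (neg-≢0 1≢0) h (solve 2 (λ x y → y · conj x ⊖ conj y · x ≋ ⊝ `1 · (x · conj y ⊖ conj x · y)) refl x y)

    bracket-flip₀ : ∀ {x y} → bracket x y ≡ 0# → bracket y x ≡ 0#
    bracket-flip₀ {x} {y} h = by₁ (- 1#) h (solve 2 (λ x y → (y · conj x ⊖ conj y · x) ⊖ `0 ≋ ⊝ `1 · ((x · conj y ⊖ conj x · y) ⊖ `0)) refl x y)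

    bracket-trans : ∀ {x y z} → x ≢ 0# → bracket x y ≡ 0# → bracket x z ≡ 0# → bracket y z ≡ 0#
    bracket-trans {x} {y} {z} x≢0 xy xz = no-zero-divisors (bar-≢0 x≢0) (by₂ (bar y) xz (- bar z) xy
      (solve 3 (λ x y z → conj x · (y · conj z ⊖ conj y · z) ⊖ `0 ≋ conj y · ((x · conj z ⊖ conj x · z) ⊖ `0) ∔ ⊝ conj z · ((x · conj y ⊖ conj x · y) ⊖ `0)) refl x y z))

    -- With y = α x, the choice T = α z makes T - y = α (z - x) and T - z = (α - 1) z. All six
    -- brackets become nonzero multiples of `bracket x z`; up to sign the factors are products of α
    -- and 1 - α.
    admissible-one-pair : ∀ {x y z} → x ≢ 0# → y ≢ 0# → x ≢ y → bracket x y ≡ 0# → bracket x z ≢ 0# → Σ K λ T → Admissible T x y z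
    admissible-one-pair {x} {y} {z} x≢0 y≢0 x≢y xy xz with proportional x≢0 xy
    ... | α , fixed , refl = α * z ,
        ( multiple (neg-≢0 (*-≢0 α≢0 α≢0)) xz (by₁ (bar x * z * α - norm′) fixed
            (solve 3 (λ α x z → ((α · z ⊖ x) · conj (α · x) ⊖ conj (α · z ⊖ x) · (α · x)) ⊖ ⊝ (α · α) · (x · conj z ⊖ conj x · z)
               ≋ (conj x · z · α ⊖ (α · x · conj z ∔ x · conj x)) · (conj α ⊖ α)) refl α x z))
        , multiple (neg-≢0 1≢0) xz (by₁ (- (z * bar z)) fixed
            (solve 3 (λ α x z → ((α · z ⊖ x) · conj z ⊖ conj (α · z ⊖ x) · z) ⊖ ⊝ `1 · (x · conj z ⊖ conj x · z) ≋ ⊝ (z · conj z) · (conj α ⊖ α)) refl α x z)) ) ,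
        ( multiple (neg-≢0 α≢0) xz (by₁ (x * bar x - x * bar z) fixed
            (solve 3 (λ α x z → ((α · z ⊖ α · x) · conj x ⊖ conj (α · z ⊖ α · x) · x) ⊖ ⊝ α · (x · conj z ⊖ conj x · z) ≋ (x · conj x ⊖ x · conj z) · (conj α ⊖ α)) refl α x z))
        , multiple (neg-≢0 α≢0) xz (by₁ (bar x * z - z * bar z) fixed
            (solve 3 (λ α x z → ((α · z ⊖ α · x) · conj z ⊖ conj (α · z ⊖ α · x) · z) ⊖ ⊝ α · (x · conj z ⊖ conj x · z) ≋ (conj x · z ⊖ z · conj z) · (conj α ⊖ α)) refl α x z)) ) ,
        ( multiple 1-α≢0 xz (by₁ (- (x * bar z)) fixed
            (solve 3 (λ α x z → ((α · z ⊖ z) · conj x ⊖ conj (α · z ⊖ z) · x) ⊖ (`1 ⊖ α) · (x · conj z ⊖ conj x · z) ≋ ⊝ (x · conj z) · (conj α ⊖ α)) refl α x z))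
        , multiple (*-≢0 α≢0 1-α≢0) xz (by₁ (α * z * bar x - z * bar x - α * x * bar z) fixed
            (solve 3 (λ α x z → ((α · z ⊖ z) · conj (α · x) ⊖ conj (α · z ⊖ z) · (α · x)) ⊖ α · (`1 ⊖ α) · (x · conj z ⊖ conj x · z)
               ≋ (α · z · conj x ⊖ z · conj x ⊖ α · x · conj z) · (conj α ⊖ α)) refl α x z)) )
      where
      norm′ = α * x * bar z + x * bar x
      α≢0 : α ≢ 0#
      α≢0 e = y≢0 (trans (cong (_* x) e) (CR.zeroˡ x))
      1-α≢0 : 1# - α ≢ 0#
      1-α≢0 e = x≢y (by₁ x e (solve 2 (λ α x → x ⊖ α · x ≋ x · ((`1 ⊖ α) ⊖ `0)) refl α x))

  -- If a, b, c are all proportional, T = θ a moves off their common F-line; if no two are, T = 0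
  -- works. Proportionality being transitive, exactly one proportional pair remains.
  admissible : ∀ {a b c} → a ≢ 0# → b ≢ 0# → c ≢ 0# → a ≢ b → a ≢ c → b ≢ c → Σ K λ T → Admissible T a b c
  admissible {a} {b} {c} a≢0 b≢0 c≢0 a≢b a≢c b≢c with bracket a b ≟ 0# | bracket a c ≟ 0#
  ... | yes ab | yes ac = θ * a , (off ab ab b≢0 , off ac ac c≢0) , (off aa (bracket-flip₀ ab) a≢0 , off ac bc c≢0) ,
                                  (off aa (bracket-flip₀ ac) a≢0 , off ab (bracket-flip₀ bc) b≢0)
    where
    aa : bracket a a ≡ 0#
    aa = solve 1 (λ a → a · conj a ⊖ conj a · a ≋ `0) refl a
    bc : bracket b c ≡ 0#
    bc = bracket-trans a≢0 ab ac
    off : ∀ {x y} → bracket a y ≡ 0# → bracket x y ≡ 0# → y ≢ 0# → bracket (θ * a - x) y ≢ 0#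
    off {x} {y} ay xy y≢0 = multiple (-≢0 (λ e → θ-moved (sym e))) (*-≢0 a≢0 (bar-≢0 y≢0)) (by₂ (bar θ) ay (- 1#) xy
      (solve 4 (λ θ a x y → ((θ · a ⊖ x) · conj y ⊖ conj (θ · a ⊖ x) · y) ⊖ (θ ⊖ conj θ) · (a · conj y)
         ≋ conj θ · ((a · conj y ⊖ conj a · y) ⊖ `0) ∔ ⊝ `1 · ((x · conj y ⊖ conj x · y) ⊖ `0)) refl θ a x y))
  ... | yes ab | no ac = admissible-one-pair a≢0 b≢0 a≢b ab ac
  ... | no ab | yes ac with admissible-one-pair a≢0 c≢0 a≢c ac ab
  ...   | T , (xy , xz) , (yx , yz) , (zx , zy) = T , (xz , xy) , (zx , zy) , (yx , yz)
  admissible {a} {b} {c} a≢0 b≢0 c≢0 a≢b a≢c b≢c | no ab | no ac with bracket b c ≟ 0#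
  ... | yes bc with admissible-one-pair b≢0 c≢0 b≢c bc (bracket-flip ab)
  ...   | T , (xy , xz) , (yx , yz) , (zx , zy) = T , (zx , zy) , (xz , xy) , (yz , yx)
  admissible {a} {b} {c} a≢0 b≢0 c≢0 a≢b a≢c b≢c | no ab | no ac | no bc =
      0# , (neg ab , neg ac) , (neg (bracket-flip ab) , neg bc) , (neg (bracket-flip ac) , neg (bracket-flip bc))
    where
    neg : ∀ {x y} → bracket x y ≢ 0# → bracket (0# - x) y ≢ 0#
    neg {x} {y} h = multiple (neg-≢0 1≢0) h (solve 2 (λ x y → (`0 ⊖ x) · conj y ⊖ conj (`0 ⊖ x) · y ≋ ⊝ `1 · (x · conj y ⊖ conj x · y)) refl x y)

  -- The lines y = x̄ and y = (λ₀ / λ̄₀) x̄.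
  module SemilinearPair (λ₀ : K) (moved : bar λ₀ ≢ λ₀) where
    private
      λ≢0 : λ₀ ≢ 0#
      λ≢0 refl = moved bar-0

      λ-1≢0 : λ₀ - 1# ≢ 0#
      λ-1≢0 h = moved (trans (cong bar (-≡0⇒≡ h)) (trans bar-1 (sym (-≡0⇒≡ h))))

      m μ : K
      m = (λ₀ - 1#) ⁻¹
      μ = λ₀ * m

      m-inverse : (λ₀ - 1#) * m ≡ 1#
      m-inverse = *-inverse λ-1≢0

      μ̄≢0 : bar μ ≢ 0#
      μ̄≢0 = bar-≢0 (*-≢0 λ≢0 (⁻¹-≢0 λ-1≢0))

      ε : K
      ε = μ * bar μ ⁻¹

      unit : N ε ≡ 1#
      unit = by₂ (μ * bar j) (*-inverse μ̄≢0) 1# (trans (cong bar (*-inverse μ̄≢0)) bar-1)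
        (solve 2 (λ μ j → norm (μ · j) ⊖ `1 ≋ (μ · conj j) · (conj μ · j ⊖ `1) ∔ `1 · (conj (conj μ · j) ⊖ `1)) refl μ j)
        where j = bar μ ⁻¹

      axis : ProjectiveLine
      axis = affine (semilinear ε unit) 0#

      on-axis : ∀ g → PointOn (μ * g , μ * bar g) axis
      on-axis g = by₁ (- (μ * bar g)) (*-inverse μ̄≢0)
        (solve 3 (λ μ g j → μ · conj g ⊖ (μ · j · conj (μ · g) ∔ `0) ≋ ⊝ (μ · conj g) · (conj μ · j ⊖ `1)) refl μ g (bar μ ⁻¹))

      -- The two norms differ by (λ̄₀ - λ₀) times `bracket g a`. This is why linearity of the joins
      -- is expressed by brackets.
      join : ∀ {g a} → bracket g a ≢ 0# → N (λ₀ * g - a) ≢ N (λ₀ * bar g - bar a)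
      join {g} {a} g∦a h = *-≢0 (-≢0 moved) g∦a (trans
        (solve 3 (λ l g a → (conj l ⊖ l) · (g · conj a ⊖ conj g · a) ≋ norm (l · g ⊖ a) ⊖ norm (l · conj g ⊖ conj a)) refl λ₀ g a)
        (≡⇒-≡0 h))

      join′ : ∀ {g a} → bracket g a ≢ 0# → N (a - λ₀ * g) ≢ N (bar a - λ₀ * bar g)
      join′ {g} {a} g∦a h = join g∦a (trans (flip (λ₀ * g) a) (trans h (flip (bar a) (λ₀ * bar g))))
        where
        flip : ∀ x y → N (x - y) ≡ N (y - x)
        flip = solve 2 (λ x y → norm (x ⊖ y) ≋ norm (y ⊖ x)) refl

      -- Since 1 + m = λ₀ m, the point of A B′ with ratio - m is given by μ (a + b - T). This is
      -- symmetric in a and b, so the point lies on A′ B too, and all such points are on the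
      -- semilinear line through the multiples of μ.
      meet : ∀ {T a b} → bracket (T - b) a ≢ 0# → bracket (T - a) b ≢ 0# →
        Meet (a , bar a) (λ₀ * (T - b) , λ₀ * bar (T - b)) (λ₀ * (T - a) , λ₀ * bar (T - a)) (b , bar b) axis
      meet {T} {a} {b} b′∦a a′∦b = meet-linear (- m) (1# + m) (μ * (a + b - T)) (μ * bar (a + b - T)) (join b′∦a) (join′ a′∦b)
        (by₁ a m-inverse (solve 5 (λ l m T a b → l · m · (a ∔ b ⊖ T) ⊖ (a ∔ ⊝ m · (l · (T ⊖ b) ⊖ a)) ≋ a · ((l ⊖ `1) · m ⊖ `1)) refl λ₀ m T a b))
        (by₁ (bar a) m-inverse (solve 5 (λ l m T a b → l · m · conj (a ∔ b ⊖ T) ⊖ (conj a ∔ ⊝ m · (l · conj (T ⊖ b) ⊖ conj a)) ≋ conj a · ((l ⊖ `1) · m ⊖ `1)) refl λ₀ m T a b))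
        (by₁ b m-inverse (solve 5 (λ l m T a b → l · m · (a ∔ b ⊖ T) ⊖ (l · (T ⊖ a) ∔ (`1 ∔ m) · (b ⊖ l · (T ⊖ a))) ≋ b · ((l ⊖ `1) · m ⊖ `1)) refl λ₀ m T a b))
        (by₁ (bar b) m-inverse (solve 5 (λ l m T a b → l · m · conj (a ∔ b ⊖ T) ⊖ (l · conj (T ⊖ a) ∔ (`1 ∔ m) · (conj b ⊖ l · conj (T ⊖ a))) ≋ conj b · ((l ⊖ `1) · m ⊖ `1)) refl λ₀ m T a b))
        (on-axis (a + b - T))

    semilinear-pair : ∀ {a b c} → a ≢ 0# → b ≢ 0# → c ≢ 0# → a ≢ b → a ≢ c → b ≢ c →
      Config (λ z → Σ K λ g → g ≢ 0# × z ≡ (λ₀ * g , λ₀ * bar g)) (a , bar a) (b , bar b) (c , bar c)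
    semilinear-pair {a} {b} {c} a≢0 b≢0 c≢0 a≢b a≢c b≢c with admissible a≢0 b≢0 c≢0 a≢b a≢c b≢c
    ... | T , (ab , ac) , (ba , bc) , (ca , cb) = config _ _ _ (T - a , nonzero ab , refl) (T - b , nonzero ba , refl) (T - c , nonzero ca , refl)
          (image-≢ a≢b) (image-≢ a≢c) (image-≢ b≢c) axis (meet ba ab) (meet ca ac) (meet cb bc)
      where
      nonzero : ∀ {x y} → bracket x y ≢ 0# → x ≢ 0#
      nonzero {_} {y} h refl = h (solve 1 (λ y → `0 · conj y ⊖ conj `0 · y ≋ `0) refl y)
      image-≢ : ∀ {x y : K} → x ≢ y → (λ₀ * (T - x) , λ₀ * bar (T - x)) ≢ (λ₀ * (T - y) , λ₀ * bar (T - y))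
      image-≢ {x} {y} h e = h (by₁ (- 1#) (*-cancelˡ λ≢0 (cong proj₁ e)) (solve 3 (λ T x y → x ⊖ y ≋ ⊝ `1 · ((T ⊖ x) ⊖ (T ⊖ y))) refl T x y))

  -- The line joining (a , 0) to (v , k) is parallel to the line joining (u , h) to (b , 0).
  Parallel : (a b u h v k : K) → Set
  Parallel a b u h v k = (N (v - a) ≢ N k × (v - a) * h ≡ (u - b) * k) ⊎ (N (v - a) ≡ N k × k * bar (u - b) ≡ h * bar (v - a))

  meet-at-infinity : ∀ {a b u h v k} → k ≢ 0# → Parallel a b u h v k → Meet (a , 0#) (v , k) (u , h) (b , 0#) infinity
  meet-at-infinity {a} {b} {u} {h} {v} {k} k≢0 (inj₁ (D∉ , e)) = parallel-linear
    (λ n → D∉ (trans n (solve 1 (λ k → norm (k ⊖ `0) ≋ norm k) refl k)))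
    (by₁ (- 1#) e (solve 6 (λ a b u h v k → (v ⊖ a) · (`0 ⊖ h) ⊖ (k ⊖ `0) · (b ⊖ u) ≋ ⊝ `1 · ((v ⊖ a) · h ⊖ (u ⊖ b) · k)) refl a b u h v k))
    (λ _ → tt)
  meet-at-infinity {a} {b} {u} {h} {v} {k} k≢0 (inj₂ (n , e)) with equal-norms v-a≢0 n
    where
    v-a≢0 : v - a ≢ 0#
    v-a≢0 z = N-≢0 k≢0 (trans (sym n) (trans (cong N z) N0≡0))
  ... | ε , unit , e′ = parallel-semilinear ε unit
    (by₁ 1# e′ (solve 4 (λ a v k ε → (k ⊖ `0) ⊖ ε · conj (v ⊖ a) ≋ `1 · (k ⊖ ε · conj (v ⊖ a))) refl a v k ε))
    (*-cancelˡ (bar-≢0 v-a≢0) (by₂ 1# e (- bar (u - b)) e′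
      (solve 7 (λ a b u h v k ε → conj (v ⊖ a) · (`0 ⊖ h) ⊖ conj (v ⊖ a) · (ε · conj (b ⊖ u))
         ≋ `1 · (k · conj (u ⊖ b) ⊖ h · conj (v ⊖ a)) ∔ ⊝ conj (u ⊖ b) · (k ⊖ ε · conj (v ⊖ a))) refl a b u h v k ε)))
    (λ _ → tt)
    where
    v-a≢0 : v - a ≢ 0#
    v-a≢0 z = N-≢0 k≢0 (trans (sym n) (trans (cong N z) N0≡0))

  -- Let the lines A B′ and A′ B have the same linear direction (m , 1). As long as the joins are linear, Pappus's
  -- theorem in the plane over K applies, and the axis has the direction (m , 1) as well or is the line at infinity.
  module CommonDirection {a b c m t μ ν : K} (m∉ : N m ≢ 1#) (ν≢0 : ν ≢ 0#) where
    -- B and A′ = (u , μ) lie on one line of direction (m , 1), A and B′ = (v , ν) on another, and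
    -- C′ = (w , ω) is B′ + t (A′ - B′). E is the determinant of the directions of A C′ and A′ C and
    -- also that of B C′ and B′ C, so these pairs are parallel together.
    u v ω w E : K
    u = b + m * μ
    v = a + m * ν
    ω = ν + t * (μ - ν)
    w = a + t * (b - a) + m * ω
    E = ω * (b - c) - μ * t * (b - a)

    private
      AB∉ : N (v - a) ≢ N (ν - 0#)
      AB∉ h = m∉ (*-cancelˡ (N-≢0 ν≢0) (by₁ 1# h
        (solve 3 (λ a m ν → norm ν · norm m ⊖ norm ν · `1 ≋ `1 · (norm ((a ∔ m · ν) ⊖ a) ⊖ norm (ν ⊖ `0))) refl a m ν)))

      AB∉′ : N (ν - 0#) ≢ N (- (v - a))
      AB∉′ h = AB∉ (trans (solve 1 (λ d → norm d ≋ norm (⊝ d)) refl (v - a)) (sym h))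

      AB : ∀ {n} → (∀ nr → DirectionOn (linear (ν - 0#) (- (v - a)) nr) n) → Meet (a , 0#) (v , ν) (u , μ) (b , 0#) n
      AB = parallel-linear AB∉
        (solve 5 (λ a b m μ ν → ((a ∔ m · ν) ⊖ a) · (`0 ⊖ μ) ≋ (ν ⊖ `0) · (b ⊖ (b ∔ m · μ))) refl a b m μ ν)

      linear-join : ∀ {x y h} → N (x - y) ≢ N h → N (x - y) ≢ N (h - 0#)
      linear-join {x} {y} {h} ∉ e = ∉ (trans e (solve 1 (λ h → norm (h ⊖ `0) ≋ norm h) refl h))

      linear-join′ : ∀ {x y h} → N (x - y) ≢ N h → N (y - x) ≢ N (0# - h)
      linear-join′ {x} {y} {h} ∉ e = ∉ (trans (solve 2 (λ x y → norm (x ⊖ y) ≋ norm (y ⊖ x)) refl x y)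
        (trans e (solve 1 (λ h → norm (`0 ⊖ h) ≋ norm h) refl h)))

    axis-at-infinity : E ≡ 0# → N (w - a) ≢ N ω → N (w - b) ≢ N ω →
      Meet (a , 0#) (v , ν) (u , μ) (b , 0#) infinity × Meet (a , 0#) (w , ω) (u , μ) (c , 0#) infinity ×
      Meet (b , 0#) (w , ω) (v , ν) (c , 0#) infinity
    axis-at-infinity E≡0 wa wb = AB (λ _ → tt) ,
      parallel-linear (linear-join wa) (by₁ 1# E≡0
        (solve 7 (λ a b c m t μ ν → let ω = ν ∔ t · (μ ⊖ ν); w = a ∔ t · (b ⊖ a) ∔ m · ω in
          (w ⊖ a) · (`0 ⊖ μ) ⊖ (ω ⊖ `0) · (c ⊖ (b ∔ m · μ)) ≋ `1 · ((ω · (b ⊖ c) ⊖ μ · t · (b ⊖ a)) ⊖ `0)) refl a b c m t μ ν)) (λ _ → tt) ,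
      parallel-linear (linear-join wb) (by₁ 1# E≡0
        (solve 7 (λ a b c m t μ ν → let ω = ν ∔ t · (μ ⊖ ν); w = a ∔ t · (b ⊖ a) ∔ m · ω in
          (w ⊖ b) · (`0 ⊖ ν) ⊖ (ω ⊖ `0) · (c ⊖ (a ∔ m · ν)) ≋ `1 · ((ω · (b ⊖ c) ⊖ μ · t · (b ⊖ a)) ⊖ `0)) refl a b c m t μ ν)) (λ _ → tt)

    affine-axis : E ≢ 0# → N (w - a) ≢ N ω → N (w - b) ≢ N ω → N (u - c) ≢ N μ → N (v - c) ≢ N ν →
      Σ ProjectiveLine λ n → Meet (a , 0#) (v , ν) (u , μ) (b , 0#) n × Meet (a , 0#) (w , ω) (u , μ) (c , 0#) n ×
      Meet (b , 0#) (w , ω) (v , ν) (c , 0#) n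
    affine-axis E≢0 wa wb uc vc = n , AB (λ _ → refl , refl) ,
      meet-linear ρ σ (a + ρ * (w - a)) (0# + ρ * (ω - 0#)) (linear-join wa) (linear-join′ uc) refl refl
        (by₁ (c - a) inv (solve 8 (λ a b c m t μ ν j → let ω = ν ∔ t · (μ ⊖ ν); w = a ∔ t · (b ⊖ a) ∔ m · ω; u = b ∔ m · μ in
          (a ∔ μ · (a ⊖ c) · j · (w ⊖ a)) ⊖ (u ∔ (`1 ⊖ ω · (a ⊖ c) · j) · (c ⊖ u)) ≋ (c ⊖ a) · ((ω · (b ⊖ c) ⊖ μ · t · (b ⊖ a)) · j ⊖ `1)) refl a b c m t μ ν j))
        (solve 7 (λ a b c t μ ν j → let ω = ν ∔ t · (μ ⊖ ν) in
          `0 ∔ μ · (a ⊖ c) · j · (ω ⊖ `0) ≋ μ ∔ (`1 ⊖ ω · (a ⊖ c) · j) · (`0 ⊖ μ)) refl a b c t μ ν j)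
        (by₁ (- (ν * a)) inv (solve 8 (λ a b c m t μ ν j → let ω = ν ∔ t · (μ ⊖ ν); w = a ∔ t · (b ⊖ a) ∔ m · ω; ρ = μ · (a ⊖ c) · j in
          ((ν ⊖ `0) · (a ∔ ρ · (w ⊖ a)) ∔ (⊝ ((a ∔ m · ν) ⊖ a)) · (`0 ∔ ρ · (ω ⊖ `0))) ⊖ ν · ((ω · a · (b ⊖ c) ⊖ μ · t · c · (b ⊖ a)) · j)
            ≋ ⊝ (ν · a) · ((ω · (b ⊖ c) ⊖ μ · t · (b ⊖ a)) · j ⊖ `1)) refl a b c m t μ ν j)) ,
      meet-linear ρ′ σ′ (b + ρ′ * (w - b)) (0# + ρ′ * (ω - 0#)) (linear-join wb) (linear-join′ vc) refl refl
        (by₁ (c - b) inv (solve 8 (λ a b c m t μ ν j → let ω = ν ∔ t · (μ ⊖ ν); w = a ∔ t · (b ⊖ a) ∔ m · ω; v = a ∔ m · ν in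
          (b ∔ ν · (b ⊖ c) · j · (w ⊖ b)) ⊖ (v ∔ (`1 ⊖ ω · (b ⊖ c) · j) · (c ⊖ v)) ≋ (c ⊖ b) · ((ω · (b ⊖ c) ⊖ μ · t · (b ⊖ a)) · j ⊖ `1)) refl a b c m t μ ν j))
        (solve 6 (λ b c t μ ν j → let ω = ν ∔ t · (μ ⊖ ν) in
          `0 ∔ ν · (b ⊖ c) · j · (ω ⊖ `0) ≋ ν ∔ (`1 ⊖ ω · (b ⊖ c) · j) · (`0 ⊖ ν)) refl b c t μ ν j)
        (by₁ (- (ν * b)) inv (solve 8 (λ a b c m t μ ν j → let ω = ν ∔ t · (μ ⊖ ν); w = a ∔ t · (b ⊖ a) ∔ m · ω; ρ = ν · (b ⊖ c) · j in
          ((ν ⊖ `0) · (b ∔ ρ · (w ⊖ b)) ∔ (⊝ ((a ∔ m · ν) ⊖ a)) · (`0 ∔ ρ · (ω ⊖ `0))) ⊖ ν · ((ω · a · (b ⊖ c) ⊖ μ · t · c · (b ⊖ a)) · j)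
            ≋ ⊝ (ν · b) · ((ω · (b ⊖ c) ⊖ μ · t · (b ⊖ a)) · j ⊖ `1)) refl a b c m t μ ν j))
      where
      j ρ σ ρ′ σ′ : K
      j = E ⁻¹
      inv = *-inverse E≢0
      -- Cramer's rule for the two intersections, both with determinant E.
      ρ = μ * (a - c) * j
      σ = 1# - ω * (a - c) * j
      ρ′ = ν * (b - c) * j
      σ′ = 1# - ω * (b - c) * j
      -- The line of direction (m , 1), scaled by ν so that its coefficients are exactly those of A
      -- B′; the factor after ν is its abscissa on y = 0.
      n = affine (linear (ν - 0#) (- (v - a)) AB∉′) (ν * ((ω * a * (b - c) - μ * t * c * (b - a)) * j))

    common-direction : ∀ {Q} → a ≢ b → t ≢ 0# → t ≢ 1# → Q (u , μ) → Q (v , ν) → Q (w , ω) →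
      N (w - a) ≢ N ω → N (w - b) ≢ N ω → N (u - c) ≢ N μ → N (v - c) ≢ N ν → Config Q (a , 0#) (b , 0#) (c , 0#)
    common-direction {Q} a≢b t≢0 t≢1 u∈ v∈ w∈ wa wb uc vc = build
      (λ e → a≢b (sym (foot e)))
      (λ e → *-≢0 (-≢0 (λ h → t≢1 (sym h))) (-≢0 (λ h → a≢b (sym h))) (by₁ 1# (foot e)
        (solve 3 (λ a b t → (`1 ⊖ t) · (b ⊖ a) ⊖ `0 ≋ `1 · (b ⊖ (a ∔ t · (b ⊖ a)))) refl a b t)))
      (λ e → *-≢0 t≢0 (-≢0 (λ h → a≢b (sym h))) (by₁ (- 1#) (foot e)
        (solve 3 (λ a b t → t · (b ⊖ a) ⊖ `0 ≋ ⊝ `1 · (a ⊖ (a ∔ t · (b ⊖ a)))) refl a b t)))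
      where
      -- Projection along (m , 1) onto y = 0 takes A′, B′, C′ to b, a and a + t (b - a), which are
      -- distinct.
      foot : ∀ {x y h k} → (x + m * h , h) ≡ (y + m * k , k) → x ≡ y
      foot {x} {y} {h} {k} e = by₂ 1# (cong proj₁ e) (- m) (cong proj₂ e)
        (solve 5 (λ x y m h k → x ⊖ y ≋ `1 · ((x ∔ m · h) ⊖ (y ∔ m · k)) ∔ ⊝ m · (h ⊖ k)) refl x y m h k)
      build : (u , μ) ≢ (v , ν) → (u , μ) ≢ (w , ω) → (v , ν) ≢ (w , ω) → Config Q (a , 0#) (b , 0#) (c , 0#)
      build uv uw vw with E ≟ 0#
      ... | yes E≡0 = let AB , AC , BC = axis-at-infinity E≡0 wa wb in
                      config _ _ _ u∈ v∈ w∈ uv uw vw infinity AB AC BC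
      ... | no  E≢0 = let n , AB , AC , BC = affine-axis E≢0 wa wb uc vc in
                      config _ _ _ u∈ v∈ w∈ uv uw vw n AB AC BC

-- Crossing lines of which the first is linear

module Crossing (S : StarField) where
  open StarField S
  open StarSolver S
  open FieldLemmas S
  open Plane S
  open Configurations S

  LinearPoint : K → K × K → Set
  LinearPoint k (x , y) = y ≡ k * x × y ≢ 0#

  SemilinearPoint : K × K → Set
  SemilinearPoint (x , y) = y ≡ bar x × y ≢ 0#

  -- Parallel a b u (k u) v (k v), for N k = κ.
  LinearParallel : (κ a b u v : K) → Set
  LinearParallel κ a b u v = (N (v - a) ≢ κ * N v × (v - a) * u ≡ (u - b) * v) ⊎ (N (v - a) ≡ κ * N v × v * bar (u - b) ≡ u * bar (v - a))

  linear-pair : ∀ {k a b c u v w} → k ≢ 0# → u ≢ 0# → v ≢ 0# → w ≢ 0# → u ≢ v → u ≢ w → v ≢ w →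
    LinearParallel (N k) a b u v → LinearParallel (N k) a c u w → LinearParallel (N k) b c v w →
    Config (LinearPoint k) (a , 0#) (b , 0#) (c , 0#)
  linear-pair {k} k≢0 u≢0 v≢0 w≢0 uv uw vw AB AC BC = config _ _ _ (refl , *-≢0 k≢0 u≢0) (refl , *-≢0 k≢0 v≢0) (refl , *-≢0 k≢0 w≢0)
      (fst-≢ uv) (fst-≢ uw) (fst-≢ vw) infinity
      (meet-at-infinity (*-≢0 k≢0 v≢0) (scale AB)) (meet-at-infinity (*-≢0 k≢0 w≢0) (scale AC)) (meet-at-infinity (*-≢0 k≢0 w≢0) (scale BC))
    where
    Nk : ∀ v → N k * N v ≡ N (k * v)
    Nk v = solve 2 (λ k v → norm k · norm v ≋ norm (k · v)) refl k v
    scale : ∀ {a b u v} → LinearParallel (N k) a b u v → Parallel a b u (k * u) v (k * v)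
    scale {a} {b} {u} {v} (inj₁ (n , e)) = inj₁ ((λ h → n (trans h (sym (Nk v)))) ,
      by₁ k e (solve 5 (λ k a b u v → (v ⊖ a) · (k · u) ⊖ (u ⊖ b) · (k · v) ≋ k · ((v ⊖ a) · u ⊖ (u ⊖ b) · v)) refl k a b u v))
    scale {a} {b} {u} {v} (inj₂ (n , e)) = inj₂ (trans n (Nk v) ,
      by₁ k e (solve 5 (λ k a b u v → k · v · conj (u ⊖ b) ⊖ k · u · conj (v ⊖ a) ≋ k · (v · conj (u ⊖ b) ⊖ u · conj (v ⊖ a))) refl k a b u v))

  mixed-pair : ∀ {a b c u v w} → u ≢ 0# → v ≢ 0# → w ≢ 0# → u ≢ v → u ≢ w → v ≢ w →
    Parallel a b u (bar u) v (bar v) → Parallel a c u (bar u) w (bar w) → Parallel b c v (bar v) w (bar w) →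
    Config SemilinearPoint (a , 0#) (b , 0#) (c , 0#)
  mixed-pair u≢0 v≢0 w≢0 uv uw vw AB AC BC = config _ _ _ (refl , bar-≢0 u≢0) (refl , bar-≢0 v≢0) (refl , bar-≢0 w≢0)
      (fst-≢ uv) (fst-≢ uw) (fst-≢ vw) infinity
      (meet-at-infinity (bar-≢0 v≢0) AB) (meet-at-infinity (bar-≢0 w≢0) AC) (meet-at-infinity (bar-≢0 w≢0) BC)

  -- The first bound leaves room for three lists of excluded values indexed by `units` and for the
  -- value 0, the second for the four excluded values of t in the mixed case.
  module Fresh (units : List K) (units-complete : ∀ {η} → N η ≡ 1# → η ∈ units)
    (fresh : ∀ xs → length xs ℕ.≤ ℕ.suc (3 ℕ.* length units) → Σ K (_∉ xs))
    (fresh-fixed : ∀ xs → length xs ℕ.≤ 4 → Σ K λ t → bar t ≡ t × t ∉ xs) where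

    length-two : ∀ (f g : K → K) → length (List.map f units List.++ List.map g units) ≡ 2 ℕ.* length units
    length-two f g = trans (Listₚ.length-++ (List.map f units)) (cong₂ ℕ._+_ (Listₚ.length-map f units)
                       (trans (Listₚ.length-map g units) (sym (ℕₚ.+-identityʳ _))))

    length-three : ∀ (f g h : K → K) → length (List.map f units List.++ (List.map g units List.++ List.map h units)) ≡ 3 ℕ.* length units
    length-three f g h = trans (Listₚ.length-++ (List.map f units)) (cong₂ ℕ._+_ (Listₚ.length-map f units) (length-two g h))

    -- The points are A′ = s b c, B′ = s a c, C′ = s a b; the line A B′ is semilinear iff N (s c - 1) = N k N (s c), and then
    -- η = k s c / (s c - 1) has norm 1.
    linear-pair-exists : ∀ {k a b c} → k ≢ 0# → N k ≢ 1# → a ≢ 0# → b ≢ 0# → c ≢ 0# → a ≢ b → a ≢ c → b ≢ c →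
      Config (LinearPoint k) (a , 0#) (b , 0#) (c , 0#)
    linear-pair-exists {k} {a} {b} {c} k≢0 Nk≢1 a≢0 b≢0 c≢0 a≢b a≢c b≢c = choose (fresh bad (ℕₚ.≤-reflexive (cong ℕ.suc (length-three _ _ _))))
      where
      -- The solution s of η (s x - 1) = k s x; here η ≠ k because N k ≠ 1.
      excluded : K → K → K
      excluded x η = η * (η - k) ⁻¹ * x ⁻¹
      bad : List K
      bad = 0# ∷ (List.map (excluded a) units List.++ (List.map (excluded b) units List.++ List.map (excluded c) units))

      excludes : ∀ {s x} → x ≢ 0# → s ≢ 0# → N (s * x - 1#) ≡ N k * N (s * x) → Σ K λ η → η ∈ units × s ≡ excluded x η
      excludes {s} {x} x≢0 s≢0 h with equal-norms (bar-≢0 z≢0) (trans (solve 1 (λ z → norm (conj z) ≋ norm z) refl (s * x - 1#))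
          (trans h (solve 2 (λ k y → norm k · norm y ≋ norm (k · y)) refl k (s * x))))
        where
        z≢0 : s * x - 1# ≢ 0#
        z≢0 e = *-≢0 (N-≢0 k≢0) (N-≢0 (*-≢0 s≢0 x≢0)) (trans (sym h) (trans (cong N e) N0≡0))
      ... | η , unit , e = η , units-complete unit ,
          by₃ (- (s * (x * x ⁻¹))) (*-inverse η-k≢0) (- s) (*-inverse x≢0) (- ((η - k) ⁻¹ * x ⁻¹)) e
            (solve 6 (λ s x η k j y → s ⊖ η · j · y ≋ ⊝ (s · (x · y)) · ((η ⊖ k) · j ⊖ `1) ∔ ⊝ s · (x · y ⊖ `1) ∔
              ⊝ (j · y) · (k · (s · x) ⊖ η · conj (conj (s · x ⊖ `1)))) refl s x η k ((η - k) ⁻¹) (x ⁻¹))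
        where
        η-k≢0 : η - k ≢ 0#
        η-k≢0 z = Nk≢1 (trans (cong N (sym (-≡0⇒≡ z))) unit)

      choose : Σ K (_∉ bad) → Config (LinearPoint k) (a , 0#) (b , 0#) (c , 0#)
      choose (s , s∉) = linear-pair k≢0 (*-≢0 s≢0 (*-≢0 b≢0 c≢0)) (*-≢0 s≢0 (*-≢0 a≢0 c≢0)) (*-≢0 s≢0 (*-≢0 a≢0 b≢0))
          (λ e → a≢b (sym (*-cancelˡ c≢0 (trans (CR.*-comm c b) (trans (*-cancelˡ s≢0 e) (CR.*-comm a c))))))
          (λ e → a≢c (sym (*-cancelˡ b≢0 (trans (*-cancelˡ s≢0 e) (CR.*-comm a b)))))
          (λ e → b≢c (sym (*-cancelˡ a≢0 (*-cancelˡ s≢0 e))))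
          (inj₁ (scale a c good-c a≢0 , solve 4 (λ a b c s → (s · (a · c) ⊖ a) · (s · (b · c)) ≋ (s · (b · c) ⊖ b) · (s · (a · c))) refl a b c s))
          (inj₁ (scale a b good-b a≢0 , solve 4 (λ a b c s → (s · (a · b) ⊖ a) · (s · (b · c)) ≋ (s · (b · c) ⊖ c) · (s · (a · b))) refl a b c s))
          (inj₁ ((λ h → scale b a good-a b≢0 (subst (λ z → N (s * z - b) ≡ N k * N (s * z)) (CR.*-comm a b) h)) ,
            solve 4 (λ a b c s → (s · (a · b) ⊖ b) · (s · (a · c)) ≋ (s · (a · c) ⊖ c) · (s · (a · b))) refl a b c s))
        where
        s≢0 : s ≢ 0#
        s≢0 e = s∉ (here e)
        Good : K → Set
        Good x = N (s * x - 1#) ≢ N k * N (s * x)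
        good-a : Good a
        good-a h with excludes a≢0 s≢0 h
        ... | η , η∈ , refl = s∉ (there (∈-++⁺ˡ (∈-map⁺ (excluded a) η∈)))
        good-b : Good b
        good-b h with excludes b≢0 s≢0 h
        ... | η , η∈ , refl = s∉ (there (∈-++⁺ʳ (List.map (excluded a) units) (∈-++⁺ˡ (∈-map⁺ (excluded b) η∈))))
        good-c : Good c
        good-c h with excludes c≢0 s≢0 h
        ... | η , η∈ , refl = s∉ (there (∈-++⁺ʳ (List.map (excluded a) units) (∈-++⁺ʳ (List.map (excluded b) units) (∈-map⁺ (excluded c) η∈))))
        scale : ∀ y x → Good x → y ≢ 0# → N (s * (y * x) - y) ≢ N k * N (s * (y * x))
        scale y x good y≢0 h = good (*-cancelˡ (N-≢0 y≢0) (by₁ 1# h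
          (solve 4 (λ s x y k → norm y · norm (s · x ⊖ `1) ⊖ norm y · (norm k · norm (s · x)) ≋
             `1 · (norm (s · (y · x) ⊖ y) ⊖ norm k · norm (s · (y · x)))) refl s x y k)))

    module MixedPair {a b c : K} (a≢0 : a ≢ 0#) (b≢0 : b ≢ 0#) (c≢0 : c ≢ 0#) (a≢b : a ≢ b) (a≢c : a ≢ c) (b≢c : b ≢ c) where

      -- (x + m h , h) with h = height x is the point on y = x̄ of the line of direction (m , 1) through (x , 0).
      height : K → K → K
      height m x = (bar x + bar m * x) * (1# - N m) ⁻¹

      -- The semilinear lines through (c , 0) meet y = x̄ in the points with ordinate h = ε c̄ / (ε - 1).
      excluded : K → K → K
      excluded x ε = (bar h - x) * h ⁻¹
        where h = ε * bar c * (ε - 1#) ⁻¹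

      -- The first list keeps the direction (m , 1) linear, the other two the joins B′ C and A′ C.
      -- The joins A C′ and B C′ involve t and are taken care of by `bad-parameters`.
      bad : List K
      bad = units List.++ (List.map (excluded a) units List.++ List.map (excluded b) units)

      bad-length : length bad ≡ 3 ℕ.* length units
      bad-length = trans (Listₚ.length-++ units) (cong (length units ℕ.+_) (length-two _ _))

      module _ {m : K} (m∉ : m ∉ bad) where
        Nm≢1 : N m ≢ 1#
        Nm≢1 h = m∉ (∈-++⁺ˡ (units-complete h))

        i : K
        i = (1# - N m) ⁻¹

        i-inv : (1# - N m) * i ≡ 1#
        i-inv = *-inverse (-≢0 (λ h → Nm≢1 (sym h)))

        i-fixed : bar i ≡ i
        i-fixed = bar-⁻¹ (solve 1 (λ m → conj (`1 ⊖ norm m) ≋ `1 ⊖ norm m) refl m) i-inv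

        on-line : ∀ x → bar (height m x) ≡ x + m * height m x
        on-line x = by₂ (x + m * bar x) i-fixed x i-inv
          (solve 3 (λ m x i → conj ((conj x ∔ conj m · x) · i) ⊖ (x ∔ m · ((conj x ∔ conj m · x) · i)) ≋
             (x ∔ m · conj x) · (conj i ⊖ i) ∔ x · ((`1 ⊖ norm m) · i ⊖ `1)) refl m x i)

        on-curve : ∀ x → height m x ≡ bar (x + m * height m x)
        on-curve x = trans (sym (bar-bar _)) (cong bar (on-line x))

        height-≢0 : ∀ {x} → x ≢ 0# → height m x ≢ 0#
        height-≢0 {x} x≢0 h = x≢0 (by₃ (- 1#) (on-line x) (- m) h 1# (trans (cong bar h) bar-0)
          (solve 3 (λ x m h → x ⊖ `0 ≋ ⊝ `1 · (conj h ⊖ (x ∔ m · h)) ∔ ⊝ m · (h ⊖ `0) ∔ `1 · (conj h ⊖ `0)) refl x m (height m x)))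

        -- If the line joining (c , 0) to the point on y = x̄ above x is semilinear, then m is excluded.
        excludes : ∀ {x} → x ≢ 0# → N ((x + m * height m x) - c) ≡ N (height m x) → Σ K λ ε → ε ∈ units × m ≡ excluded x ε
        excludes {x} x≢0 e with equal-norms (λ z → N-≢0 (height-≢0 x≢0) (trans (sym e) (trans (cong N z) N0≡0))) e
        ... | ε , unit , h≡ = ε , units-complete unit , m≡
          where
          h : K
          h = height m x
          ε-relation : h * (ε - 1#) ≡ ε * bar c
          ε-relation = by₂ (- 1#) h≡ ε (on-curve x)
            (solve 5 (λ h ε c x m → h · (ε ⊖ `1) ⊖ ε · conj c ≋ ⊝ `1 · (h ⊖ ε · conj ((x ∔ m · h) ⊖ c)) ∔ ε · (h ⊖ conj (x ∔ m · h))) refl h ε c x m)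
          ε-1≢0 : ε - 1# ≢ 0#
          ε-1≢0 z = *-≢0 (unit-≢0 unit) (bar-≢0 c≢0) (trans (sym ε-relation) (trans (cong (h *_) z) (CR.zeroʳ h)))
          h≡′ : h ≡ ε * bar c * (ε - 1#) ⁻¹
          h≡′ = by₂ (- h) (*-inverse ε-1≢0) ((ε - 1#) ⁻¹) ε-relation
            (solve 4 (λ h ε c j → h ⊖ ε · conj c · j ≋ ⊝ h · ((ε ⊖ `1) · j ⊖ `1) ∔ j · (h · (ε ⊖ `1) ⊖ ε · conj c)) refl h ε c ((ε - 1#) ⁻¹))
          m≡ : m ≡ excluded x ε
          m≡ = trans (by₂ (- m) (*-inverse (height-≢0 x≢0)) (- (h ⁻¹)) (on-line x)
            (solve 4 (λ m h x j → m ⊖ (conj h ⊖ x) · j ≋ ⊝ m · (h · j ⊖ `1) ∔ ⊝ j · (conj h ⊖ (x ∔ m · h))) refl m h x (h ⁻¹)))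
            (cong (λ z → (bar z - x) * z ⁻¹) h≡′)

        ν μ u v g₀ g₁ h₀ h₁ : K
        ν = height m a
        μ = height m b
        u = b + m * μ
        v = a + m * ν
        g₀ = v * bar a + bar v * a - N a
        g₁ = (u - v) * bar a + bar (u - v) * a
        h₀ = u * bar b + bar u * b - N b
        h₁ = (v - u) * bar b + bar (v - u) * b

        -- The values 0 and 1 would make C′ coincide with B′ or A′. As C′ lies on y = x̄, N ω = N w,
        -- so A C′ is semilinear iff w ā + w̄ a = N a; with w = v + t (u - v) this is g₀ + t g₁ = 0.
        -- For B C′ it is h₀ + (1 - t) h₁ = 0.
        bad-parameters : List K
        bad-parameters = 0# ∷ 1# ∷ - (g₀ * g₁ ⁻¹) ∷ 1# + h₀ * h₁ ⁻¹ ∷ []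

        affine-root : ∀ {p q t} → p ≢ 0# → p + t * q ≡ 0# → t ≡ - (p * q ⁻¹)
        affine-root {p} {q} {t} p≢0 e = by₂ (- t) (*-inverse q≢0) (q ⁻¹) e
          (solve 4 (λ p q t j → t ⊖ (⊝ (p · j)) ≋ ⊝ t · (q · j ⊖ `1) ∔ j · ((p ∔ t · q) ⊖ `0)) refl p q t (q ⁻¹))
          where
          q≢0 : q ≢ 0#
          q≢0 z = p≢0 (by₂ 1# e (- t) z (solve 3 (λ p q t → p ⊖ `0 ≋ `1 · ((p ∔ t · q) ⊖ `0) ∔ ⊝ t · (q ⊖ `0)) refl p q t))

        -- The join of (x , 0) with the point above x is linear.
        join-≢0 : ∀ {x} → x ≢ 0# → (x + m * height m x) * bar x + bar (x + m * height m x) * x - N x ≢ 0#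
        join-≢0 {x} x≢0 e = Nm≢1 (*-cancelˡ (N-≢0 (height-≢0 x≢0)) (by₃ (- 1#) e (- bar h) (on-curve x) (- bar (x + m * h)) (on-line x)
            (solve 3 (λ x m h → let p = x ∔ m · h in norm h · norm m ⊖ norm h · `1 ≋
              ⊝ `1 · ((p · conj x ∔ conj p · x ⊖ norm x) ⊖ `0) ∔ ⊝ conj h · (h ⊖ conj p) ∔ ⊝ conj p · (conj h ⊖ p)) refl x m h)))
          where
          h : K
          h = height m x

        mixed-pair-at : ∀ {t} → bracket a b ≢ 0# → bar t ≡ t → t ∉ bad-parameters → Config SemilinearPoint (a , 0#) (b , 0#) (c , 0#)
        mixed-pair-at {t} a∦b t-fixed t∉ = CommonDirection.common-direction {a} {b} {c} {m} {t} {μ} {ν} Nm≢1 (height-≢0 a≢0) a≢b t≢0 (λ e → t∉ (there (here e)))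
            (on-curve b , height-≢0 b≢0) (on-curve a , height-≢0 a≢0) (w∈ , ω≢0) wa wb good-b good-a
          where
          ω w : K
          ω = ν + t * (μ - ν)
          w = a + t * (b - a) + m * ω
          t≢0 : t ≢ 0#
          t≢0 e = t∉ (here e)
          w∈ : ω ≡ bar w
          w∈ = by₃ (1# - t) (on-curve a) t (on-curve b) (- (bar u - bar v)) t-fixed
            (solve 6 (λ a b m t μ ν → let u = b ∔ m · μ; v = a ∔ m · ν; ω = ν ∔ t · (μ ⊖ ν) in
              ω ⊖ conj (a ∔ t · (b ⊖ a) ∔ m · ω) ≋ (`1 ⊖ t) · (ν ⊖ conj v) ∔ t · (μ ⊖ conj u) ∔ ⊝ (conj u ⊖ conj v) · (conj t ⊖ t)) refl a b m t μ ν)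
          -- If C′ were the common point of the two lines, its foot a + t (b - a) would vanish and
          -- a, b would be proportional over F.
          ω≢0 : ω ≢ 0#
          ω≢0 z = *-≢0 t≢0 a∦b (by₃ (- bar a) foot≡0 a (trans (cong bar foot≡0) bar-0) (- (a * (bar b - bar a))) t-fixed
            (solve 3 (λ a b t → let X = a ∔ t · (b ⊖ a) in t · (a · conj b ⊖ conj a · b) ⊖ `0 ≋
              ⊝ conj a · (X ⊖ `0) ∔ a · (conj X ⊖ `0) ∔ ⊝ (a · (conj b ⊖ conj a)) · (conj t ⊖ t)) refl a b t))
            where
            foot≡0 : a + t * (b - a) ≡ 0#
            foot≡0 = by₃ (- m) z 1# (trans (cong bar z) bar-0) (- 1#) (cong bar w∈)
              (solve 5 (λ a b t m ω → (a ∔ t · (b ⊖ a)) ⊖ `0 ≋ ⊝ m · (ω ⊖ `0) ∔ `1 · (conj ω ⊖ `0) ∔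
                ⊝ `1 · (conj ω ⊖ conj (conj (a ∔ t · (b ⊖ a) ∔ m · ω)))) refl a b t m ω)
          Nω≡Nw : N ω ≡ N w
          Nω≡Nw = trans (cong N w∈) (solve 1 (λ w → norm (conj w) ≋ norm w) refl w)
          wa : N (w - a) ≢ N ω
          wa e = t∉ (there (there (here (affine-root (join-≢0 a≢0) (by₃ (- 1#) e (- 1#) Nω≡Nw (- (bar (u - v) * a)) t-fixed
            (solve 6 (λ a b m t μ ν → let u = b ∔ m · μ; v = a ∔ m · ν; ω = ν ∔ t · (μ ⊖ ν); w = a ∔ t · (b ⊖ a) ∔ m · ω in
              ((v · conj a ∔ conj v · a ⊖ norm a) ∔ t · ((u ⊖ v) · conj a ∔ conj (u ⊖ v) · a)) ⊖ `0 ≋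
              ⊝ `1 · (norm (w ⊖ a) ⊖ norm ω) ∔ ⊝ `1 · (norm ω ⊖ norm w) ∔ ⊝ (conj (u ⊖ v) · a) · (conj t ⊖ t)) refl a b m t μ ν))))))
          wb : N (w - b) ≢ N ω
          wb e = t∉ (there (there (there (here (by₁ (- 1#) (affine-root {t = 1# - t} (join-≢0 b≢0)
              (by₃ (- 1#) e (- 1#) Nω≡Nw (bar (v - u) * b) t-fixed
                (solve 6 (λ a b m t μ ν → let u = b ∔ m · μ; v = a ∔ m · ν; ω = ν ∔ t · (μ ⊖ ν); w = a ∔ t · (b ⊖ a) ∔ m · ω in
                  ((u · conj b ∔ conj u · b ⊖ norm b) ∔ (`1 ⊖ t) · ((v ⊖ u) · conj b ∔ conj (v ⊖ u) · b)) ⊖ `0 ≋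
                  ⊝ `1 · (norm (w ⊖ b) ⊖ norm ω) ∔ ⊝ `1 · (norm ω ⊖ norm w) ∔ (conj (v ⊖ u) · b) · (conj t ⊖ t)) refl a b m t μ ν)))
            (solve 2 (λ t r → t ⊖ (`1 ∔ r) ≋ ⊝ `1 · ((`1 ⊖ t) ⊖ ⊝ r)) refl t (h₀ * h₁ ⁻¹)))))))
          good-a : N (v - c) ≢ N ν
          good-a e with excludes a≢0 e
          ... | ε , ε∈ , m≡ = m∉ (∈-++⁺ʳ units (∈-++⁺ˡ (subst (_∈ List.map (excluded a) units) (sym m≡) (∈-map⁺ (excluded a) ε∈))))
          good-b : N (u - c) ≢ N μ
          good-b e with excludes b≢0 e
          ... | ε , ε∈ , m≡ = m∉ (∈-++⁺ʳ units (∈-++⁺ʳ (List.map (excluded a) units) (subst (_∈ List.map (excluded b) units) (sym m≡) (∈-map⁺ (excluded b) ε∈))))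

    private
      bracket≢0⇒config : ∀ {a b c} → a ≢ 0# → b ≢ 0# → c ≢ 0# → a ≢ b → a ≢ c → b ≢ c → bracket a b ≢ 0# →
        Config SemilinearPoint (a , 0#) (b , 0#) (c , 0#)
      bracket≢0⇒config a≢0 b≢0 c≢0 a≢b a≢c b≢c a∦b = choose-m (fresh bad (ℕₚ.≤-trans (ℕₚ.≤-reflexive bad-length) (ℕₚ.n≤1+n _)))
        where
        open MixedPair a≢0 b≢0 c≢0 a≢b a≢c b≢c
        choose-m : Σ K (_∉ bad) → Config SemilinearPoint _ _ _
        choose-m (m , m∉) = choose-t (fresh-fixed (bad-parameters m∉) ℕₚ.≤-refl)
          where
          choose-t : Σ K (λ t → bar t ≡ t × t ∉ bad-parameters m∉) → Config SemilinearPoint _ _ _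
          choose-t (t , t-fixed , t∉) = mixed-pair-at m∉ a∦b t-fixed t∉

      -- A′, B′, C′ are chosen on the line spanned by e = (θ - θ̄) a, which is orthogonal to a.
      proportional⇒config : ∀ {a β γ} → bar β ≡ β → bar γ ≡ γ → a ≢ 0# → β ≢ 0# → γ ≢ 0# → β ≢ 1# → γ ≢ 1# → β ≢ γ →
        Config SemilinearPoint (a , 0#) (β * a , 0#) (γ * a , 0#)
      proportional⇒config {a} {β} {γ} β̄ γ̄ a≢0 β≢0 γ≢0 β≢1 γ≢1 β≢γ =
        -- The factors β γ, γ, β are again the products b c, a c, a b, formed from the factors 1, β,
        -- γ of the three given points.
        mixed-pair (*-≢0 β≢0 (*-≢0 γ≢0 e≢0)) (*-≢0 γ≢0 e≢0) (*-≢0 β≢0 e≢0)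
          (λ h → β≢1 (cancel (*-≢0 γ≢0 e≢0) (trans h (sym (CR.*-identityˡ _)))))
          (λ h → γ≢1 (cancel e≢0 (trans (*-cancelˡ β≢0 h) (sym (CR.*-identityˡ _)))))
          (λ h → β≢γ (sym (cancel e≢0 h)))
          (inj₁ (orthogonal a≢0 (by₁ (- (i * N a)) γ̄ (solve 3 (λ θ a γ → let v = γ · ((θ ⊖ conj θ) · a) in
             (v · conj a ∔ conj v · a) ⊖ `0 ≋ ⊝ ((θ ⊖ conj θ) · norm a) · (conj γ ⊖ γ)) refl θ a γ)) ,
           by₁ ((γ * e - a) * bar (γ * e)) β̄ (solve 4 (λ e a β γ → (γ · e ⊖ a) · conj (β · (γ · e)) ⊖ (β · (γ · e) ⊖ β · a) · conj (γ · e)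
             ≋ ((γ · e ⊖ a) · conj (γ · e)) · (conj β ⊖ β)) refl e a β γ)))
          (inj₁ (orthogonal a≢0 (by₁ (- (i * N a)) β̄ (solve 3 (λ θ a γ → let v = γ · ((θ ⊖ conj θ) · a) in
             (v · conj a ∔ conj v · a) ⊖ `0 ≋ ⊝ ((θ ⊖ conj θ) · norm a) · (conj γ ⊖ γ)) refl θ a β)) ,
           by₁ ((β * e - a) * bar (β * e)) γ̄ (solve 4 (λ e a β γ → (β · e ⊖ a) · conj (β · (γ · e)) ⊖ (β · (γ · e) ⊖ γ · a) · conj (β · e)
             ≋ ((β · e ⊖ a) · conj (β · e)) · (conj γ ⊖ γ)) refl e a β γ)))
          (inj₁ (orthogonal (*-≢0 β≢0 a≢0) (solve 3 (λ θ a β → let v = β · ((θ ⊖ conj θ) · a) in v · conj (β · a) ∔ conj v · (β · a) ≋ `0) refl θ a β) ,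
           by₂ (β * (e - a) * bar e) γ̄ (- (γ * (e - a) * bar e)) β̄ (solve 4 (λ e a β γ → (β · e ⊖ β · a) · conj (γ · e) ⊖ (γ · e ⊖ γ · a) · conj (β · e)
             ≋ (β · (e ⊖ a) · conj e) · (conj γ ⊖ γ) ∔ ⊝ (γ · (e ⊖ a) · conj e) · (conj β ⊖ β)) refl e a β γ)))
        where
        i e : K
        i = θ - bar θ
        e = i * a
        e≢0 : e ≢ 0#
        e≢0 = *-≢0 (-≢0 (λ h → θ-moved (sym h))) a≢0
        cancel : ∀ {x y z} → z ≢ 0# → x * z ≡ y * z → x ≡ y
        cancel {x} {y} {z} z≢0 h = *-cancelˡ z≢0 (trans (CR.*-comm z x) (trans h (CR.*-comm y z)))
        -- Pythagoras: N (p - x) = N p + N x for orthogonal p and x, so the join is linear.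
        orthogonal : ∀ {p x} → x ≢ 0# → p * bar x + bar p * x ≡ 0# → N (p - x) ≢ N (bar p)
        orthogonal {p} {x} x≢0 o h = N-≢0 x≢0 (by₂ 1# h 1# o
          (solve 2 (λ p x → norm x ⊖ `0 ≋ `1 · (norm (p ⊖ x) ⊖ norm (conj p)) ∔ `1 · ((p · conj x ∔ conj p · x) ⊖ `0)) refl p x))

    mixed-pair-exists : ∀ {a b c} → a ≢ 0# → b ≢ 0# → c ≢ 0# → a ≢ b → a ≢ c → b ≢ c →
      Config SemilinearPoint (a , 0#) (b , 0#) (c , 0#)
    mixed-pair-exists {a} {b} {c} a≢0 b≢0 c≢0 a≢b a≢c b≢c with bracket a b ≟ 0# | bracket a c ≟ 0#
    ... | no ab  | _      = bracket≢0⇒config a≢0 b≢0 c≢0 a≢b a≢c b≢c ab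
    ... | yes ab | no ac  = swap₂₃ (bracket≢0⇒config a≢0 c≢0 b≢0 a≢c a≢b (λ h → b≢c (sym h)) ac)
    ... | yes ab | yes ac with proportional a≢0 ab | proportional a≢0 ac
    ...   | β , β̄ , refl | γ , γ̄ , refl = proportional⇒config β̄ γ̄ a≢0 (factor b≢0) (factor c≢0)
            (λ h → a≢b (sym (trans (cong (_* a) h) (CR.*-identityˡ a)))) (λ h → a≢c (sym (trans (cong (_* a) h) (CR.*-identityˡ a))))
            (λ h → b≢c (cong (_* a) h))
      where
      factor : ∀ {x} → x * a ≢ 0# → x ≢ 0#
      factor h e = h (trans (cong (_* a) e) (CR.zeroˡ a))

-- Reduction of two lines to normal form

module AffineMaps (S : StarField) where
  open StarField S
  open StarSolver S
  open FieldLemmas S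
  open Plane S

  -- The linear part multiplies N x - N y by N α - N β, so null directions go to null directions.
  module AffineMap {α β η : K} (x₀ y₀ : K) (Nα≢Nβ : N α ≢ N β) (η-unit : N η ≡ 1#) where
    f : K × K → K × K
    f (x , y) = α * x + β * y + x₀ , η * (bar β * x + bar α * y) + y₀

    η≢0 : η ≢ 0#
    η≢0 = unit-≢0 η-unit

    det≢0 : N α - N β ≢ 0#
    det≢0 = -≢0 Nα≢Nβ

    f-injective : ∀ {z w} → f z ≡ f w → z ≡ w
    f-injective {x , y} {x′ , y′} e = cong₂ _,_
        (*-cancelˡ η≢0 (*-cancelˡ det≢0 (by₂ (bar α * η) (cong proj₁ e) (- β) (cong proj₂ e)
          (solve 9 (λ α β η x y x′ y′ x₀ y₀ → (norm α ⊖ norm β) · (η · x) ⊖ (norm α ⊖ norm β) · (η · x′) ≋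
            (conj α · η) · ((α · x ∔ β · y ∔ x₀) ⊖ (α · x′ ∔ β · y′ ∔ x₀)) ∔
            ⊝ β · ((η · (conj β · x ∔ conj α · y) ∔ y₀) ⊖ (η · (conj β · x′ ∔ conj α · y′) ∔ y₀))) refl α β η x y x′ y′ x₀ y₀))))
        (*-cancelˡ η≢0 (*-cancelˡ det≢0 (by₂ (- (bar β * η)) (cong proj₁ e) α (cong proj₂ e)
          (solve 9 (λ α β η x y x′ y′ x₀ y₀ → (norm α ⊖ norm β) · (η · y) ⊖ (norm α ⊖ norm β) · (η · y′) ≋
            ⊝ (conj β · η) · ((α · x ∔ β · y ∔ x₀) ⊖ (α · x′ ∔ β · y′ ∔ x₀)) ∔
            α · ((η · (conj β · x ∔ conj α · y) ∔ y₀) ⊖ (η · (conj β · x′ ∔ conj α · y′) ∔ y₀))) refl α β η x y x′ y′ x₀ y₀))))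

    -- In the linear case (p , q) is multiplied by the adjugate of the linear part, up to the unit
    -- η̄, rather than by its inverse. This avoids division and puts the factor N α - N β into
    -- `constant`.
    direction : Direction → Direction
    direction (linear p q N≢) = linear (p * bar α - q * bar β) (bar η * (q * α - p * β)) N≢′
      where
      N≢′ : N (p * bar α - q * bar β) ≢ N (bar η * (q * α - p * β))
      N≢′ h = *-≢0 (-≢0 N≢) det≢0 (by₂ 1# h (N (q * α - p * β)) η-unit
        (solve 5 (λ p q α β η → (norm p ⊖ norm q) · (norm α ⊖ norm β) ⊖ `0 ≋
          `1 · (norm (p · conj α ⊖ q · conj β) ⊖ norm (conj η · (q · α ⊖ p · β))) ∔ norm (q · α ⊖ p · β) · (norm η ⊖ `1)) refl p q α β η))
    direction (semilinear ε unit) = semilinear (η * ε) (trans (solve 2 (λ η ε → norm (η · ε) ≋ norm η · norm ε) refl η ε)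
      (trans (cong₂ _*_ η-unit unit) (CR.*-identityˡ 1#)))

    constant : Direction → K → K
    constant (linear p q N≢) κ     = (N α - N β) * κ + (p * bar α - q * bar β) * x₀ + bar η * (q * α - p * β) * y₀
    constant (semilinear ε unit) κ = y₀ - η * ε * bar x₀ + η * (bar α * κ - ε * bar β * bar κ)

    On-f : ∀ {κ} d z → On z d κ → On (f z) (direction d) (constant d κ)
    On-f {κ} (linear p q N≢) (x , y) o = by₂ (N α - N β) o ((q * α - p * β) * (bar β * x + bar α * y)) η-unit
      (solve 10 (λ p q α β η x y x₀ y₀ κ → let p′ = p · conj α ⊖ q · conj β; q′ = conj η · (q · α ⊖ p · β) in
        (p′ · (α · x ∔ β · y ∔ x₀) ∔ q′ · (η · (conj β · x ∔ conj α · y) ∔ y₀)) ⊖ ((norm α ⊖ norm β) · κ ∔ p′ · x₀ ∔ q′ · y₀) ≋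
        (norm α ⊖ norm β) · (p · x ∔ q · y ⊖ κ) ∔ ((q · α ⊖ p · β) · (conj β · x ∔ conj α · y)) · (norm η ⊖ `1)) refl p q α β η x y x₀ y₀ κ)
    On-f {κ} (semilinear ε unit) (x , y) o = by₃ (η * bar α) o (- (η * ε * bar β)) (cong bar o) (- (η * bar β * x)) unit
      (solve 9 (λ ε α β η x y x₀ y₀ κ →
        (η · (conj β · x ∔ conj α · y) ∔ y₀) ⊖ (η · ε · conj (α · x ∔ β · y ∔ x₀) ∔ (y₀ ⊖ η · ε · conj x₀ ∔ η · (conj α · κ ⊖ ε · conj β · conj κ))) ≋
        (η · conj α) · (y ⊖ (ε · conj x ∔ κ)) ∔ ⊝ (η · ε · conj β) · (conj y ⊖ conj (ε · conj x ∔ κ)) ∔ ⊝ (η · conj β · x) · (norm ε ⊖ `1))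
        refl ε α β η x y x₀ y₀ κ)

    line : ProjectiveLine → ProjectiveLine
    line (affine d κ) = affine (direction d) (constant d κ)
    line infinity     = infinity

    PointOn-f : ∀ n z → PointOn z n → PointOn (f z) (line n)
    PointOn-f (affine d κ) z o = On-f d z o

    DirectionOn-f : ∀ d n → DirectionOn d n → DirectionOn (direction d) (line n)
    DirectionOn-f (linear _ _ _)     infinity _ = tt
    DirectionOn-f (semilinear _ _)   infinity _ = tt
    DirectionOn-f (linear _ _ _)     (affine (linear _ _ _) _) (refl , refl) = refl , refl
    DirectionOn-f (semilinear _ _)   (affine (semilinear _ _) _) refl        = refl

    Meet-f : ∀ {X Y Z W n} → Meet X Y Z W n → Meet (f X) (f Y) (f Z) (f W) (line n)
    Meet-f {n = n} (at-point d κ e l P x y z w p p′ pn) = at-point _ _ _ _ (f P) (On-f d _ x) (On-f d _ y) (On-f e _ z) (On-f e _ w) (On-f d _ p) (On-f e _ p′) (PointOn-f n P pn)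
    Meet-f {n = n} (parallel d κ l x y z w dn) = parallel _ _ _ (On-f d _ x) (On-f d _ y) (On-f d _ z) (On-f d _ w) (DirectionOn-f d n dn)

    Config-f : ∀ {Q Q′ A B C} → (∀ z → Q z → Q′ (f z)) → Config Q A B C → Config Q′ (f A) (f B) (f C)
    Config-f Q⇒Q′ (config A′ B′ C′ a b c ab ac bc n AB AC BC) =
      config (f A′) (f B′) (f C′) (Q⇒Q′ A′ a) (Q⇒Q′ B′ b) (Q⇒Q′ C′ c)
        (λ e → ab (f-injective e)) (λ e → ac (f-injective e)) (λ e → bc (f-injective e)) (line n) (Meet-f AB) (Meet-f AC) (Meet-f BC)

module TwoLines (S : StarField) where
  open StarField S
  open StarSolver S
  open FieldLemmas S
  open Plane S
  open Configurations S
  open Crossing S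
  open AffineMaps S

  Parallel-directions : Direction → Direction → Set
  Parallel-directions (linear p q _)   (linear p′ q′ _)  = p * q′ ≡ q * p′
  Parallel-directions (semilinear ε _) (semilinear ε′ _) = ε ≡ ε′
  Parallel-directions _                _                 = ⊥

  one-≢0 : ∀ {p q} → N p ≢ N q → p ≡ 0# → q ≢ 0#
  one-≢0 N≢ refl refl = N≢ refl

  some-point : ∀ d κ → Σ (K × K) λ z → On z d κ
  some-point (semilinear ε _) κ = (0# , κ) , solve 2 (λ ε κ → κ ≋ ε · conj `0 ∔ κ) refl ε κ
  some-point (linear p q N≢) κ with p ≟ 0#
  ... | no p≢0 = (κ * p ⁻¹ , 0#) , by₁ κ (*-inverse p≢0) (solve 4 (λ p q κ i → p · (κ · i) ∔ q · `0 ⊖ κ ≋ κ · (p · i ⊖ `1)) refl p q κ (p ⁻¹))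
  ... | yes p≡0 = (0# , κ * q ⁻¹) , by₁ κ (*-inverse (one-≢0 N≢ p≡0)) (solve 4 (λ p q κ i → p · `0 ∔ q · (κ · i) ⊖ κ ≋ κ · (q · i ⊖ `1)) refl p q κ (q ⁻¹))

  shift : ∀ {a₁ a₂ b₁ b₂ z₁ z₂ κ l} d e → Parallel-directions d e → On (a₁ , a₂) d κ → On (b₁ , b₂) d κ → On (z₁ , z₂) e l →
    On ((a₁ + z₁) - b₁ , (a₂ + z₂) - b₂) e l
  shift {a₁} {a₂} {b₁} {b₂} {z₁} {z₂} {κ} {l} (linear p q N≢) (linear p′ q′ _) par a b z = by-direction
    where
    Δ : p * (a₁ - b₁) + q * (a₂ - b₂) ≡ 0#
    Δ = by₂ 1# a (- 1#) b (solve 7 (λ p q a₁ a₂ b₁ b₂ κ → (p · (a₁ ⊖ b₁) ∔ q · (a₂ ⊖ b₂)) ⊖ `0 ≋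
          `1 · ((p · a₁ ∔ q · a₂) ⊖ κ) ∔ ⊝ `1 · ((p · b₁ ∔ q · b₂) ⊖ κ)) refl p q a₁ a₂ b₁ b₂ κ)
    Δ′ : p′ * (a₁ - b₁) + q′ * (a₂ - b₂) ≡ 0#
    Δ′ with p ≟ 0#
    ... | no p≢0  = no-zero-divisors p≢0 (by₂ p′ Δ (a₂ - b₂) par (solve 6 (λ p q p′ q′ d e → p · (p′ · d ∔ q′ · e) ⊖ `0 ≋
                      p′ · ((p · d ∔ q · e) ⊖ `0) ∔ e · (p · q′ ⊖ q · p′)) refl p q p′ q′ (a₁ - b₁) (a₂ - b₂)))
    ... | yes p≡0 = no-zero-divisors (one-≢0 N≢ p≡0) (by₂ q′ Δ (- (a₁ - b₁)) par (solve 6 (λ p q p′ q′ d e → q · (p′ · d ∔ q′ · e) ⊖ `0 ≋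
                      q′ · ((p · d ∔ q · e) ⊖ `0) ∔ ⊝ d · (p · q′ ⊖ q · p′)) refl p q p′ q′ (a₁ - b₁) (a₂ - b₂)))
    by-direction : p′ * ((a₁ + z₁) - b₁) + q′ * ((a₂ + z₂) - b₂) ≡ l
    by-direction = by₂ 1# z 1# Δ′ (solve 9 (λ p q a₁ a₂ b₁ b₂ z₁ z₂ l → (p · ((a₁ ∔ z₁) ⊖ b₁) ∔ q · ((a₂ ∔ z₂) ⊖ b₂)) ⊖ l ≋
      `1 · ((p · z₁ ∔ q · z₂) ⊖ l) ∔ `1 · ((p · (a₁ ⊖ b₁) ∔ q · (a₂ ⊖ b₂)) ⊖ `0)) refl p′ q′ a₁ a₂ b₁ b₂ z₁ z₂ l)
  shift {a₁} {a₂} {b₁} {b₂} {z₁} {z₂} {κ} {l} (semilinear ε _) (semilinear _ _) refl a b z = by₃ 1# a (- 1#) b 1# z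
    (solve 9 (λ ε a₁ a₂ b₁ b₂ z₁ z₂ κ l → ((a₂ ∔ z₂) ⊖ b₂) ⊖ (ε · conj ((a₁ ∔ z₁) ⊖ b₁) ∔ l) ≋
      `1 · (a₂ ⊖ (ε · conj a₁ ∔ κ)) ∔ ⊝ `1 · (b₂ ⊖ (ε · conj b₁ ∔ κ)) ∔ `1 · (z₂ ⊖ (ε · conj z₁ ∔ l))) refl ε a₁ a₂ b₁ b₂ z₁ z₂ κ l)

  Opposite : Direction → K → Direction → K → K × K → Set
  Opposite d κ e l z = On z e l × ¬ On z d κ

  -- The centre is chosen so that A goes to some point of the second line; by parallelism the whole
  -- first line follows. A reflected point lying on both lines would, after a translation along the
  -- first, put A on the second.
  parallel-lines : ∀ d κ e l → Parallel-directions d e → ∀ {A B C} → On A d κ → On B d κ → On C d κ → ¬ On A e l →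
    A ≢ B → A ≢ C → B ≢ C → Config (Opposite d κ e l) A B C
  parallel-lines d κ e l par {a₁ , a₂} {b₁ , b₂} {c₁ , c₂} a b c a∉ ab ac bc with some-point e l
  ... | (x₁ , x₂) , x = reflected {Opposite d κ e l} (a₁ + x₁) (a₂ + x₂) (λ q → proj₂ q a) (λ q → proj₂ q b) (λ q → proj₂ q c) (opposite a) (opposite b) (opposite c) ab ac bc
    where
    opposite : ∀ {y₁ y₂} → On (y₁ , y₂) d κ → Opposite d κ e l ((a₁ + x₁) - y₁ , (a₂ + x₂) - y₂)
    opposite {y₁} {y₂} y = o , λ o′ → a∉ (subst (λ z → On z e l) (cong₂ _,_ (undo a₁ _) (undo a₂ _)) (shift d e par a o′ o))
      where
      o = shift d e par a y x
      undo : ∀ x z → (x + z) - z ≡ x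
      undo = solve 2 (λ x z → (x ∔ z) ⊖ z ≋ x) refl

  -- A linear line through (x₀ , y₀), parametrised by a ↦ (x₀ + q a , y₀ - p a).
  module ThroughPoint {p q κ x₀ y₀ : K} (N≢ : N p ≢ N q) (O∈ : On (x₀ , y₀) (linear p q N≢) κ) where
    d : Direction
    d = linear p q N≢

    parameter : K × K → K
    parameter (x , y) = (bar q * (x - x₀) + bar p * (y - y₀)) * (N q - N p) ⁻¹

    det-inverse : (N q - N p) * (N q - N p) ⁻¹ ≡ 1#
    det-inverse = *-inverse (-≢0 (λ h → N≢ (sym h)))

    parametrised : ∀ {x y} → On (x , y) d κ → x ≡ q * parameter (x , y) + x₀ × y ≡ - (p * parameter (x , y)) + y₀
    parametrised {x} {y} o =
      by₃ (- (x - x₀)) det-inverse (- (bar p * j)) o (bar p * j) O∈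
        (solve 8 (λ p q x y x₀ y₀ κ j → x ⊖ (q · ((conj q · (x ⊖ x₀) ∔ conj p · (y ⊖ y₀)) · j) ∔ x₀) ≋
          ⊝ (x ⊖ x₀) · ((norm q ⊖ norm p) · j ⊖ `1) ∔ ⊝ (conj p · j) · ((p · x ∔ q · y) ⊖ κ) ∔ (conj p · j) · ((p · x₀ ∔ q · y₀) ⊖ κ)) refl p q x y x₀ y₀ κ j) ,
      by₃ (- (y - y₀)) det-inverse (bar q * j) o (- (bar q * j)) O∈
        (solve 8 (λ p q x y x₀ y₀ κ j → y ⊖ (⊝ (p · ((conj q · (x ⊖ x₀) ∔ conj p · (y ⊖ y₀)) · j)) ∔ y₀) ≋
          ⊝ (y ⊖ y₀) · ((norm q ⊖ norm p) · j ⊖ `1) ∔ (conj q · j) · ((p · x ∔ q · y) ⊖ κ) ∔ ⊝ (conj q · j) · ((p · x₀ ∔ q · y₀) ⊖ κ)) refl p q x y x₀ y₀ κ j)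
      where j = (N q - N p) ⁻¹

    parameter≡0 : ∀ {z} → On z d κ → parameter z ≡ 0# → z ≡ (x₀ , y₀)
    parameter≡0 {x , y} o e = cong₂ _,_
      (trans (proj₁ (parametrised o)) (trans (cong (λ a → q * a + x₀) e) (solve 2 (λ q x₀ → q · `0 ∔ x₀ ≋ x₀) refl q x₀)))
      (trans (proj₂ (parametrised o)) (trans (cong (λ a → - (p * a) + y₀) e) (solve 2 (λ p y₀ → ⊝ (p · `0) ∔ y₀ ≋ y₀) refl p y₀)))

    parameter-injective : ∀ {z w} → On z d κ → On w d κ → parameter z ≡ parameter w → z ≡ w
    parameter-injective {x , y} {x′ , y′} o o′ e = cong₂ _,_
      (trans (proj₁ (parametrised o)) (trans (cong (λ a → q * a + x₀) e) (sym (proj₁ (parametrised o′)))))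
      (trans (proj₂ (parametrised o)) (trans (cong (λ a → - (p * a) + y₀) e) (sym (proj₂ (parametrised o′)))))

    -- The map of the plane that sends y = 0 to the given line and (1 , 0) to the point with parameter m.
    module Chart {m η : K} (m≢0 : m ≢ 0#) (unit : N η ≡ 1#) where
      α β : K
      α = q * m
      β = - (bar p * η * bar m)

      Nα≢Nβ : N α ≢ N β
      Nα≢Nβ h = N≢ (*-cancelˡ (N-≢0 m≢0) (by₂ (- 1#) h (- (N p * N m)) unit
        (solve 4 (λ p q m η → norm m · norm p ⊖ norm m · norm q ≋ ⊝ `1 · (norm (q · m) ⊖ norm (⊝ (conj p · η · conj m))) ∔ ⊝ (norm p · norm m) · (norm η ⊖ `1)) refl p q m η)))

      open AffineMap {α} {β} {η} x₀ y₀ Nα≢Nβ unit public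

      on-axis : ∀ {z} → On z d κ → f (parameter z * m ⁻¹ , 0#) ≡ z
      on-axis {x , y} o = cong₂ _,_
        (trans (by₁ (q * a) (*-inverse m≢0) (solve 6 (λ q m β x₀ a i → (q · m · (a · i) ∔ β · `0 ∔ x₀) ⊖ (q · a ∔ x₀) ≋ (q · a) · (m · i ⊖ `1)) refl q m β x₀ a (m ⁻¹)))
          (sym (proj₁ (parametrised o))))
        (trans (by₂ (- (p * a)) (*-inverse m≢0) (- (p * m * (a * m ⁻¹))) unit
            (solve 7 (λ p q m η y₀ a i → (η · (conj (⊝ (conj p · η · conj m)) · (a · i) ∔ conj (q · m) · `0) ∔ y₀) ⊖ (⊝ (p · a) ∔ y₀) ≋
              ⊝ (p · a) · (m · i ⊖ `1) ∔ ⊝ (p · m · (a · i)) · (norm η ⊖ `1)) refl p q m η y₀ a (m ⁻¹)))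
          (sym (proj₂ (parametrised o))))
        where a = parameter (x , y)

      off-axis : ∀ {x y} → y ≢ 0# → ¬ On (f (x , y)) d κ
      off-axis {x} {y} y≢0 o = *-≢0 (*-≢0 (-≢0 (λ h → N≢ (sym h))) η≢0) (*-≢0 (bar-≢0 m≢0) y≢0) (by₃ 1# o (- 1#) O∈ (q * p * m * x) unit
        (solve 9 (λ p q m η x y x₀ y₀ κ → ((norm q ⊖ norm p) · η) · (conj m · y) ⊖ `0 ≋
          `1 · ((p · (q · m · x ∔ ⊝ (conj p · η · conj m) · y ∔ x₀) ∔ q · (η · (conj (⊝ (conj p · η · conj m)) · x ∔ conj (q · m) · y) ∔ y₀)) ⊖ κ) ∔
          ⊝ `1 · ((p · x₀ ∔ q · y₀) ⊖ κ) ∔ (q · p · m · x) · (norm η ⊖ `1)) refl p q m η x y x₀ y₀ κ))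

  -- Only triples with first parameter 1 are asked for, because a chart can be scaled to send (1 ,
  -- 0) to A. This removes one variable from the exhaustive searches.
  module Crossing-lines
    (linear-pair-exists : ∀ {k b c} → k ≢ 0# → N k ≢ 1# → b ≢ 0# → c ≢ 0# → 1# ≢ b → 1# ≢ c → b ≢ c →
      Config (LinearPoint k) (1# , 0#) (b , 0#) (c , 0#))
    (mixed-pair-exists : ∀ {b c} → b ≢ 0# → c ≢ 0# → 1# ≢ b → 1# ≢ c → b ≢ c →
      Config SemilinearPoint (1# , 0#) (b , 0#) (c , 0#)) where

    1-unit : N 1# ≡ 1#
    1-unit = Conjugate.1-unit

    module FromLinear {p q κ x₀ y₀ : K} (N≢ : N p ≢ N q) (O∈ : On (x₀ , y₀) (linear p q N≢) κ) (e : Direction) (l : K) (O∈′ : On (x₀ , y₀) e l)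
      {A B C : K × K} (A∈ : On A (linear p q N≢) κ) (B∈ : On B (linear p q N≢) κ) (C∈ : On C (linear p q N≢) κ)
      (A∉ : ¬ On A e l) (B∉ : ¬ On B e l) (C∉ : ¬ On C e l) (A≢B : A ≢ B) (A≢C : A ≢ C) (B≢C : B ≢ C) where
      open ThroughPoint N≢ O∈

      m b c : K
      m = parameter A
      b = parameter B * m ⁻¹
      c = parameter C * m ⁻¹

      parameter-≢0 : ∀ {Z} → On Z d κ → ¬ On Z e l → parameter Z ≢ 0#
      parameter-≢0 Z∈ Z∉ h = Z∉ (subst (λ z → On z e l) (sym (parameter≡0 Z∈ h)) O∈′)

      m≢0 : m ≢ 0#
      m≢0 = parameter-≢0 A∈ A∉

      1≡m/m : m * m ⁻¹ ≡ 1#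
      1≡m/m = *-inverse m≢0

      quotient-≢ : ∀ {Z W} → On Z d κ → On W d κ → Z ≢ W → parameter Z * m ⁻¹ ≢ parameter W * m ⁻¹
      quotient-≢ Z∈ W∈ Z≢W h = Z≢W (parameter-injective Z∈ W∈ (*-cancelˡ (⁻¹-≢0 m≢0) (trans (CR.*-comm _ _) (trans h (CR.*-comm _ _)))))

      b≢0 : b ≢ 0#
      b≢0 = *-≢0 (parameter-≢0 B∈ B∉) (⁻¹-≢0 m≢0)
      c≢0 : c ≢ 0#
      c≢0 = *-≢0 (parameter-≢0 C∈ C∉) (⁻¹-≢0 m≢0)
      1≢b : 1# ≢ b
      1≢b h = quotient-≢ A∈ B∈ A≢B (trans 1≡m/m h)
      1≢c : 1# ≢ c
      1≢c h = quotient-≢ A∈ C∈ A≢C (trans 1≡m/m h)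
      b≢c : b ≢ c
      b≢c = quotient-≢ B∈ C∈ B≢C

      module _ {η : K} (unit : N η ≡ 1#) where
        open Chart m≢0 unit

        transport : ∀ {Q} → (∀ z → Q z → On (f z) e l × proj₂ z ≢ 0#) → Config Q (1# , 0#) (b , 0#) (c , 0#) → Config (Opposite d κ e l) A B C
        transport {Q} Q⇒ conf = subst (λ Z → Config (Opposite d κ e l) Z B C) (trans (cong (λ t → f (t , 0#)) (sym 1≡m/m)) (on-axis A∈))
          (subst₂ (λ Y Z → Config (Opposite d κ e l) (f (1# , 0#)) Y Z) (on-axis B∈) (on-axis C∈)
            (Config-f (λ z q → proj₁ (Q⇒ z q) , off-axis (proj₂ (Q⇒ z q))) conf))

    module LinearLinear {p q κ p′ q′ l : K} (N≢ : N p ≢ N q) (N≢′ : N p′ ≢ N q′) (∦ : p * q′ ≢ q * p′) {A B C : K × K}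
      (A∈ : On A (linear p q N≢) κ) (B∈ : On B (linear p q N≢) κ) (C∈ : On C (linear p q N≢) κ)
      (A∉ : ¬ On A (linear p′ q′ N≢′) l) (B∉ : ¬ On B (linear p′ q′ N≢′) l) (C∉ : ¬ On C (linear p′ q′ N≢′) l)
      (A≢B : A ≢ B) (A≢C : A ≢ C) (B≢C : B ≢ C) where
      i x₀ y₀ : K
      i = (p * q′ - q * p′) ⁻¹
      x₀ = (κ * q′ - q * l) * i
      y₀ = (p * l - p′ * κ) * i
      O∈ : p * x₀ + q * y₀ ≡ κ
      O∈ = by₁ κ (*-inverse (-≢0 ∦)) (solve 7 (λ p q p′ q′ κ l i → p · ((κ · q′ ⊖ q · l) · i) ∔ q · ((p · l ⊖ p′ · κ) · i) ⊖ κ ≋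
             κ · ((p · q′ ⊖ q · p′) · i ⊖ `1)) refl p q p′ q′ κ l i)
      O∈′ : p′ * x₀ + q′ * y₀ ≡ l
      O∈′ = by₁ l (*-inverse (-≢0 ∦)) (solve 7 (λ p q p′ q′ κ l i → p′ · ((κ · q′ ⊖ q · l) · i) ∔ q′ · ((p · l ⊖ p′ · κ) · i) ⊖ l ≋
             l · ((p · q′ ⊖ q · p′) · i ⊖ `1)) refl p q p′ q′ κ l i)

      open FromLinear N≢ O∈ (linear p′ q′ N≢′) l O∈′ A∈ B∈ C∈ A∉ B∉ C∉ A≢B A≢C B≢C
      open ThroughPoint.Chart N≢ O∈ m≢0 1-unit using (f)

      -- In the chart the second line has the equation e₁ x + e₂ y = 0. Here e₂ = 0 says that the
      -- two lines are orthogonal for N x - N y, the case settled by the exchange of y = 0 and x =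
      -- 0.
      e₁ e₂ : K
      e₁ = m * (p′ * q - q′ * p)
      e₂ = bar m * (q′ * bar q - p′ * bar p)

      e₁≢0 : e₁ ≢ 0#
      e₁≢0 = *-≢0 m≢0 (λ h → ∦ (by₁ (- 1#) h (solve 4 (λ p q p′ q′ → p · q′ ⊖ q · p′ ≋ ⊝ `1 · ((p′ · q ⊖ q′ · p) ⊖ `0)) refl p q p′ q′)))

      Ne₁≢Ne₂ : N e₁ ≢ N e₂
      Ne₁≢Ne₂ h = *-≢0 (N-≢0 m≢0) (*-≢0 (-≢0 N≢′) (-≢0 (λ h → N≢ (sym h)))) (by₁ 1# h
        (solve 5 (λ p q p′ q′ m → norm m · ((norm p′ ⊖ norm q′) · (norm q ⊖ norm p)) ⊖ `0 ≋
          `1 · (norm (m · (p′ · q ⊖ q′ · p)) ⊖ norm (conj m · (q′ · conj q ⊖ p′ · conj p)))) refl p q p′ q′ m))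

      on-second : ∀ x y → e₁ * x + e₂ * y ≡ 0# → On (f (x , y)) (linear p′ q′ N≢′) l
      on-second x y h = by₂ 1# O∈′ 1# h
        (solve 10 (λ p q p′ q′ m x y x₀ y₀ l →
          (p′ · (q · m · x ∔ ⊝ (conj p · `1 · conj m) · y ∔ x₀) ∔ q′ · (`1 · (conj (⊝ (conj p · `1 · conj m)) · x ∔ conj (q · m) · y) ∔ y₀)) ⊖ l ≋
          `1 · ((p′ · x₀ ∔ q′ · y₀) ⊖ l) ∔ `1 · ((m · (p′ · q ⊖ q′ · p) · x ∔ conj m · (q′ · conj q ⊖ p′ · conj p) · y) ⊖ `0)) refl p q p′ q′ m x y x₀ y₀ l)

      crossing : Dec (e₂ ≡ 0#) → Config (Opposite (linear p q N≢) κ (linear p′ q′ N≢′) l) A B C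
      crossing (yes e₂≡0) = transport 1-unit
        (λ { (x , y) (x≡0 , y≢0) → on-second x y (by₂ e₁ x≡0 y e₂≡0 (solve 4 (λ e₁ e₂ x y → e₁ · x ∔ e₂ · y ⊖ `0 ≋ e₁ · (x ⊖ `0) ∔ y · (e₂ ⊖ `0)) refl e₁ e₂ x y)) , y≢0 })
        (conjugate 1≢0 b≢0 c≢0 1≢b 1≢c b≢c)
      crossing (no e₂≢0) = transport 1-unit
        (λ { (x , y) (y≡ , y≢0) → on-second x y (by₂ e₂ y≡ (- (e₁ * x)) (*-inverse e₂≢0)
               (solve 5 (λ e₁ e₂ x y i → e₁ · x ∔ e₂ · y ⊖ `0 ≋ e₂ · (y ⊖ ⊝ (e₁ · i) · x) ∔ ⊝ (e₁ · x) · (e₂ · i ⊖ `1)) refl e₁ e₂ x y (e₂ ⁻¹))) , y≢0 })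
        (linear-pair-exists (neg-≢0 (*-≢0 e₁≢0 (⁻¹-≢0 e₂≢0))) Nk≢1 b≢0 c≢0 1≢b 1≢c b≢c)
        where
        j = e₂ ⁻¹
        inv = *-inverse e₂≢0
        Nk≢1 : N (- (e₁ * j)) ≢ 1#
        Nk≢1 h = Ne₁≢Ne₂ (by₃ (N e₂) h (- (N e₁ * (bar e₂ * bar j))) inv (- N e₁) (trans (cong bar inv) bar-1)
          (solve 3 (λ e₁ e₂ j → norm e₁ ⊖ norm e₂ ≋ norm e₂ · (norm (⊝ (e₁ · j)) ⊖ `1) ∔
            ⊝ (norm e₁ · (conj e₂ · conj j)) · (e₂ · j ⊖ `1) ∔ ⊝ norm e₁ · (conj (e₂ · j) ⊖ `1)) refl e₁ e₂ j))

    linear-semilinear : ∀ {p q κ ε l} (N≢ : N p ≢ N q) (unit : N ε ≡ 1#) → ∀ {A B C} →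
      let d = linear p q N≢; e = semilinear ε unit in
      On A d κ → On B d κ → On C d κ → ¬ On A e l → ¬ On B e l → ¬ On C e l → A ≢ B → A ≢ C → B ≢ C → Config (Opposite d κ e l) A B C
    linear-semilinear {p} {q} {κ} {ε} {l} N≢ unit {A} {B} {C} A∈ B∈ C∈ A∉ B∉ C∉ A≢B A≢C B≢C =
      -- The chart with η = ε takes y = x̄ to the second line.
      transport unit (λ { (x , y) (y≡ , y≢0) → on-second x y y≡ , y≢0 }) (mixed-pair-exists b≢0 c≢0 1≢b 1≢c b≢c)
      where
      i x₀ y₀ : K
      i = (N p - N q) ⁻¹
      -- Elimination of x̄ from p x + q ε x̄ = κ - q l and the conjugate equation.
      x₀ = (bar p * (κ - q * l) - q * ε * bar (κ - q * l)) * i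
      y₀ = ε * bar x₀ + l
      inv : (N p - N q) * i ≡ 1#
      inv = *-inverse (-≢0 N≢)
      i-fixed : bar i ≡ i
      i-fixed = bar-⁻¹ (solve 2 (λ p q → conj (norm p ⊖ norm q) ≋ norm p ⊖ norm q) refl p q) inv
      O∈ : p * x₀ + q * y₀ ≡ κ
      O∈ = by₃ (κ - q * l) inv (- ((κ - q * l) * N q * i)) unit (q * ε * bar (bar p * (κ - q * l) - q * ε * bar (κ - q * l))) i-fixed
        (solve 6 (λ p q κ ε l i → let c = κ ⊖ q · l; x = conj p · c ⊖ q · ε · conj c in
          p · (x · i) ∔ q · (ε · conj (x · i) ∔ l) ⊖ κ ≋
          c · ((norm p ⊖ norm q) · i ⊖ `1) ∔ ⊝ (c · norm q · i) · (norm ε ⊖ `1) ∔ (q · ε · conj x) · (conj i ⊖ i)) refl p q κ ε l i)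
      open FromLinear N≢ O∈ (semilinear ε unit) l refl A∈ B∈ C∈ A∉ B∉ C∉ A≢B A≢C B≢C
      open ThroughPoint.Chart N≢ O∈ m≢0 unit using (f)
      on-second : ∀ x y → y ≡ bar x → On (f (x , y)) (semilinear ε unit) l
      on-second x .(bar x) refl = solve 7 (λ p q m x x₀ ε l →
        ε · (conj (⊝ (conj p · ε · conj m)) · x ∔ conj (q · m) · conj x) ∔ (ε · conj x₀ ∔ l) ≋
        ε · conj (q · m · x ∔ ⊝ (conj p · ε · conj m) · conj x ∔ x₀) ∔ l) refl p q m x x₀ ε l

    -- Such a λ₀ presents y = ε x̄ as the set of the points (λ₀ g , λ₀ ḡ). The element 1 + ε serves;
    -- for ε = - 1 it vanishes, and θ - θ̄, which conjugation negates, takes its place.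
    hilbert-90 : ∀ {ε} → N ε ≡ 1# → ε ≢ 1# → Σ K λ λ₀ → λ₀ ≡ ε * bar λ₀ × bar λ₀ ≢ λ₀
    hilbert-90 {ε} unit ε≢1 with (1# + ε) ≟ 0#
    ... | no 1+ε≢0 = 1# + ε , relation , moved 1+ε≢0 relation
      where
      relation : 1# + ε ≡ ε * bar (1# + ε)
      relation = by₁ (- 1#) unit (solve 1 (λ ε → (`1 ∔ ε) ⊖ ε · conj (`1 ∔ ε) ≋ ⊝ `1 · (norm ε ⊖ `1)) refl ε)
      moved : ∀ {x} → x ≢ 0# → x ≡ ε * bar x → bar x ≢ x
      moved {x} x≢0 r h = ε≢1 (sym (*-cancelˡ x≢0 (by₂ 1# r ε h (solve 2 (λ ε x → x · `1 ⊖ x · ε ≋ `1 · (x ⊖ ε · conj x) ∔ ε · (conj x ⊖ x)) refl ε x))))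
    ... | yes 1+ε≡0 = θ - bar θ , relation , λ h → ε≢1 (sym (*-cancelˡ (-≢0 (λ e → θ-moved (sym e)))
            (by₂ 1# relation ε h (solve 2 (λ ε x → x · `1 ⊖ x · ε ≋ `1 · (x ⊖ ε · conj x) ∔ ε · (conj x ⊖ x)) refl ε (θ - bar θ)))))
      where
      relation : θ - bar θ ≡ ε * bar (θ - bar θ)
      relation = by₁ (θ - bar θ) 1+ε≡0 (solve 2 (λ ε θ → (θ ⊖ conj θ) ⊖ ε · conj (θ ⊖ conj θ) ≋ (θ ⊖ conj θ) · ((`1 ∔ ε) ⊖ `0)) refl ε θ)

    semilinear-semilinear : ∀ {ε κ ε′ l} (unit : N ε ≡ 1#) (unit′ : N ε′ ≡ 1#) → ε ≢ ε′ → ∀ {A B C} →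
      let d = semilinear ε unit; e = semilinear ε′ unit′ in
      On A d κ → On B d κ → On C d κ → ¬ On A e l → ¬ On B e l → ¬ On C e l → A ≢ B → A ≢ C → B ≢ C → Config (Opposite d κ e l) A B C
    semilinear-semilinear {ε} {κ} {ε′} {l} unit unit′ ε≢ε′ {A} {B} {C} A∈ B∈ C∈ A∉ B∉ C∉ A≢B A≢C B≢C with hilbert-90 {ε′ * bar ε} unit″ ratio≢1
      where
      unit″ : N (ε′ * bar ε) ≡ 1#
      unit″ = trans (solve 2 (λ ε ε′ → norm (ε′ · conj ε) ≋ norm ε′ · norm ε) refl ε ε′) (trans (cong₂ _*_ unit′ unit) (CR.*-identityˡ 1#))
      ratio≢1 : ε′ * bar ε ≢ 1#
      ratio≢1 h = ε≢ε′ (by₂ (- ε) h ε′ unit (solve 2 (λ ε ε′ → ε ⊖ ε′ ≋ ⊝ ε · (ε′ · conj ε ⊖ `1) ∔ ε′ · (norm ε ⊖ `1)) refl ε ε′))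
    ... | λ₀ , relation , moved =
      subst (λ Z → Config (Opposite (semilinear ε unit) κ (semilinear ε′ unit′) l) Z B C) (foot A∈) (subst₂ (λ Y Z → Config (Opposite (semilinear ε unit) κ (semilinear ε′ unit′) l) (f (start A)) Y Z) (foot B∈) (foot C∈)
        (Config-f second (SemilinearPair.semilinear-pair λ₀ moved (start-≢0 A∈ A∉) (start-≢0 B∈ B∉) (start-≢0 C∈ C∉)
          (start-≢ A∈ B∈ A≢B) (start-≢ A∈ C∈ A≢C) (start-≢ B∈ C∈ B≢C))))
      where
      i x₀ y₀ : K
      i = (ε - ε′) ⁻¹
      x₀ = bar ((l - κ) * i)
      y₀ = ε * bar x₀ + κ
      O∈′ : y₀ ≡ ε′ * bar x₀ + l
      O∈′ = by₁ (l - κ) (*-inverse (-≢0 ε≢ε′)) (solve 5 (λ ε ε′ κ l i → (ε · conj (conj ((l ⊖ κ) · i)) ∔ κ) ⊖ (ε′ · conj (conj ((l ⊖ κ) · i)) ∔ l) ≋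
              (l ⊖ κ) · ((ε ⊖ ε′) · i ⊖ `1)) refl ε ε′ κ l i)
      N1≢N0 : N 1# ≢ N 0#
      N1≢N0 h = 1≢0 (trans (sym 1-unit) (trans h N0≡0))
      -- This map takes y = x̄ to the first line and y = ε′ ε̄ x̄ to the second, whence the ratio to
      -- which `hilbert-90` is applied.
      open AffineMap {1#} {0#} {ε} x₀ y₀ N1≢N0 unit
      offset : K × K → K
      offset (x , _) = x - x₀
      start : K × K → K × K
      start z = offset z , bar (offset z)
      foot : ∀ {z} → On z (semilinear ε unit) κ → f (start z) ≡ z
      foot {x , y} o = cong₂ _,_ (solve 2 (λ x x₀ → `1 · (x ⊖ x₀) ∔ `0 · conj (x ⊖ x₀) ∔ x₀ ≋ x) refl x x₀)
        (trans (solve 4 (λ x x₀ ε κ → ε · (conj `0 · (x ⊖ x₀) ∔ conj `1 · conj (x ⊖ x₀)) ∔ (ε · conj x₀ ∔ κ) ≋ ε · conj x ∔ κ) refl x x₀ ε κ) (sym o))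
      start-≢ : ∀ {z w} → On z (semilinear ε unit) κ → On w (semilinear ε unit) κ → z ≢ w → offset z ≢ offset w
      start-≢ z∈ w∈ z≢w h = z≢w (trans (sym (foot z∈)) (trans (cong (λ t → f (t , bar t)) h) (foot w∈)))
      start-≢0 : ∀ {z} → On z (semilinear ε unit) κ → ¬ On z (semilinear ε′ unit′) l → offset z ≢ 0#
      start-≢0 {x , y} z∈ z∉ h = z∉ (by₃ 1# z∈ (ε - ε′) (cong bar (-≡0⇒≡ h)) 1# O∈′
        (solve 7 (λ x y x₀ ε ε′ κ l → y ⊖ (ε′ · conj x ∔ l) ≋ `1 · (y ⊖ (ε · conj x ∔ κ)) ∔ (ε ⊖ ε′) · (conj x ⊖ conj x₀) ∔
          `1 · ((ε · conj x₀ ∔ κ) ⊖ (ε′ · conj x₀ ∔ l))) refl x y x₀ ε ε′ κ l))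
      second : ∀ z → (Σ K λ g → g ≢ 0# × z ≡ (λ₀ * g , λ₀ * bar g)) → Opposite (semilinear ε unit) κ (semilinear ε′ unit′) l (f z)
      second .(λ₀ * g , λ₀ * bar g) (g , g≢0 , refl) =
        by₃ 1# O∈′ (ε * bar g) relation (ε′ * bar λ₀ * bar g) unit
          (solve 7 (λ ε ε′ λ₀ g x₀ y₀ l →
            (ε · (conj `0 · (λ₀ · g) ∔ conj `1 · (λ₀ · conj g)) ∔ y₀) ⊖ (ε′ · conj (`1 · (λ₀ · g) ∔ `0 · (λ₀ · conj g) ∔ x₀) ∔ l) ≋
            `1 · (y₀ ⊖ (ε′ · conj x₀ ∔ l)) ∔ (ε · conj g) · (λ₀ ⊖ ε′ · conj ε · conj λ₀) ∔ (ε′ · conj λ₀ · conj g) · (norm ε ⊖ `1)) refl ε ε′ λ₀ g x₀ y₀ l) ,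
        λ o → moved (*-cancelˡ (*-≢0 η≢0 (bar-≢0 g≢0)) (by₁ (- 1#) o
          (solve 5 (λ ε λ₀ g x₀ κ → ε · conj g · conj λ₀ ⊖ ε · conj g · λ₀ ≋ ⊝ `1 ·
            ((ε · (conj `0 · (λ₀ · g) ∔ conj `1 · (λ₀ · conj g)) ∔ (ε · conj x₀ ∔ κ)) ⊖ (ε · conj (`1 · (λ₀ · g) ∔ `0 · (λ₀ · conj g) ∔ x₀) ∔ κ))) refl ε λ₀ g x₀ κ)))

    -- The order BF, NBF, which lies outside the theorem, is the only one ruled out.
    crossing-or-parallel : Direction → Direction → Set
    crossing-or-parallel (semilinear _ _) (linear _ _ _) = ⊥
    crossing-or-parallel _ _ = ⊤

    two-lines : ∀ d κ e l → crossing-or-parallel d e → ∀ {A B C} → On A d κ → On B d κ → On C d κ → ¬ On A e l → ¬ On B e l → ¬ On C e l →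
      A ≢ B → A ≢ C → B ≢ C → Config (Opposite d κ e l) A B C
    two-lines (linear p q N≢) κ (linear p′ q′ N≢′) l _ A∈ B∈ C∈ A∉ B∉ C∉ ab ac bc with (p * q′) ≟ (q * p′)
    ... | yes ∥ = parallel-lines (linear p q N≢) κ (linear p′ q′ N≢′) l ∥ A∈ B∈ C∈ A∉ ab ac bc
    ... | no ∦  = LinearLinear.crossing N≢ N≢′ ∦ A∈ B∈ C∈ A∉ B∉ C∉ ab ac bc (_ ≟ 0#)
    two-lines (linear p q N≢) κ (semilinear ε unit) l _ A∈ B∈ C∈ A∉ B∉ C∉ ab ac bc = linear-semilinear N≢ unit A∈ B∈ C∈ A∉ B∉ C∉ ab ac bc
    two-lines (semilinear ε unit) κ (semilinear ε′ unit′) l _ A∈ B∈ C∈ A∉ B∉ C∉ ab ac bc with ε ≟ ε′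
    ... | yes ∥ = parallel-lines (semilinear ε unit) κ (semilinear ε′ unit′) l ∥ A∈ B∈ C∈ A∉ ab ac bc
    ... | no ∦  = semilinear-semilinear unit unit′ ∦ A∈ B∈ C∈ A∉ B∉ C∉ ab ac bc

-- The coordinates (x , y) with x̄ = Y - θ̄ X and y = Y - θ X of the point (X , Y).
module Coordinates (S : StarField) where
  open StarField S
  open StarSolver S
  open FieldLemmas S
  open Plane S

  δ : K
  δ = θ - bar θ

  δ≢0 : δ ≢ 0#
  δ≢0 = -≢0 (λ e → θ-moved (sym e))

  coordinates point : K × K → K × K
  coordinates (X , Y) = bar (Y - bar θ * X) , Y - θ * X
  point (x , y) = X , y + θ * X
    where X = (bar x - y) * δ ⁻¹

  point-coordinates : ∀ P → point (coordinates P) ≡ P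
  point-coordinates (X , Y) = cong₂ _,_ X≡ (trans (cong (λ z → Y - θ * X + θ * z) X≡) (solve 3 (λ θ X Y → Y ⊖ θ · X ∔ θ · X ≋ Y) refl θ X Y))
    where
    X≡ : (bar (bar (Y - bar θ * X)) - (Y - θ * X)) * δ ⁻¹ ≡ X
    X≡ = by₁ X (*-inverse δ≢0) (solve 4 (λ θ X Y i → (conj (conj (Y ⊖ conj θ · X)) ⊖ (Y ⊖ θ · X)) · i ⊖ X ≋ X · ((θ ⊖ conj θ) · i ⊖ `1)) refl θ X Y (δ ⁻¹))

  coordinates-point : ∀ z → coordinates (point z) ≡ z
  coordinates-point (x , y) = cong₂ _,_
    (by₁ (x - bar y) (trans (cong bar (*-inverse δ≢0)) bar-1)
      (solve 4 (λ θ x y i → let X = (conj x ⊖ y) · i in conj ((y ∔ θ · X) ⊖ conj θ · X) ⊖ x ≋ (x ⊖ conj y) · (conj ((θ ⊖ conj θ) · i) ⊖ `1)) refl θ x y (δ ⁻¹)))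
    (solve 3 (λ θ X y → (y ∔ θ · X) ⊖ θ · X ≋ y) refl θ ((bar x - y) * δ ⁻¹) y)

  sloped⇒On : ∀ {ε m k X Y} (unit : N ε ≡ 1#) → ε * (m - bar θ) ≡ m - θ → Y ≡ m * X + k →
    On (coordinates (X , Y)) (semilinear ε unit) (k - ε * k)
  sloped⇒On {ε} {m} {k} {X} {Y} unit slope-relation e = by₂ (1# - ε) e (- X) slope-relation
    (solve 6 (λ θ ε m k X Y → (Y ⊖ θ · X) ⊖ (ε · conj (conj (Y ⊖ conj θ · X)) ∔ (k ⊖ ε · k)) ≋
       (`1 ⊖ ε) · (Y ⊖ (m · X ∔ k)) ∔ ⊝ X · (ε · (m ⊖ conj θ) ⊖ (m ⊖ θ))) refl θ ε m k X Y)

  On⇒sloped : ∀ {ε m k X Y} (unit : N ε ≡ 1#) → ε ≢ 1# → ε * (m - bar θ) ≡ m - θ →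
    On (coordinates (X , Y)) (semilinear ε unit) (k - ε * k) → Y ≡ m * X + k
  On⇒sloped {ε} {m} {k} {X} {Y} unit ε≢1 slope-relation e = *-cancelˡ (-≢0 (λ h → ε≢1 (sym h))) (by₂ 1# e X slope-relation
    (solve 6 (λ θ ε m k X Y → (`1 ⊖ ε) · Y ⊖ (`1 ⊖ ε) · (m · X ∔ k) ≋
       `1 · ((Y ⊖ θ · X) ⊖ (ε · conj (conj (Y ⊖ conj θ · X)) ∔ (k ⊖ ε · k))) ∔ X · (ε · (m ⊖ conj θ) ⊖ (m ⊖ θ))) refl θ ε m k X Y))

  vertical⇒On : ∀ {c X Y} (unit : N 1# ≡ 1#) → X ≡ c → On (coordinates (X , Y)) (semilinear 1# unit) (- δ * c)
  vertical⇒On {c} {X} {Y} unit e = by₁ (- δ) e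
    (solve 4 (λ θ c X Y → (Y ⊖ θ · X) ⊖ (`1 · conj (conj (Y ⊖ conj θ · X)) ∔ ⊝ (θ ⊖ conj θ) · c) ≋ ⊝ (θ ⊖ conj θ) · (X ⊖ c)) refl θ c X Y)

  On⇒vertical : ∀ {c X Y} (unit : N 1# ≡ 1#) → On (coordinates (X , Y)) (semilinear 1# unit) (- δ * c) → X ≡ c
  On⇒vertical {c} {X} {Y} unit e = *-cancelˡ δ≢0 (by₁ (- 1#) e
    (solve 4 (λ θ c X Y → (θ ⊖ conj θ) · X ⊖ (θ ⊖ conj θ) · c ≋ ⊝ `1 · ((Y ⊖ θ · X) ⊖ (`1 · conj (conj (Y ⊖ conj θ · X)) ∔ ⊝ (θ ⊖ conj θ) · c))) refl θ c X Y))

  vertical-constant : ∀ κ → - δ * (- (κ * δ ⁻¹)) ≡ κ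
  vertical-constant κ = by₁ κ (*-inverse δ≢0) (solve 3 (λ δ κ i → ⊝ δ · (⊝ (κ · i)) ⊖ κ ≋ κ · (δ · i ⊖ `1)) refl δ κ (δ ⁻¹))

  -- On Y = m X + k one has x̄ - k = (m - θ̄) X and y - k = (m - θ) X, and ε is the quotient. This
  -- Cayley transform maps F bijectively onto the elements of norm 1 other than 1; the value 1
  -- belongs to the vertical lines.
  module UnitOfSlope {m : K} (m-fixed : bar m ≡ m) where
    m-θ̄≢0 : m - bar θ ≢ 0#
    m-θ̄≢0 e = θ-moved (trans (sym (-≡0⇒≡ e)) (trans (sym m-fixed) (trans (cong bar (-≡0⇒≡ e)) (bar-bar θ))))

    ε : K
    ε = (m - θ) * (m - bar θ) ⁻¹

    relation : ε * (m - bar θ) ≡ m - θ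
    relation = by₁ (m - θ) (*-inverse m-θ̄≢0) (solve 3 (λ θ m i → (m ⊖ θ) · i · (m ⊖ conj θ) ⊖ (m ⊖ θ) ≋ (m ⊖ θ) · ((m ⊖ conj θ) · i ⊖ `1)) refl θ m ((m - bar θ) ⁻¹))

    unit : N ε ≡ 1#
    unit = *-cancelˡ (N-≢0 m-θ̄≢0) (trans (solve 3 (λ θ ε m → norm (m ⊖ conj θ) · norm ε ≋ norm (ε · (m ⊖ conj θ))) refl θ ε m)
      (trans (cong N relation) (by₁ (bar θ - θ) m-fixed
        (solve 2 (λ θ m → norm (m ⊖ θ) ⊖ norm (m ⊖ conj θ) · `1 ≋ (conj θ ⊖ θ) · (conj m ⊖ m)) refl θ m))))

    ε≢1 : ε ≢ 1#
    ε≢1 e = θ-moved (by₂ (- 1#) relation (m - bar θ) e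
      (solve 3 (λ θ ε m → conj θ ⊖ θ ≋ ⊝ `1 · (ε · (m ⊖ conj θ) ⊖ (m ⊖ θ)) ∔ (m ⊖ conj θ) · (ε ⊖ `1)) refl θ ε m))

  module SlopeOfUnit {ε : K} (unit : N ε ≡ 1#) (ε≢1 : ε ≢ 1#) where
    1-ε≢0 : 1# - ε ≢ 0#
    1-ε≢0 = -≢0 (λ h → ε≢1 (sym h))

    i : K
    i = (1# - ε) ⁻¹

    m : K
    m = (θ - ε * bar θ) * i

    relation : ε * (m - bar θ) ≡ m - θ
    relation = by₁ (- (θ - ε * bar θ)) (*-inverse 1-ε≢0)
      (solve 3 (λ θ ε i → let m = (θ ⊖ ε · conj θ) · i in ε · (m ⊖ conj θ) ⊖ (m ⊖ θ) ≋ ⊝ (θ ⊖ ε · conj θ) · ((`1 ⊖ ε) · i ⊖ `1)) refl θ ε i)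

    fixed : bar m ≡ m
    fixed = *-cancelˡ 1-ε≢0 (by₃ 1# relation ε (cong bar relation) (- (bar m - θ)) unit
      (solve 3 (λ θ ε m → (`1 ⊖ ε) · conj m ⊖ (`1 ⊖ ε) · m ≋
        `1 · (ε · (m ⊖ conj θ) ⊖ (m ⊖ θ)) ∔ ε · (conj (ε · (m ⊖ conj θ)) ⊖ conj (m ⊖ θ)) ∔ ⊝ (conj m ⊖ θ) · (norm ε ⊖ `1)) refl θ ε m))

    intercept : K → K
    intercept κ = κ * i

    intercept-relation : ∀ κ → intercept κ - ε * intercept κ ≡ κ
    intercept-relation κ = by₁ κ (*-inverse 1-ε≢0) (solve 3 (λ κ ε i → (κ · i ⊖ ε · (κ · i)) ⊖ κ ≋ κ · ((`1 ⊖ ε) · i ⊖ `1)) refl κ ε i)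

  -- In terms of x = z₁ + θ̄ z₂ and y = z₁ + θ z₂ the form p x + q y is σ z₁ + τ z₂ with σ = p + q and τ = p θ̄ + q θ.
  norm-difference : ∀ p q → δ * (N p - N q) ≡ (p + q) * bar (p * bar θ + q * θ) - bar (p + q) * (p * bar θ + q * θ)
  norm-difference p q = solve 3 (λ θ p q → (θ ⊖ conj θ) · (norm p ⊖ norm q) ≋
    (p ∔ q) · conj (p · conj θ ∔ q · θ) ⊖ conj (p ∔ q) · (p · conj θ ∔ q · θ)) refl θ p q

  linear-form : ∀ p q z₁ z₂ → p * (z₁ + bar θ * z₂) + q * (z₁ + θ * z₂) ≡ (p + q) * z₁ + (p * bar θ + q * θ) * z₂
  linear-form p q z₁ z₂ = solve 5 (λ θ p q z₁ z₂ → p · (z₁ ∔ conj θ · z₂) ∔ q · (z₁ ∔ θ · z₂) ≋ (p ∔ q) · z₁ ∔ (p · conj θ ∔ q · θ) · z₂) refl θ p q z₁ z₂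

  -- p and q are the solution of p + q = δ μ and p θ̄ + q θ = δ (θ - m), so that p x + q y is δ
  -- times the form μ z₁ + (θ - m) z₂.
  module FormOfSlope {m μ : K} (m-fixed : bar m ≡ m) (μ-fixed : bar μ ≡ μ) (μ≢0 : μ ≢ 0#) where
    p q : K
    p = μ * θ - (θ - m)
    q = (θ - m) - μ * bar θ

    N≢ : N p ≢ N q
    N≢ h = *-≢0 (*-≢0 (N-≢0 δ≢0) μ≢0) (*-≢0 δ≢0 1≢0) (by₃ (- δ) h (- (N δ * μ)) m-fixed (- (N δ * (θ - m))) μ-fixed
      (solve 3 (λ θ m μ → let δ = θ ⊖ conj θ; p = μ · θ ⊖ (θ ⊖ m); q = (θ ⊖ m) ⊖ μ · conj θ in
        (norm δ · μ) · (δ · `1) ⊖ `0 ≋ ⊝ δ · (norm p ⊖ norm q) ∔ ⊝ (norm δ · μ) · (conj m ⊖ m) ∔ ⊝ (norm δ · (θ ⊖ m)) · (conj μ ⊖ μ)) refl θ m μ))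

    form : ∀ z₁ z₂ → p * (z₁ + bar θ * z₂) + q * (z₁ + θ * z₂) ≡ δ * (μ * z₁ + (θ - m) * z₂)
    form z₁ z₂ = solve 5 (λ θ m μ z₁ z₂ → (μ · θ ⊖ (θ ⊖ m)) · (z₁ ∔ conj θ · z₂) ∔ ((θ ⊖ m) ⊖ μ · conj θ) · (z₁ ∔ θ · z₂) ≋
      (θ ⊖ conj θ) · (μ · z₁ ∔ (θ ⊖ m) · z₂)) refl θ m μ z₁ z₂

  -- Because N p ≠ N q, the quotient g = τ / σ lies outside F. Hence 1 and g form a basis of K over
  -- F, and θ = m + μ g gives the slope (m , μ) of the line.
  module SlopeOfForm {p q : K} (N≢ : N p ≢ N q) where
    σ τ g : K
    σ = p + q
    τ = p * bar θ + q * θ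
    g = τ * σ ⁻¹

    σ≢0 : σ ≢ 0#
    σ≢0 e = *-≢0 δ≢0 (-≢0 N≢) (trans (norm-difference p q) (by₂ (bar τ) e (- τ) (trans (cong bar e) bar-0)
      (solve 2 (λ σ τ → (σ · conj τ ⊖ conj σ · τ) ⊖ `0 ≋ conj τ · (σ ⊖ `0) ∔ ⊝ τ · (conj σ ⊖ `0)) refl σ τ)))

    g-relation : σ * g ≡ τ
    g-relation = by₁ τ (*-inverse σ≢0) (solve 3 (λ σ τ i → σ · (τ · i) ⊖ τ ≋ τ · (σ · i ⊖ `1)) refl σ τ (σ ⁻¹))

    g-moved : bar g ≢ g
    g-moved e = *-≢0 δ≢0 (-≢0 N≢) (trans (norm-difference p q) (by₃ (bar σ) g-relation (- σ) (cong bar g-relation) (N σ) e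
      (solve 3 (λ σ τ g → (σ · conj τ ⊖ conj σ · τ) ⊖ `0 ≋ conj σ · (σ · g ⊖ τ) ∔ ⊝ σ · (conj (σ · g) ⊖ conj τ) ∔ norm σ · (conj g ⊖ g)) refl σ τ g)))

    scaled-form : ∀ {μ m κ} z₁ z₂ → μ * g ≡ θ - m → p * (z₁ + bar θ * z₂) + q * (z₁ + θ * z₂) ≡ κ →
      μ * z₁ + (θ - m) * z₂ ≡ μ * (κ * σ ⁻¹)
    scaled-form {μ} {m} {κ} z₁ z₂ slope-relation e = by₃ (- z₂) slope-relation (μ * σ ⁻¹) (trans (sym (linear-form p q z₁ z₂)) e) (- (μ * z₁)) (*-inverse σ≢0)
      (solve 9 (λ θ m μ κ σ τ i z₁ z₂ → (μ · z₁ ∔ (θ ⊖ m) · z₂) ⊖ μ · (κ · i) ≋ ⊝ z₂ · (μ · (τ · i) ⊖ (θ ⊖ m)) ∔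
        (μ · i) · ((σ · z₁ ∔ τ · z₂) ⊖ κ) ∔ ⊝ (μ · z₁) · (σ · i ⊖ `1)) refl θ m μ κ σ τ (σ ⁻¹) z₁ z₂)

-- The ground field and its quadratic extension

module GroundField (Fq : FiniteField) where
  open FiniteField Fq public renaming (Carrier to F)

  ring : CommutativeRing 0ℓ 0ℓ
  ring = record { isCommutativeRing = isCommutativeRing }
  module R = CommutativeRing ring
  open DifferenceSolver ring public

  decode : F → _
  decode = Inverse.to enum

  decode-injective : ∀ {x y} → decode x ≡ decode y → x ≡ y
  decode-injective {x} {y} e = trans (sym (Inverse.strictlyInverseʳ enum x)) (trans (cong (Inverse.from enum) e) (Inverse.strictlyInverseʳ enum y))

  element-injective : ∀ {i j} → Inverse.from enum i ≡ Inverse.from enum j → i ≡ j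
  element-injective {i} {j} e = trans (sym (Inverse.strictlyInverseˡ enum i)) (trans (cong decode e) (Inverse.strictlyInverseˡ enum j))

  no-zero-divisors : ∀ {x y} → x ≢ 0# → x * y ≡ 0# → y ≡ 0#
  no-zero-divisors {x} {y} x≢0 h = by₂ (- y) (⁻¹-inverse x x≢0) (x ⁻¹) h
    (solve 3 (λ x y i → y :- :0 := :- y :* (x :* i :- :1) :+ i :* (x :* y :- :0)) refl x y (x ⁻¹))

  square≡0⇒≡0 : ∀ {x} → x * x ≡ 0# → x ≡ 0#
  square≡0⇒≡0 {x} h with x ≟ 0#
  ... | yes e   = e
  ... | no  x≢0 = no-zero-divisors x≢0 h

  -- In characteristic 2 the Frobenius map is injective, hence surjective.
  square-root : 1# + 1# ≡ 0# → ∀ y → Σ F λ x → x * x ≡ y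
  square-root 2≡0 y with injective⇒surjective (λ i → decode (Inverse.from enum i * Inverse.from enum i))
      (λ e → element-injective (injective (decode-injective e))) (decode y)
    where
    injective : ∀ {x y} → x * x ≡ y * y → x ≡ y
    injective {x} {y} e = -≡0⇒≡ (square≡0⇒≡0 (by₂ 1# e (y * y - x * y) 2≡0
      (solve 2 (λ x y → (x :- y) :* (x :- y) :- :0 := :1 :* (x :* x :- y :* y) :+ (y :* y :- x :* y) :* (:1 :+ :1 :- :0)) refl x y)))
  ... | i , e = Inverse.from enum i , decode-injective e

module QuadraticExtension (Fq : FiniteField) (r s : FiniteField.Carrier Fq) (irreducible : Irreducible Fq r s) where
  open GroundField Fq

  no-root : ∀ x → x * x - r * x - s ≢ 0#
  no-root x h = irreducible (1# , - x , 1# , x - r , R.*-identityˡ 1# ,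
    solve 2 (λ x r → :1 :* (x :- r) :+ (:- x) :* :1 := :- r) refl x r ,
    by₁ (- 1#) h (solve 3 (λ x r s → (:- x) :* (x :- r) :- (:- s) := (:- :1) :* ((x :* x :- r :* x :- s) :- :0)) refl x r s))

  -- The norm of x + y θ, as θ + θ̄ = r and θ θ̄ = - s. A zero with y ≠ 0 would make - x / y a root
  -- of f.
  form : F → F → F
  form x y = x * x + r * (x * y) - s * (y * y)

  form-≢0 : ∀ {x y} → (x , y) ≢ (0# , 0#) → form x y ≢ 0#
  form-≢0 {x} {y} xy≢0 h with y ≟ 0#
  ... | yes refl = xy≢0 (cong (_, 0#) (square≡0⇒≡0 (by₁ 1# h
          (solve 3 (λ x r s → x :* x :- :0 := :1 :* ((x :* x :+ r :* (x :* :0) :- s :* (:0 :* :0)) :- :0)) refl x r s))))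
  ... | no y≢0 = no-root (- (x * i)) (by₂ (i * i) h (s * (y * i + 1#) - r * (x * i)) (⁻¹-inverse y y≢0)
          (solve 5 (λ x y i r s → ((:- (x :* i)) :* (:- (x :* i)) :- r :* (:- (x :* i)) :- s) :- :0 :=
             (i :* i) :* ((x :* x :+ r :* (x :* y) :- s :* (y :* y)) :- :0) :+ (s :* (y :* i :+ :1) :- r :* (x :* i)) :* (y :* i :- :1)) refl x y i r s))
    where i = y ⁻¹

  Kq : Set
  Kq = F × F

  _⊞_ _⊠_ : Kq → Kq → Kq
  (x , y) ⊞ (x′ , y′) = x + x′ , y + y′
  (x , y) ⊠ (x′ , y′) = x * x′ + s * (y * y′) , x * y′ + y * x′ + r * (y * y′)

  ⊟_ conjugate inverse : Kq → Kq
  ⊟ (x , y) = - x , - y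
  conjugate (x , y) = x + r * y , - y
  inverse (x , y) = (x + r * y) * form x y ⁻¹ , (- y) * form x y ⁻¹

  isCommutativeRingK : IsCommutativeRing _≡_ _⊞_ _⊠_ ⊟_ (0# , 0#) (1# , 0#)
  isCommutativeRingK = record
    { isRing = record
      { +-isAbelianGroup = record
        { isGroup = record
          { isMonoid = record
            { isSemigroup = record
              { isMagma = record { isEquivalence = isEquivalence ; ∙-cong = cong₂ _⊞_ }
              ; assoc = λ (a , b) (c , d) (e , f) → cong₂ _,_ (R.+-assoc a c e) (R.+-assoc b d f)
              }
            ; identity = (λ (a , b) → cong₂ _,_ (R.+-identityˡ a) (R.+-identityˡ b)) ,
                         (λ (a , b) → cong₂ _,_ (R.+-identityʳ a) (R.+-identityʳ b))
            }
          ; inverse = (λ (a , b) → cong₂ _,_ (R.-‿inverseˡ a) (R.-‿inverseˡ b)) ,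
                      (λ (a , b) → cong₂ _,_ (R.-‿inverseʳ a) (R.-‿inverseʳ b))
          ; ⁻¹-cong = cong ⊟_
          }
        ; comm = λ (a , b) (c , d) → cong₂ _,_ (R.+-comm a c) (R.+-comm b d)
        }
      ; *-cong = cong₂ _⊠_
      ; *-assoc = λ (a , b) (c , d) (e , f) → cong₂ _,_
          (solve 8 (λ a b c d e f r s → (a :* c :+ s :* (b :* d)) :* e :+ s :* ((a :* d :+ b :* c :+ r :* (b :* d)) :* f) :=
             a :* (c :* e :+ s :* (d :* f)) :+ s :* (b :* (c :* f :+ d :* e :+ r :* (d :* f)))) refl a b c d e f r s)
          (solve 8 (λ a b c d e f r s → (a :* c :+ s :* (b :* d)) :* f :+ (a :* d :+ b :* c :+ r :* (b :* d)) :* e :+ r :* ((a :* d :+ b :* c :+ r :* (b :* d)) :* f) :=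
             a :* (c :* f :+ d :* e :+ r :* (d :* f)) :+ b :* (c :* e :+ s :* (d :* f)) :+ r :* (b :* (c :* f :+ d :* e :+ r :* (d :* f)))) refl a b c d e f r s)
      ; *-identity = (λ (a , b) → cong₂ _,_ (solve 3 (λ a b s → :1 :* a :+ s :* (:0 :* b) := a) refl a b s)
                                            (solve 3 (λ a b r → :1 :* b :+ :0 :* a :+ r :* (:0 :* b) := b) refl a b r)) ,
                     (λ (a , b) → cong₂ _,_ (solve 3 (λ a b s → a :* :1 :+ s :* (b :* :0) := a) refl a b s)
                                            (solve 3 (λ a b r → a :* :0 :+ b :* :1 :+ r :* (b :* :0) := b) refl a b r))
      ; distrib = (λ (a , b) (c , d) (e , f) → cong₂ _,_
                    (solve 7 (λ a b c d e f s → a :* (c :+ e) :+ s :* (b :* (d :+ f)) := (a :* c :+ s :* (b :* d)) :+ (a :* e :+ s :* (b :* f))) refl a b c d e f s)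
                    (solve 7 (λ a b c d e f r → a :* (d :+ f) :+ b :* (c :+ e) :+ r :* (b :* (d :+ f)) := (a :* d :+ b :* c :+ r :* (b :* d)) :+ (a :* f :+ b :* e :+ r :* (b :* f))) refl a b c d e f r)) ,
                  (λ (a , b) (c , d) (e , f) → cong₂ _,_
                    (solve 7 (λ a b c d e f s → (c :+ e) :* a :+ s :* ((d :+ f) :* b) := (c :* a :+ s :* (d :* b)) :+ (e :* a :+ s :* (f :* b))) refl a b c d e f s)
                    (solve 7 (λ a b c d e f r → (c :+ e) :* b :+ (d :+ f) :* a :+ r :* ((d :+ f) :* b) := (c :* b :+ d :* a :+ r :* (d :* b)) :+ (e :* b :+ f :* a :+ r :* (f :* b))) refl a b c d e f r))
      }
    ; *-comm = λ (a , b) (c , d) → cong₂ _,_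
        (solve 5 (λ a b c d s → a :* c :+ s :* (b :* d) := c :* a :+ s :* (d :* b)) refl a b c d s)
        (solve 5 (λ a b c d r → a :* d :+ b :* c :+ r :* (b :* d) := c :* b :+ d :* a :+ r :* (d :* b)) refl a b c d r)
    }

  starField : StarField
  starField = record
    { K = Kq
    ; _+_ = _⊞_
    ; _*_ = _⊠_
    ; -_ = ⊟_
    ; 0# = 0# , 0#
    ; 1# = 1# , 0#
    ; _⁻¹ = inverse
    ; bar = conjugate
    ; isCommutativeRing = isCommutativeRingK
    ; 0≢1 = λ e → 0≢1 (cong proj₁ e)
    ; *-inverse = λ {(x , y)} xy≢0 → cong₂ _,_
        (by₁ 1# (⁻¹-inverse _ (form-≢0 xy≢0)) (solve 5 (λ x y i r s → (x :* ((x :+ r :* y) :* i) :+ s :* (y :* ((:- y) :* i))) :- :1 :=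
          :1 :* ((x :* x :+ r :* (x :* y) :- s :* (y :* y)) :* i :- :1)) refl x y (form x y ⁻¹) r s))
        (solve 4 (λ x y i r → x :* ((:- y) :* i) :+ y :* ((x :+ r :* y) :* i) :+ r :* (y :* ((:- y) :* i)) := :0) refl x y (form x y ⁻¹) r)
    ; bar-+ = λ (a , b) (c , d) → cong₂ _,_ (solve 5 (λ a b c d r → (a :+ c) :+ r :* (b :+ d) := (a :+ r :* b) :+ (c :+ r :* d)) refl a b c d r)
                                            (solve 2 (λ b d → :- (b :+ d) := (:- b) :+ (:- d)) refl b d)
    ; bar-* = λ (a , b) (c , d) → cong₂ _,_
        (solve 6 (λ a b c d r s → (a :* c :+ s :* (b :* d)) :+ r :* (a :* d :+ b :* c :+ r :* (b :* d)) :=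
          (a :+ r :* b) :* (c :+ r :* d) :+ s :* ((:- b) :* (:- d))) refl a b c d r s)
        (solve 5 (λ a b c d r → :- (a :* d :+ b :* c :+ r :* (b :* d)) := (a :+ r :* b) :* (:- d) :+ (:- b) :* (c :+ r :* d) :+ r :* ((:- b) :* (:- d))) refl a b c d r)
    ; bar-- = λ (a , b) → cong₂ _,_ (solve 3 (λ a b r → (:- a) :+ r :* (:- b) := :- (a :+ r :* b)) refl a b r) refl
    ; bar-1 = cong₂ _,_ (solve 1 (λ r → :1 :+ r :* :0 := :1) refl r) (solve 0 (:- :0 := :0) refl)
    ; bar-bar = λ (a , b) → cong₂ _,_ (solve 3 (λ a b r → (a :+ r :* b) :+ r :* (:- b) := a) refl a b r) (solve 1 (λ b → :- (:- b) := b) refl b)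
    ; _≟_ = ≡-dec _≟_ _≟_
    ; θ = 0# , 1#
    ; θ-moved = separable
    }
    where
    -- θ̄ = θ would force characteristic 2 and r = 0; then f = x² - s has a root, since every
    -- element of F is a square.
    separable : conjugate (0# , 1#) ≢ (0# , 1#)
    separable e with square-root 2≡0 s
      where
      2≡0 : 1# + 1# ≡ 0#
      2≡0 = by₁ (- 1#) (cong proj₂ e) (solve 0 ((:1 :+ :1) :- :0 := (:- :1) :* ((:- :1) :- :1)) refl)
    ... | x , x²≡s = no-root x (by₂ 1# x²≡s (- x) (cong proj₁ e)
            (solve 3 (λ x r s → (x :* x :- r :* x :- s) :- :0 := :1 :* (x :* x :- s) :+ (:- x) :* ((:0 :+ r :* :1) :- :0)) refl x r s))

-- The Hall plane in coordinates over the quadratic extension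

module HallPlane (Fq : FiniteField) (r s : FiniteField.Carrier Fq) (irreducible : Irreducible Fq r s) where
  open GroundField Fq
  open QuadraticExtension Fq r s irreducible
  private
    module K = StarField starField
    module KL = FieldLemmas starField
  open Plane starField
  open Coordinates starField

  private
    HLine  = Line Fq r s
    HPoint = Point Fq r s
    _∈ℓ_   = _∈L_ Fq r s
    infix 4 _∈ℓ_

  scalar : F → Kq
  scalar a = a , 0#

  -- z₁ = Y₁ - X₁ θ and z₂ = Y₂ - X₂ θ. Pairing components of equal index makes type 2 lines linear
  -- over K, whereas `coordinates` treats X and Y themselves as elements of K.
  z₁ z₂ : HPoint → Kq
  z₁ ((X₁ , X₂) , (Y₁ , Y₂)) = Y₁ , - X₁
  z₂ ((X₁ , X₂) , (Y₁ , Y₂)) = Y₂ , - X₂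

  private
    Pair : ∀ n → Set
    Pair n = Polynomial n × Polynomial n
    module PairSyntax {n} (r s : Polynomial n) where
      infixl 6 _+′_ _-′_
      infixl 7 _*′_
      _+′_ _*′_ _-′_ : Pair n → Pair n → Pair n
      (a , b) +′ (c , d) = a :+ c , b :+ d
      (a , b) *′ (c , d) = a :* c :+ s :* (b :* d) , a :* d :+ b :* c :+ r :* (b :* d)
      (a , b) -′ (c , d) = a :+ (:- c) , b :+ (:- d)
      conj′ : Pair n → Pair n
      conj′ (a , b) = a :+ r :* b , :- b
      θ′ : Pair n
      θ′ = :0 , :1

  coordinates-x : ∀ P → proj₁ (coordinates P) ≡ z₁ P K.+ K.bar K.θ K.* z₂ P
  coordinates-x ((a , b) , (c , d)) = cong₂ _,_
      (solve 6 (λ a b c d r s → let open PairSyntax r s in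
        proj₁ (conj′ ((c , d) -′ conj′ θ′ *′ (a , b))) := proj₁ ((c , :- a) +′ conj′ θ′ *′ (d , :- b))) refl a b c d r s)
      (solve 6 (λ a b c d r s → let open PairSyntax r s in
        proj₂ (conj′ ((c , d) -′ conj′ θ′ *′ (a , b))) := proj₂ ((c , :- a) +′ conj′ θ′ *′ (d , :- b))) refl a b c d r s)

  coordinates-y : ∀ P → proj₂ (coordinates P) ≡ z₁ P K.+ K.θ K.* z₂ P
  coordinates-y ((a , b) , (c , d)) = cong₂ _,_
      (solve 6 (λ a b c d r s → let open PairSyntax r s in
        proj₁ ((c , d) -′ θ′ *′ (a , b)) := proj₁ ((c , :- a) +′ θ′ *′ (d , :- b))) refl a b c d r s)
      (solve 6 (λ a b c d r s → let open PairSyntax r s in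
        proj₂ ((c , d) -′ θ′ *′ (a , b)) := proj₂ ((c , :- a) +′ θ′ *′ (d , :- b))) refl a b c d r s)

  scalar-fixed : ∀ a → K.bar (scalar a) ≡ scalar a
  scalar-fixed a = cong₂ _,_ (solve 2 (λ a r → a :+ r :* :0 := a) refl a r) (solve 0 (:- :0 := :0) refl)

  fixed⇒scalar : ∀ {m} → K.bar m ≡ m → m ≡ scalar (proj₁ m)
  fixed⇒scalar {a , b} e = cong (a ,_) (cong proj₁ (KL.no-zero-divisors {y = scalar b} δ≢0 (trans product (KL.≡⇒-≡0 (sym e)))))
    where
    product : δ K.* scalar b ≡ (a , b) K.- K.bar (a , b)
    product = cong₂ _,_
      (solve 4 (λ a b r s → let open PairSyntax r s in proj₁ ((θ′ -′ conj′ θ′) *′ (b , :0)) := proj₁ ((a , b) -′ conj′ (a , b))) refl a b r s)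
      (solve 4 (λ a b r s → let open PairSyntax r s in proj₂ ((θ′ -′ conj′ θ′) *′ (b , :0)) := proj₂ ((a , b) -′ conj′ (a , b))) refl a b r s)

  -- A line of slope (m , μ) with μ ≠ 0 is a level set of the form μ z₁ + (θ - m) z₂.
  form-of : F → F → HPoint → Kq
  form-of m μ ((X₁ , X₂) , (Y₁ , Y₂)) = μ * Y₁ - m * Y₂ - s * X₂ , Y₂ - μ * X₁ + m * X₂ - r * X₂

  form-of-correct : ∀ m μ P → scalar μ K.* z₁ P K.+ (K.θ K.- scalar m) K.* z₂ P ≡ form-of m μ P
  form-of-correct m μ ((a , b) , (c , d)) = cong₂ _,_
    (solve 8 (λ a b c d m μ r s → let open PairSyntax r s in
       proj₁ ((μ , :0) *′ (c , :- a) +′ (θ′ -′ (m , :0)) *′ (d , :- b)) := μ :* c :- m :* d :- s :* b) refl a b c d m μ r s)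
    (solve 8 (λ a b c d m μ r s → let open PairSyntax r s in
       proj₂ ((μ , :0) *′ (c , :- a) +′ (θ′ -′ (m , :0)) *′ (d , :- b)) := d :- μ :* a :+ m :* b :- r :* b) refl a b c d m μ r s)

  level : F → F → H Fq r s → Kq
  level m μ (k₁ , k₂) = μ * k₁ - m * k₂ , k₂

  private
    _⊗′_ = Defs._⊗_ Fq r s
    _⊕′_ = Defs._⊕_ Fq r s

    product-linear : ∀ {μ} (μ≢0 : μ ≢ 0#) X₁ X₂ m →
      (X₁ , X₂) ⊗′ (m , μ) ≡ (X₁ * m - X₂ * (μ ⁻¹) * fpoly Fq r s m , X₁ * μ - X₂ * m + X₂ * r)
    product-linear {μ} μ≢0 X₁ X₂ m with μ ≟ 0#
    ... | yes e = ⊥-elim (μ≢0 e)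
    ... | no  _ = refl

    product-scalar : ∀ X₁ X₂ m → (X₁ , X₂) ⊗′ (m , 0#) ≡ (X₁ * m , X₂ * m)
    product-scalar X₁ X₂ m with 0# ≟ 0#
    ... | yes _  = refl
    ... | no  ¬e = ⊥-elim (¬e refl)

  -- In μ Y₁ - m Y₂ the term - X₂ f(m) meets X₂ (m² - r m), and only s X₂ survives. So the nonlinear
  -- dependence on the slope disappears from the equation.
  ∈⇒level : ∀ {m μ k} → μ ≢ 0# → ∀ P → P ∈ℓ nonVert (m , μ) k → form-of m μ P ≡ level m μ k
  ∈⇒level {m} {μ} {k₁ , k₂} μ≢0 ((X₁ , X₂) , (Y₁ , Y₂)) e rewrite product-linear μ≢0 X₁ X₂ m = cong₂ _,_
      (by₃ μ (cong proj₁ e) (- m) (cong proj₂ e) (- (X₂ * fpoly Fq r s m)) (⁻¹-inverse μ μ≢0)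
        (solve 11 (λ X₁ X₂ Y₁ Y₂ m μ i k₁ k₂ r s → let f = m :* m :- r :* m :- s in
          (μ :* Y₁ :- m :* Y₂ :- s :* X₂) :- (μ :* k₁ :- m :* k₂) :=
          μ :* (Y₁ :- (X₁ :* m :- X₂ :* i :* f :+ k₁)) :+ (:- m) :* (Y₂ :- (X₁ :* μ :- X₂ :* m :+ X₂ :* r :+ k₂)) :+ (:- (X₂ :* f)) :* (μ :* i :- :1))
          refl X₁ X₂ Y₁ Y₂ m μ (μ ⁻¹) k₁ k₂ r s))
      (by₁ 1# (cong proj₂ e) (solve 7 (λ X₁ X₂ Y₂ m μ k₂ r → (Y₂ :- μ :* X₁ :+ m :* X₂ :- r :* X₂) :- k₂ := :1 :* (Y₂ :- (X₁ :* μ :- X₂ :* m :+ X₂ :* r :+ k₂))) refl X₁ X₂ Y₂ m μ k₂ r))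

  level⇒∈ : ∀ {m μ k} → μ ≢ 0# → ∀ P → form-of m μ P ≡ level m μ k → P ∈ℓ nonVert (m , μ) k
  level⇒∈ {m} {μ} {k₁ , k₂} μ≢0 ((X₁ , X₂) , (Y₁ , Y₂)) e rewrite product-linear μ≢0 X₁ X₂ m = cong₂ _,_
      (by₃ (μ ⁻¹) (cong proj₁ e) (μ ⁻¹ * m) (cong proj₂ e) (- (Y₁ - k₁ - m * X₁)) (⁻¹-inverse μ μ≢0)
        (solve 11 (λ X₁ X₂ Y₁ Y₂ m μ i k₁ k₂ r s → let f = m :* m :- r :* m :- s in
          Y₁ :- (X₁ :* m :- X₂ :* i :* f :+ k₁) :=
          i :* ((μ :* Y₁ :- m :* Y₂ :- s :* X₂) :- (μ :* k₁ :- m :* k₂)) :+ (i :* m) :* ((Y₂ :- μ :* X₁ :+ m :* X₂ :- r :* X₂) :- k₂) :+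
          (:- (Y₁ :- k₁ :- m :* X₁)) :* (μ :* i :- :1)) refl X₁ X₂ Y₁ Y₂ m μ (μ ⁻¹) k₁ k₂ r s))
      (by₁ 1# (cong proj₂ e) (solve 7 (λ X₁ X₂ Y₂ m μ k₂ r → Y₂ :- (X₁ :* μ :- X₂ :* m :+ X₂ :* r :+ k₂) := :1 :* ((Y₂ :- μ :* X₁ :+ m :* X₂ :- r :* X₂) :- k₂)) refl X₁ X₂ Y₂ m μ k₂ r))

  scalar-≢0 : ∀ {a} → a ≢ 0# → scalar a ≢ K.0#
  scalar-≢0 a≢0 e = a≢0 (cong proj₁ e)

  scalar-times : ∀ m X₁ X₂ → scalar m K.* (X₁ , X₂) ≡ (X₁ * m , X₂ * m)
  scalar-times m X₁ X₂ = cong₂ _,_ (solve 4 (λ m X₁ X₂ s → m :* X₁ :+ s :* (:0 :* X₂) := X₁ :* m) refl m X₁ X₂ s)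
                                   (solve 4 (λ m X₁ X₂ r → m :* X₂ :+ :0 :* X₁ :+ r :* (:0 :* X₂) := X₂ :* m) refl m X₁ X₂ r)

  ∈⇒sloped : ∀ {m k} → ∀ X Y → (X , Y) ∈ℓ nonVert (m , 0#) k → Y ≡ scalar m K.* X K.+ k
  ∈⇒sloped {m} {k} (X₁ , X₂) Y e rewrite product-scalar X₁ X₂ m = trans e (cong (K._+ k) (sym (scalar-times m X₁ X₂)))

  sloped⇒∈ : ∀ {m k} → ∀ X Y → Y ≡ scalar m K.* X K.+ k → (X , Y) ∈ℓ nonVert (m , 0#) k
  sloped⇒∈ {m} {k} (X₁ , X₂) Y e rewrite product-scalar X₁ X₂ m = trans e (cong (K._+ k) (scalar-times m X₁ X₂))

  record LineModel (ℓ : HLine) : Set where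
    field
      direction : Direction
      constant  : Kq
      ∈⇒On : ∀ {P} → P ∈ℓ ℓ → On (coordinates P) direction constant
      On⇒∈ : ∀ {P} → On (coordinates P) direction constant → P ∈ℓ ℓ

  form-On : ∀ {m μ} (μ≢0 : μ ≢ 0#) P →
    let module F = FormOfSlope (scalar-fixed m) (scalar-fixed μ) (scalar-≢0 μ≢0) in
    F.p K.* proj₁ (coordinates P) K.+ F.q K.* proj₂ (coordinates P) ≡ δ K.* form-of m μ P
  form-On {m} {μ} μ≢0 P = trans (cong₂ (λ x y → F.p K.* x K.+ F.q K.* y) (coordinates-x P) (coordinates-y P))
      (trans (F.form (z₁ P) (z₂ P)) (cong (δ K.*_) (form-of-correct m μ P)))
    where module F = FormOfSlope (scalar-fixed m) (scalar-fixed μ) (scalar-≢0 μ≢0)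

  linear-model : ∀ {m μ k} → μ ≢ 0# → LineModel (nonVert (m , μ) k)
  linear-model {m} {μ} {k} μ≢0 = record
    { direction = linear F.p F.q F.N≢
    ; constant  = δ K.* level m μ k
    ; ∈⇒On = λ {P} e → trans (form-On μ≢0 P) (cong (δ K.*_) (∈⇒level μ≢0 P e))
    ; On⇒∈ = λ {P} o → level⇒∈ μ≢0 P (KL.*-cancelˡ δ≢0 (trans (sym (form-On μ≢0 P)) o))
    }
    where module F = FormOfSlope (scalar-fixed m) (scalar-fixed μ) (scalar-≢0 μ≢0)

  sloped-model : ∀ {m k} → LineModel (nonVert (m , 0#) k)
  sloped-model {m} {k} = record
    { direction = semilinear U.ε U.unit
    ; constant  = k K.- U.ε K.* k
    ; ∈⇒On = λ {(X , Y)} e → sloped⇒On U.unit U.relation (∈⇒sloped X Y e)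
    ; On⇒∈ = λ {(X , Y)} o → sloped⇒∈ X Y (On⇒sloped U.unit U.ε≢1 U.relation o)
    }
    where module U = UnitOfSlope (scalar-fixed m)

  1-unit : K.N K.1# ≡ K.1#
  1-unit = trans (cong (K.1# K.*_) K.bar-1) (cong₂ _,_ (solve 1 (λ s → :1 :* :1 :+ s :* (:0 :* :0) := :1) refl s)
                                                      (solve 1 (λ r → :1 :* :0 :+ :0 :* :1 :+ r :* (:0 :* :0) := :0) refl r))

  vertical-model : ∀ {c} → LineModel (vert c)
  vertical-model {c} = record
    { direction = semilinear K.1# 1-unit
    ; constant  = K.- δ K.* c
    ; ∈⇒On = λ {(X , Y)} → vertical⇒On 1-unit
    ; On⇒∈ = λ {(X , Y)} → On⇒vertical 1-unit
    }

  line-model : ∀ ℓ → LineModel ℓ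
  line-model (vert c) = vertical-model
  line-model (nonVert (m , μ) k) with μ ≟ 0#
  ... | yes refl = sloped-model
  ... | no  μ≢0  = linear-model μ≢0

  IsLinear IsSemilinear : Direction → Set
  IsLinear (linear _ _ _)       = ⊤
  IsLinear (semilinear _ _)     = ⊥
  IsSemilinear (linear _ _ _)   = ⊥
  IsSemilinear (semilinear _ _) = ⊤

  NBF⇒linear : ∀ ℓ → InNBF Fq r s ℓ → IsLinear (LineModel.direction (line-model ℓ))
  NBF⇒linear (nonVert (m , μ) k) μ≢0 with μ ≟ 0#
  ... | yes refl = ⊥-elim (μ≢0 refl)
  ... | no  _    = tt

  BF⇒semilinear : ∀ ℓ → InBF Fq r s ℓ → IsSemilinear (LineModel.direction (line-model ℓ))
  BF⇒semilinear (vert c) _ = tt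
  BF⇒semilinear (nonVert (m , μ) k) μ≡0 with μ ≟ 0#
  ... | yes refl = tt
  ... | no  μ≢0  = ⊥-elim (μ≢0 μ≡0)

  private
    ratio : Kq → Kq → Kq
    ratio p q = (p K.* K.bar K.θ K.+ q K.* K.θ) K.* (p K.+ q) K.⁻¹

    -- If the ratio is x + y θ, then θ = m + μ (x + y θ) yields μ = 1 / y and m = - x / y.
    slope-of : Kq → Kq → H Fq r s
    slope-of p q = - (proj₁ (ratio p q) * i) , i
      where i = proj₂ (ratio p q) ⁻¹

    module Linear {p q : Kq} (N≢ : K.N p ≢ K.N q) where
      open SlopeOfForm N≢
      x y m μ : F
      x = proj₁ g
      y = proj₂ g
      m = proj₁ (slope-of p q)
      μ = proj₂ (slope-of p q)

      y≢0 : y ≢ 0#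
      y≢0 e = g-moved (trans (cong (λ y → K.bar (x , y)) e) (trans (scalar-fixed x) (cong (x ,_) (sym e))))

      μ≢0 : μ ≢ 0#
      μ≢0 e = 0≢1 (trans (sym (R.zeroʳ y)) (trans (cong (y *_) (sym e)) (⁻¹-inverse y y≢0)))

      slope-relation : scalar μ K.* g ≡ K.θ K.- scalar m
      slope-relation = cong₂ _,_
        (solve 4 (λ x y i s → i :* x :+ s :* (:0 :* y) := :0 :+ (:- (:- (x :* i)))) refl x y μ s)
        (by₁ 1# (⁻¹-inverse y y≢0) (solve 4 (λ x y i r → (i :* y :+ :0 :* x :+ r :* (:0 :* y)) :- (:1 :+ (:- :0)) := :1 :* (y :* i :- :1)) refl x y μ r))

      target : Kq → Kq
      target κ = scalar μ K.* (κ K.* σ K.⁻¹)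

      intercept : Kq → H Fq r s
      -- Solves `level m μ k` = `target κ` for k; dividing by μ is multiplying by y.
      intercept κ = (proj₁ (target κ) + m * proj₂ (target κ)) * y , proj₂ (target κ)

      level-intercept : ∀ κ → level m μ (intercept κ) ≡ target κ
      level-intercept κ = cong (_, proj₂ (target κ)) (by₁ (proj₁ (target κ) + m * proj₂ (target κ)) (⁻¹-inverse y y≢0)
        (solve 5 (λ t₁ t₂ m i y → (i :* ((t₁ :+ m :* t₂) :* y) :- m :* t₂) :- t₁ := (t₁ :+ m :* t₂) :* (y :* i :- :1)) refl (proj₁ (target κ)) (proj₂ (target κ)) m μ y))

      On⇒∈ : ∀ {κ} P → On (coordinates P) (linear p q N≢) κ → P ∈ℓ nonVert (slope-of p q) (intercept κ)
      On⇒∈ {κ} P o = level⇒∈ μ≢0 P (trans (sym (form-of-correct m μ P))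
        (trans (scaled-form (z₁ P) (z₂ P) slope-relation
          (trans (cong₂ (λ x y → p K.* x K.+ q K.* y) (sym (coordinates-x P)) (sym (coordinates-y P))) o))
          (sym (level-intercept κ))))

    semilinear-line : ∀ {ε} → K.N ε ≡ K.1# → Dec (ε ≡ K.1#) → Kq → HLine
    semilinear-line unit (yes _)  κ = vert (K.- (κ K.* δ K.⁻¹))
    semilinear-line unit (no ε≢1) κ = nonVert (proj₁ (SlopeOfUnit.m unit ε≢1) , 0#) (SlopeOfUnit.intercept unit ε≢1 κ)

    -- The slope is written without the proof that ε has norm 1, because directions with equal ε may
    -- carry different proofs.
    semilinear-infinity : (ε : Kq) → Dec (ε ≡ K.1#) → PPoint Fq r s
    semilinear-infinity ε (yes _) = vertInf
    semilinear-infinity ε (no _)  = slope (proj₁ ((K.θ K.- ε K.* K.bar K.θ) K.* (K.1# K.- ε) K.⁻¹) , 0#)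

    semilinear-∈ : ∀ {ε κ} (unit : K.N ε ≡ K.1#) (d : Dec (ε ≡ K.1#)) P → On (coordinates P) (semilinear ε unit) κ → P ∈ℓ semilinear-line unit d κ
    semilinear-∈ {κ = κ} unit (yes refl) (X , Y) o = On⇒vertical unit (subst (On (coordinates (X , Y)) (semilinear K.1# unit)) (sym κ≡) o)
      where
      κ≡ : K.- δ K.* (K.- (κ K.* δ K.⁻¹)) ≡ κ
      κ≡ = vertical-constant κ
    semilinear-∈ {κ = κ} unit (no ε≢1) (X , Y) o = sloped⇒∈ X Y
        (subst (λ m → Y ≡ m K.* X K.+ intercept κ) (fixed⇒scalar fixed)
          (On⇒sloped unit ε≢1 relation (subst (On (coordinates (X , Y)) (semilinear _ unit)) (sym (intercept-relation κ)) o)))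
      where open SlopeOfUnit unit ε≢1

    semilinear-infinity-∈ : ∀ {ε κ} (unit : K.N ε ≡ K.1#) (d : Dec (ε ≡ K.1#)) →
      _∈P_ Fq r s (semilinear-infinity ε d) (affL (semilinear-line unit d κ))
    semilinear-infinity-∈ unit (yes _) = tt
    semilinear-infinity-∈ unit (no _)  = refl

  hall-line : Direction → Kq → HLine
  hall-line (linear p q N≢) κ       = nonVert (slope-of p q) (Linear.intercept N≢ κ)
  hall-line (semilinear ε unit) κ   = semilinear-line unit (ε K.≟ K.1#) κ

  On⇒∈-line : ∀ {κ} d P → On (coordinates P) d κ → P ∈ℓ hall-line d κ
  On⇒∈-line (linear p q N≢)     P o = Linear.On⇒∈ N≢ P o
  On⇒∈-line (semilinear ε unit) P o = semilinear-∈ unit (ε K.≟ K.1#) P o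

  at-infinity : Direction → PPoint Fq r s
  at-infinity (linear p q _)     = slope (slope-of p q)
  at-infinity (semilinear ε _)   = semilinear-infinity ε (ε K.≟ K.1#)

  at-infinity-∈ : ∀ d κ → _∈P_ Fq r s (at-infinity d) (affL (hall-line d κ))
  at-infinity-∈ (linear _ _ _) κ        = refl
  at-infinity-∈ (semilinear ε unit) κ   = semilinear-infinity-∈ unit (ε K.≟ K.1#)

  hall-projective : ProjectiveLine → PLine Fq r s
  hall-projective (affine d κ) = affL (hall-line d κ)
  hall-projective infinity     = lInf

  DirectionOn⇒∈ : ∀ d n → DirectionOn d n → _∈P_ Fq r s (at-infinity d) (hall-projective n)
  DirectionOn⇒∈ (linear p q _)   infinity _ = tt
  DirectionOn⇒∈ (semilinear ε _) infinity _ = ∈lInf (ε K.≟ K.1#)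
    where
    ∈lInf : ∀ d → _∈P_ Fq r s (semilinear-infinity ε d) lInf
    ∈lInf (yes _) = tt
    ∈lInf (no _)  = tt
  DirectionOn⇒∈ (linear p q _)   (affine (linear _ _ N≢) κ) (refl , refl) = refl
  DirectionOn⇒∈ (semilinear ε _) (affine (semilinear _ unit) κ) refl      = at-infinity-∈ (semilinear ε unit) κ

  On⇒∈-point : ∀ {κ} d z → On z d κ → point z ∈ℓ hall-line d κ
  On⇒∈-point {κ} d z o = On⇒∈-line d (point z) (subst (λ z → On z d κ) (sym (coordinates-point z)) o)

  PointOn⇒∈ : ∀ z n → PointOn z n → _∈P_ Fq r s (aff (point z)) (hall-projective n)
  PointOn⇒∈ z (affine d κ) o = On⇒∈-point d z o

  Meet⇒MeetOn : ∀ {X Y Z W n} → Meet X Y Z W n →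
    MeetOn Fq r s (aff (point X)) (aff (point Y)) (aff (point Z)) (aff (point W)) (hall-projective n)
  Meet⇒MeetOn {X} {Y} {Z} {W} {n} (at-point d κ e l P x y z w p p′ pn) = affL (hall-line d κ) , affL (hall-line e l) , aff (point P) ,
    On⇒∈-point d X x , On⇒∈-point d Y y , On⇒∈-point e Z z , On⇒∈-point e W w , On⇒∈-point d P p , On⇒∈-point e P p′ , PointOn⇒∈ P n pn
  Meet⇒MeetOn {X} {Y} {Z} {W} {n} (parallel d κ l x y z w dn) = affL (hall-line d κ) , affL (hall-line d l) , at-infinity d ,
    On⇒∈-point d X x , On⇒∈-point d Y y , On⇒∈-point d Z z , On⇒∈-point d W w , at-infinity-∈ d κ , at-infinity-∈ d l , DirectionOn⇒∈ d n dn

-- Exhaustive search over fields with at most four elements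

-- Conditions are data so that they can be read twice: by `check` in the tables and by `_⊨_` in K.
data Formula (n : ℕ) : Set where
  _≐_ _≭_ : Term n → Term n → Formula n
  _&_ _∥_ : Formula n → Formula n → Formula n

infix  4 _≐_ _≭_
infixr 3 _&_
infixr 2 _∥_

module Satisfaction (S : StarField) where
  open StarField S
  open StarSolver S

  _⊨_ : ∀ {n} → Vec K n → Formula n → Set
  ρ ⊨ (s ≐ t) = ⟦ s ⟧ ρ ≡ ⟦ t ⟧ ρ
  ρ ⊨ (s ≭ t) = ⟦ s ⟧ ρ ≢ ⟦ t ⟧ ρ
  ρ ⊨ (A & B) = ρ ⊨ A × ρ ⊨ B
  ρ ⊨ (A ∥ B) = ρ ⊨ A ⊎ ρ ⊨ B

record Tables : Set₁ where
  infixl 7 _*_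
  infixl 6 _+_
  infix  8 -_
  infix  4 _==_
  field
    C        : Set
    _+_ _*_  : C → C → C
    -_       : C → C
    0# 1#    : C
    _==_     : C → C → Bool
    elements : List C
    complete : ∀ x → x ∈ elements

all-∈ : ∀ {A : Set} {p : A → Bool} {x xs} → all p xs ≡ true → x ∈ xs → p x ≡ true
all-∈ {p = p} {xs = y ∷ _} h (here refl) with p y
... | true = refl
all-∈ {p = p} {xs = y ∷ _} h (there x∈) with p y
... | true = all-∈ h x∈

all-true : ∀ {A : Set} {p : A → Bool} xs → (∀ x → p x ≡ true) → all p xs ≡ true
all-true [] h = refl
all-true (x ∷ xs) h rewrite h x = all-true xs h

any-∃ : ∀ {A : Set} {p : A → Bool} xs → any p xs ≡ true → Σ A λ x → p x ≡ true
any-∃ {p = p} (x ∷ xs) h with p x in e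
... | true  = x , e
... | false = any-∃ xs h

module Evaluation (A : Tables) (r s : Tables.C A) where
  open Tables A

  K₀ : Set
  K₀ = C × C

  value : ∀ {n} → Term n → Vec K₀ n → K₀
  value (var i) ρ  = lookup ρ i
  value (t ∔ u) ρ  = let (a , b) = value t ρ ; (c , d) = value u ρ in a + c , b + d
  value (t · u) ρ  = let (a , b) = value t ρ ; (c , d) = value u ρ in a * c + s * (b * d) , (a * d + b * c) + r * (b * d)
  value (t ⊖ u) ρ  = let (a , b) = value t ρ ; (c , d) = value u ρ in a + (- c) , b + (- d)
  value (⊝ t) ρ    = let (a , b) = value t ρ in - a , - b
  value (conj t) ρ = let (a , b) = value t ρ in a + r * b , - b
  value `0 ρ       = 0# , 0#
  value `1 ρ       = 1# , 0#

  equal : K₀ → K₀ → Bool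
  equal (a , b) (c , d) = (a == c) ∧ (b == d)

  check : ∀ {n} → Formula n → Vec K₀ n → Bool
  check (t ≐ u) ρ = equal (value t ρ) (value u ρ)
  check (t ≭ u) ρ = not (equal (value t ρ) (value u ρ))
  check (B & D) ρ = check B ρ ∧ check D ρ
  check (B ∥ D) ρ = check B ρ ∨ check D ρ

  elementsK : List K₀
  elementsK = List.concatMap (λ a → List.map (a ,_) elements) elements

  irreducible? : Bool
  irreducible? = all (λ x → not ((x * x + (- (r * x))) + (- s) == 0#)) elements

-- In effect an isomorphism from the tables onto F; injectivity is stated through the Boolean test,
-- the form in which `check` relies on it.
record Presentation (A : Tables) (Fq : FiniteField) : Set where
  private
    module A = Tables A
    module F = FiniteField Fq
  field
    φ         : A.C → F.Carrier
    φ-+       : ∀ x y → φ (x A.+ y) ≡ φ x F.+ φ y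
    φ-*       : ∀ x y → φ (x A.* y) ≡ φ x F.* φ y
    φ--       : ∀ x → φ (A.- x) ≡ F.- φ x
    φ-0       : φ A.0# ≡ F.0#
    φ-1       : φ A.1# ≡ F.1#
    ==-true   : ∀ x y → (x A.== y) ≡ true → φ x ≡ φ y
    ==-false  : ∀ x y → (x A.== y) ≡ false → φ x ≢ φ y
    surjective : ∀ y → Σ A.C λ x → φ x ≡ y

module Transfer {A : Tables} {Fq : FiniteField} (P : Presentation A Fq) (r₀ s₀ : Tables.C A)
  (irreducible : Irreducible Fq (Presentation.φ P r₀) (Presentation.φ P s₀)) where
  open Presentation P
  open Tables A using (_==_; elements; complete)
  open Evaluation A r₀ s₀
  open QuadraticExtension Fq (φ r₀) (φ s₀) irreducible
  open StarSolver starField using (⟦_⟧)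
  open Satisfaction starField
  private
    module F = FiniteField Fq
    module K = StarField starField

  Φ : K₀ → Kq
  Φ (a , b) = φ a , φ b

  value-correct : ∀ {n} (t : Term n) ρ → Φ (value t ρ) ≡ ⟦ t ⟧ (Vec.map Φ ρ)
  value-correct (var i) ρ = sym (Vecₚ.lookup-map i Φ ρ)
  value-correct (t ∔ u) ρ rewrite sym (value-correct t ρ) | sym (value-correct u ρ) = cong₂ _,_ (φ-+ _ _) (φ-+ _ _)
  value-correct (t · u) ρ rewrite sym (value-correct t ρ) | sym (value-correct u ρ) = cong₂ _,_
    (trans (φ-+ _ _) (cong₂ F._+_ (φ-* _ _) (trans (φ-* _ _) (cong (φ s₀ F.*_) (φ-* _ _)))))
    (trans (φ-+ _ _) (cong₂ F._+_ (trans (φ-+ _ _) (cong₂ F._+_ (φ-* _ _) (φ-* _ _))) (trans (φ-* _ _) (cong (φ r₀ F.*_) (φ-* _ _)))))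
  value-correct (t ⊖ u) ρ rewrite sym (value-correct t ρ) | sym (value-correct u ρ) = cong₂ _,_
    (trans (φ-+ _ _) (cong (_ F.+_) (φ-- _))) (trans (φ-+ _ _) (cong (_ F.+_) (φ-- _)))
  value-correct (⊝ t) ρ rewrite sym (value-correct t ρ) = cong₂ _,_ (φ-- _) (φ-- _)
  value-correct (conj t) ρ rewrite sym (value-correct t ρ) = cong₂ _,_ (trans (φ-+ _ _) (cong (_ F.+_) (φ-* _ _))) (φ-- _)
  value-correct `0 ρ = cong₂ _,_ φ-0 φ-0
  value-correct `1 ρ = cong₂ _,_ φ-1 φ-0

  equal-true : ∀ x y → equal x y ≡ true → Φ x ≡ Φ y
  equal-true (a , b) (c , d) h with a == c in e | b == d in e′
  ... | true | true = cong₂ _,_ (==-true a c e) (==-true b d e′)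

  equal-false : ∀ x y → equal x y ≡ false → Φ x ≢ Φ y
  equal-false (a , b) (c , d) h e with a == c in ac | b == d in bd
  ... | false | _     = ==-false a c ac (cong proj₁ e)
  ... | true  | false = ==-false b d bd (cong proj₂ e)

  check-sound : ∀ {n} (B : Formula n) ρ → check B ρ ≡ true → Vec.map Φ ρ ⊨ B
  check-unsound : ∀ {n} (B : Formula n) ρ → check B ρ ≡ false → ¬ (Vec.map Φ ρ ⊨ B)
  check-sound (t ≐ u) ρ h = trans (sym (value-correct t ρ)) (trans (equal-true _ _ h) (value-correct u ρ))
  check-sound (t ≭ u) ρ h e with equal (value t ρ) (value u ρ) in eq
  ... | false = equal-false _ _ eq (trans (value-correct t ρ) (trans e (sym (value-correct u ρ))))
  check-sound (B & D) ρ h with check B ρ in b | check D ρ in d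
  ... | true | true = check-sound B ρ b , check-sound D ρ d
  check-sound (B ∥ D) ρ h with check B ρ in b | check D ρ in d
  ... | true  | _    = inj₁ (check-sound B ρ b)
  ... | false | true = inj₂ (check-sound D ρ d)
  check-unsound (t ≐ u) ρ h e = equal-false _ _ h (trans (value-correct t ρ) (trans e (sym (value-correct u ρ))))
  check-unsound (t ≭ u) ρ h e with equal (value t ρ) (value u ρ) in eq
  ... | true = e (trans (sym (value-correct t ρ)) (trans (equal-true _ _ eq) (value-correct u ρ)))
  check-unsound (B & D) ρ h (x , y) with check B ρ in b | check D ρ in d
  ... | false | _     = check-unsound B ρ b x
  ... | true  | false = check-unsound D ρ d y
  check-unsound (B ∥ D) ρ h x with check B ρ in b | check D ρ in d
  check-unsound (B ∥ D) ρ h (inj₁ x) | false | false = check-unsound B ρ b x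
  check-unsound (B ∥ D) ρ h (inj₂ y) | false | false = check-unsound D ρ d y

  check-complete : ∀ {n} (B : Formula n) ρ → Vec.map Φ ρ ⊨ B → check B ρ ≡ true
  check-complete B ρ x with check B ρ in b
  ... | true  = refl
  ... | false = ⊥-elim (check-unsound B ρ b x)

  irreducible?-true : irreducible? ≡ true
  irreducible?-true = all-true elements λ x → nonzero x _ refl
    where
    module A = Tables A
    nonzero : ∀ x b → ((x A.* x A.+ (A.- (r₀ A.* x))) A.+ (A.- s₀) == A.0#) ≡ b → not b ≡ true
    nonzero x false _ = refl
    nonzero x true  e = ⊥-elim (no-root (φ x) (trans (sym (trans (φ-+ _ _) (cong₂ F._+_ (trans (φ-+ _ _) (cong₂ F._+_ (φ-* x x) (trans (φ-- _) (cong F.-_ (φ-* _ _))))) (φ-- _))))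
      (trans (==-true _ _ e) φ-0)))

  Φ-surjective : ∀ y → Σ K₀ λ x → Φ x ≡ y
  Φ-surjective (a , b) with surjective a | surjective b
  ... | x , refl | y , refl = (x , y) , refl

infix 8 #_
#_ : ∀ {n} → Fin n → Term n
#_ = var

linear-parallel : ∀ {n} (κ a b u v : Term n) → Formula n
linear-parallel κ a b u v = ((norm (v ⊖ a) ≭ κ · norm v) & ((v ⊖ a) · u ≐ (u ⊖ b) · v)) ∥
                            ((norm (v ⊖ a) ≐ κ · norm v) & (v · conj (u ⊖ b) ≐ u · conj (v ⊖ a)))

parallel-joins : ∀ {n} (a b u v : Term n) → Formula n
parallel-joins a b u v = ((norm (v ⊖ a) ≭ norm (conj v)) & ((v ⊖ a) · conj u ≐ (u ⊖ b) · conj v)) ∥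
                         ((norm (v ⊖ a) ≐ norm (conj v)) & (conj v · conj (u ⊖ b) ≐ conj u · conj (v ⊖ a)))

distinct-nonzero : ∀ {n} (u v w : Term n) → Formula n
distinct-nonzero u v w = (u ≭ `0) & (v ≭ `0) & (w ≭ `0) & (u ≭ v) & (u ≭ w) & (v ≭ w)

-- The known properties of κ = N k. The second line enters the goal only through κ, so the search
-- runs over κ and not over k.
admissible-factor : Formula 1
admissible-factor = (conj (# 0F) ≐ # 0F) & (# 0F ≭ `0) & (# 0F ≭ `1)

admissible-points : Formula 2
admissible-points = (# 0F ≭ `0) & (# 1F ≭ `0) & (`1 ≭ # 0F) & (`1 ≭ # 1F) & (# 0F ≭ # 1F)

-- Variables: κ, b, c, u, v, w.
linear-goal : Formula 6
linear-goal = linear-parallel (# 0F) `1 (# 1F) (# 3F) (# 4F) & linear-parallel (# 0F) `1 (# 2F) (# 3F) (# 5F) &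
              linear-parallel (# 0F) (# 1F) (# 2F) (# 4F) (# 5F) & distinct-nonzero (# 3F) (# 4F) (# 5F)

-- Variables: b, c, u, v, w.
mixed-goal : Formula 5
mixed-goal = parallel-joins `1 (# 0F) (# 2F) (# 3F) & parallel-joins `1 (# 1F) (# 2F) (# 4F) &
             parallel-joins (# 0F) (# 1F) (# 3F) (# 4F) & distinct-nonzero (# 2F) (# 3F) (# 4F)

common-direction-conditions : ∀ {n} (a b c m t μ ν : Term n) → Formula n
common-direction-conditions a b c m t μ ν =
  (ν ≐ conj v) & (μ ≐ conj u) & (ω ≐ conj w) & (norm m ≭ `1) & (norm (v ⊖ c) ≭ norm ν) & (norm (u ⊖ c) ≭ norm μ) &
  (norm (w ⊖ a) ≭ norm ω) & (norm (w ⊖ b) ≭ norm ω) & (ν ≭ `0) & (μ ≭ `0) & (ω ≭ `0) & (t ≭ `0) & (t ≭ `1)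
  where
  u = b ∔ m · μ
  v = a ∔ m · ν
  ω = ν ∔ t · (μ ⊖ ν)
  w = a ∔ t · (b ⊖ a) ∔ m · ω

-- Variables: b, c, m, t, μ, ν.
mixed-goal′ : Formula 6
mixed-goal′ = common-direction-conditions `1 (# 0F) (# 1F) (# 2F) (# 3F) (# 4F) (# 5F) ∥
              common-direction-conditions `1 (# 1F) (# 0F) (# 2F) (# 3F) (# 4F) (# 5F) ∥
              common-direction-conditions (# 0F) (# 1F) `1 (# 2F) (# 3F) (# 4F) (# 5F)

module Interpretation (S : StarField) where
  open StarField S
  open Satisfaction S
  open FieldLemmas S
  open Plane S
  open Configurations S
  open Crossing S

  linear-goal⇒config : ∀ {k b c u v w} → k ≢ 0# → (N k ∷ b ∷ c ∷ u ∷ v ∷ w ∷ []) ⊨ linear-goal → Config (LinearPoint k) (1# , 0#) (b , 0#) (c , 0#)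
  linear-goal⇒config k≢0 (AB , AC , BC , u≢0 , v≢0 , w≢0 , uv , uw , vw) = linear-pair k≢0 u≢0 v≢0 w≢0 uv uw vw AB AC BC

  mixed-goal⇒config : ∀ {b c u v w} → (b ∷ c ∷ u ∷ v ∷ w ∷ []) ⊨ mixed-goal → Config SemilinearPoint (1# , 0#) (b , 0#) (c , 0#)
  mixed-goal⇒config (AB , AC , BC , u≢0 , v≢0 , w≢0 , uv , uw , vw) = mixed-pair u≢0 v≢0 w≢0 uv uw vw AB AC BC

  mixed-goal′⇒config : ∀ {b c m t μ ν} → 1# ≢ b → 1# ≢ c → b ≢ c → (b ∷ c ∷ m ∷ t ∷ μ ∷ ν ∷ []) ⊨ mixed-goal′ →
    Config SemilinearPoint (1# , 0#) (b , 0#) (c , 0#)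
  mixed-goal′⇒config {b} {c} {m} {t} {μ} {ν} 1≢b 1≢c b≢c = λ
    { (inj₁ (ν≡ , μ≡ , ω≡ , m∉ , vc , uc , wa , wb , ν≢0 , μ≢0 , ω≢0 , t≢0 , t≢1)) →
        CommonDirection.common-direction {1#} {b} {c} {m} {t} {μ} {ν} m∉ ν≢0 1≢b t≢0 t≢1 (μ≡ , μ≢0) (ν≡ , ν≢0) (ω≡ , ω≢0) wa wb uc vc
    ; (inj₂ (inj₁ (ν≡ , μ≡ , ω≡ , m∉ , vc , uc , wa , wb , ν≢0 , μ≢0 , ω≢0 , t≢0 , t≢1))) →
        swap₂₃ (CommonDirection.common-direction {1#} {c} {b} {m} {t} {μ} {ν} m∉ ν≢0 1≢c t≢0 t≢1 (μ≡ , μ≢0) (ν≡ , ν≢0) (ω≡ , ω≢0) wa wb uc vc)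
    ; (inj₂ (inj₂ (ν≡ , μ≡ , ω≡ , m∉ , vc , uc , wa , wb , ν≢0 , μ≢0 , ω≢0 , t≢0 , t≢1))) →
        swap₁₂ (swap₂₃ (CommonDirection.common-direction {b} {c} {1#} {m} {t} {μ} {ν} m∉ ν≢0 b≢c t≢0 t≢1 (μ≡ , μ≢0) (ν≡ , ν≢0) (ω≡ , ω≢0) wa wb uc vc)) }

implies-true : ∀ {p q} → (not p ∨ q) ≡ true → p ≡ true → q ≡ true
implies-true {true} h refl = h

module Search (A : Tables) where
  open Tables A

  -- Candidates for n unknowns, given m data.
  Strategy : ℕ → ℕ → Set
  Strategy m n = ∀ r s → let open Evaluation A r s in Vec K₀ m → List (Vec K₀ n)

  module _ (r s : C) where
    open Evaluation A r s

    linear-test : Strategy 3 3 → Bool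
    linear-test strategy = all (λ κ → not (check admissible-factor (κ ∷ [])) ∨
      all (λ b → all (λ c → not (check admissible-points (b ∷ c ∷ [])) ∨
        any (λ τ → check linear-goal (κ ∷ b ∷ c ∷ τ)) (strategy r s (κ ∷ b ∷ c ∷ []))) elementsK) elementsK) elementsK

    mixed-test : ∀ {n} → Formula (2 ℕ.+ n) → Strategy 2 n → Bool
    mixed-test goal strategy = all (λ b → all (λ c → not (check admissible-points (b ∷ c ∷ [])) ∨
      any (λ τ → check goal (b ∷ c ∷ τ)) (strategy r s (b ∷ c ∷ []))) elementsK) elementsK

  everywhere : (C → C → Bool) → Bool
  everywhere test = all (λ r → all (λ s → not (Evaluation.irreducible? A r s) ∨ test r s) elements) elements

  -- Records, so that comparing two such types does not run the searches.
  record LinearVerified (strategy : Strategy 3 3) : Set where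
    constructor linear-verified
    field holds : everywhere (λ r s → linear-test r s strategy) ≡ true

  record MixedVerified {n} (goal : Formula (2 ℕ.+ n)) (strategy : Strategy 2 n) : Set where
    constructor mixed-verified
    field holds : everywhere (λ r s → mixed-test r s goal strategy) ≡ true

module _ {A : Tables} {Fq : FiniteField} (P : Presentation A Fq) (r₀ s₀ : Tables.C A)
  (irreducible : Irreducible Fq (Presentation.φ P r₀) (Presentation.φ P s₀)) where
  open Presentation P
  open Tables A using (elements; complete)
  open Evaluation A r₀ s₀
  open QuadraticExtension Fq (φ r₀) (φ s₀) irreducible using (starField)
  open StarField starField
  open Satisfaction starField
  open FieldLemmas starField
  open Plane starField
  open Crossing starField
  open Interpretation starField
  open Transfer P r₀ s₀ irreducible
  open Search A

  everywhere⇒ : ∀ {test} → everywhere test ≡ true → test r₀ s₀ ≡ true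
  everywhere⇒ h = implies-true (all-∈ (all-∈ h (complete r₀)) (complete s₀)) irreducible?-true

  elementsK-complete : ∀ x → x ∈ elementsK
  elementsK-complete (a , b) = ∈-concatMap⁺ (λ a → List.map (a ,_) elements) (Any.map (λ { refl → ∈-map⁺ (a ,_) (complete b) }) (complete a))

  linear-test⇒config : ∀ {strategy} → LinearVerified strategy → ∀ {k b c} → k ≢ 0# → N k ≢ 1# → b ≢ 0# → c ≢ 0# → 1# ≢ b → 1# ≢ c → b ≢ c →
    Config (LinearPoint k) (1# , 0#) (b , 0#) (c , 0#)
  linear-test⇒config {strategy} (linear-verified h) {k} {b} {c} k≢0 Nk≢1 b≢0 c≢0 1≢b 1≢c b≢c = found (Φ-surjective (N k)) (Φ-surjective b) (Φ-surjective c)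
    where
    found : Σ K₀ (λ x → Φ x ≡ N k) → Σ K₀ (λ x → Φ x ≡ b) → Σ K₀ (λ x → Φ x ≡ c) → Config (LinearPoint k) (1# , 0#) (b , 0#) (c , 0#)
    found (κ₀ , κ≡) (b₀ , refl) (c₀ , refl) = conclude (any-∃ (strategy r₀ s₀ (κ₀ ∷ b₀ ∷ c₀ ∷ [])) (implies-true (all-∈ (all-∈ (implies-true (all-∈ (everywhere⇒ {λ r s → linear-test r s strategy} h) (elementsK-complete κ₀))
        (check-complete admissible-factor (κ₀ ∷ []) (subst (λ κ → (κ ∷ []) ⊨ admissible-factor) (sym κ≡) (fixed , N-≢0 k≢0 , Nk≢1))))
        (elementsK-complete b₀)) (elementsK-complete c₀)) (check-complete admissible-points (b₀ ∷ c₀ ∷ []) (b≢0 , c≢0 , 1≢b , 1≢c , b≢c))))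
      where
      fixed : bar (N k) ≡ N k
      fixed = trans (bar-* k (bar k)) (trans (cong (bar k *_) (bar-bar k)) (CommutativeRing.*-comm commutativeRing (bar k) k))
      conclude : Σ (Vec K₀ 3) (λ τ → check linear-goal (κ₀ ∷ b₀ ∷ c₀ ∷ τ) ≡ true) → Config (LinearPoint k) (1# , 0#) (b , 0#) (c , 0#)
      conclude (u ∷ v ∷ w ∷ [] , ok) = linear-goal⇒config k≢0
        (subst (λ κ → (κ ∷ b ∷ c ∷ Φ u ∷ Φ v ∷ Φ w ∷ []) ⊨ linear-goal) κ≡ (check-sound linear-goal (κ₀ ∷ b₀ ∷ c₀ ∷ u ∷ v ∷ w ∷ []) ok))

  mixed-test⇒ : ∀ {n} {goal : Formula (2 ℕ.+ n)} {strategy} → MixedVerified goal strategy → ∀ {b c} → b ≢ 0# → c ≢ 0# → 1# ≢ b → 1# ≢ c → b ≢ c →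
    Σ (Vec K₀ n) λ τ → (b ∷ c ∷ Vec.map Φ τ) ⊨ goal
  mixed-test⇒ {_} {goal} {strategy} (mixed-verified h) {b} {c} b≢0 c≢0 1≢b 1≢c b≢c = found (Φ-surjective b) (Φ-surjective c)
    where
    found : Σ K₀ (λ x → Φ x ≡ b) → Σ K₀ (λ x → Φ x ≡ c) → Σ (Vec K₀ _) λ τ → (b ∷ c ∷ Vec.map Φ τ) ⊨ goal
    found (b₀ , refl) (c₀ , refl) = conclude (any-∃ (strategy r₀ s₀ (b₀ ∷ c₀ ∷ [])) (implies-true (all-∈ (all-∈ (everywhere⇒ {λ r s → mixed-test r s goal strategy} h) (elementsK-complete b₀)) (elementsK-complete c₀))
        (check-complete admissible-points (b₀ ∷ c₀ ∷ []) (b≢0 , c≢0 , 1≢b , 1≢c , b≢c))))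
      where
      conclude : Σ (Vec K₀ _) (λ τ → check goal (b₀ ∷ c₀ ∷ τ) ≡ true) → Σ (Vec K₀ _) λ τ → (b ∷ c ∷ Vec.map Φ τ) ⊨ goal
      conclude (τ , ok) = τ , check-sound goal (b₀ ∷ c₀ ∷ τ) ok

  mixed-test⇒config : ∀ {strategy} → MixedVerified mixed-goal strategy → ∀ {b c} → b ≢ 0# → c ≢ 0# → 1# ≢ b → 1# ≢ c → b ≢ c →
    Config SemilinearPoint (1# , 0#) (b , 0#) (c , 0#)
  mixed-test⇒config h b≢0 c≢0 1≢b 1≢c b≢c = conclude (mixed-test⇒ h b≢0 c≢0 1≢b 1≢c b≢c)
    where
    conclude : Σ (Vec K₀ 3) _ → _
    conclude (u ∷ v ∷ w ∷ [] , ok) = mixed-goal⇒config ok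

  mixed-test′⇒config : ∀ {strategy} → MixedVerified mixed-goal′ strategy → ∀ {b c} → b ≢ 0# → c ≢ 0# → 1# ≢ b → 1# ≢ c → b ≢ c →
    Config SemilinearPoint (1# , 0#) (b , 0#) (c , 0#)
  mixed-test′⇒config h b≢0 c≢0 1≢b 1≢c b≢c = conclude (mixed-test⇒ h b≢0 c≢0 1≢b 1≢c b≢c)
    where
    conclude : Σ (Vec K₀ 4) _ → _
    conclude (m ∷ t ∷ μ ∷ ν ∷ [] , ok) = mixed-goal′⇒config 1≢b 1≢c b≢c ok

-- The searches over two, three and four elements

module Two where
  tables : Tables
  tables = record { C = Bool ; _+_ = _xor_ ; _*_ = _∧_ ; -_ = λ x → x ; 0# = false ; 1# = true ; _==_ = λ x y → not (x xor y)
                  ; elements = false ∷ true ∷ [] ; complete = λ { false → here refl ; true → there (here refl) } }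

data Three : Set where
  zer one two : Three

module ThreeElements where
  add mul : Three → Three → Three
  add zer y = y
  add one zer = one
  add one one = two
  add one two = zer
  add two zer = two
  add two one = zer
  add two two = one
  mul zer y = zer
  mul one y = y
  mul two zer = zer
  mul two one = two
  mul two two = one
  neg : Three → Three
  neg zer = zer
  neg one = two
  neg two = one
  same : Three → Three → Bool
  same zer zer = true
  same one one = true
  same two two = true
  same _ _ = false
  tables : Tables
  tables = record { C = Three ; _+_ = add ; _*_ = mul ; -_ = neg ; 0# = zer ; 1# = one ; _==_ = same
                  ; elements = zer ∷ one ∷ two ∷ [] ; complete = λ { zer → here refl ; one → there (here refl) ; two → there (there (here refl)) } }

module Four where
  -- (x , y) stands for x + y ω with ω² = 1 + ω.
  tables : Tables
  tables = record { C = Bool × Bool ; _+_ = λ (a , b) (c , d) → a xor c , b xor d ; _*_ = λ (a , b) (c , d) → (a ∧ c) xor (b ∧ d) , ((a ∧ d) xor (b ∧ c)) xor (b ∧ d)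
                  ; -_ = λ x → x ; 0# = false , false ; 1# = true , false ; _==_ = λ (a , b) (c , d) → not (a xor c) ∧ not (b xor d)
                  ; elements = (false , false) ∷ (true , false) ∷ (false , true) ∷ (true , true) ∷ []
                  ; complete = λ { (false , false) → here refl ; (true , false) → there (here refl) ; (false , true) → there (there (here refl)) ; (true , true) → there (there (there (here refl))) } }

module Strategies (A : Tables) where
  open Tables A
  open Search A

  module _ (r s : C) where
    open Evaluation A r s
    -- Triples (u , v , w) such that B holds for u and v, and D for u and w.
    triples : ∀ {m} → Formula (2 ℕ.+ m) → Formula (2 ℕ.+ m) → Vec K₀ m → List (Vec K₀ 3)
    triples B D ρ = concatMap (λ u → concatMap (λ v → if check B (u ∷ v ∷ ρ)
      then concatMap (λ w → if check D (u ∷ w ∷ ρ) then (u ∷ v ∷ w ∷ []) ∷ [] else []) elementsK else []) elementsK) elementsK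

  linear-triples : Strategy 3 3
  linear-triples r s = triples r s
    (linear-parallel (# 2F) `1 (# 3F) (# 0F) (# 1F) & # 0F ≭ # 1F) (linear-parallel (# 2F) `1 (# 4F) (# 0F) (# 1F) & # 0F ≭ # 1F)

  mixed-triples : Strategy 2 3
  mixed-triples r s = triples r s
    (parallel-joins `1 (# 2F) (# 0F) (# 1F) & # 0F ≭ # 1F) (parallel-joins `1 (# 3F) (# 0F) (# 1F) & # 0F ≭ # 1F)

  -- The triples s b c, s a c, s a b of the general construction with a = 1, for every s in K.
  common-multiples : Strategy 3 3
  common-multiples r s (_ ∷ b ∷ c ∷ []) = List.map (λ x →
      value (# 0F · (# 1F · # 2F)) (x ∷ b ∷ c ∷ []) ∷ value (# 0F · # 2F) (x ∷ b ∷ c ∷ []) ∷ value (# 0F · # 1F) (x ∷ b ∷ c ∷ []) ∷ []) elementsK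
    where open Evaluation A r s

linear₂ : Search.LinearVerified Two.tables (Strategies.common-multiples Two.tables)
linear₂ = Search.linear-verified refl

linear₃ : Search.LinearVerified ThreeElements.tables (Strategies.linear-triples ThreeElements.tables)
linear₃ = Search.linear-verified refl

linear₄ : Search.LinearVerified Four.tables (Strategies.common-multiples Four.tables)
linear₄ = Search.linear-verified refl

mixed₂ : Search.MixedVerified Two.tables mixed-goal (Strategies.mixed-triples Two.tables)
mixed₂ = Search.mixed-verified refl

mixed₃ : Search.MixedVerified ThreeElements.tables mixed-goal (Strategies.mixed-triples ThreeElements.tables)
mixed₃ = Search.mixed-verified refl

module Heights where
  open Search Four.tables
  -- In the field of four elements, y⁻¹ = y².
  height : ∀ {n} → Term n → Term n → Term n
  height m x = (conj x ∔ conj m · x) · ((`1 ⊖ norm m) · (`1 ⊖ norm m))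

  -- The two values of t are the elements of F other than 0 and 1. The three tuples for each m and t
  -- use the pairs (1 , b), (1 , c) and (b , c), in the order of the alternatives of `mixed-goal′`.
  common-directions : Strategy 2 4
  common-directions r s (b ∷ c ∷ []) = concatMap (λ m → concatMap (λ t →
      (let μ = value (height (# 0F) (# 1F)) (m ∷ b ∷ []); ν = value (height (# 0F) `1) (m ∷ []); ω = value (height (# 0F) (# 1F)) (m ∷ c ∷ []) in
       (m ∷ t ∷ μ ∷ ν ∷ []) ∷ (m ∷ t ∷ ω ∷ ν ∷ []) ∷ (m ∷ t ∷ ω ∷ μ ∷ []) ∷ []))
      (((false , true) , (false , false)) ∷ ((true , true) , (false , false)) ∷ [])) elementsK
    where open Evaluation Four.tables r s

mixed₄ : Search.MixedVerified Four.tables mixed-goal′ (Heights.common-directions)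
mixed₄ = Search.mixed-verified refl

module Existence (S : StarField) where
  open StarField S
  open Plane S
  open Crossing S

  LinearPairs MixedPairs : Set
  LinearPairs = ∀ {k b c} → k ≢ 0# → N k ≢ 1# → b ≢ 0# → c ≢ 0# → 1# ≢ b → 1# ≢ c → b ≢ c → Config (LinearPoint k) (1# , 0#) (b , 0#) (c , 0#)
  MixedPairs  = ∀ {b c} → b ≢ 0# → c ≢ 0# → 1# ≢ b → 1# ≢ c → b ≢ c → Config SemilinearPoint (1# , 0#) (b , 0#) (c , 0#)

-- Identification of the fields with two, three and four elements

module Counting (Fq : FiniteField) where
  open GroundField Fq
  open DecMembership _≟_ using (_∈?_)

  lookup-injective : ∀ {xs : List F} → Unique xs → ∀ i j → List.lookup xs i ≡ List.lookup xs j → i ≡ j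
  lookup-injective (x∉ ∷ u) zero    zero    e = refl
  lookup-injective (x∉ ∷ u) zero    (suc j) e = ⊥-elim (All.lookup x∉ (∈-lookup j) e)
  lookup-injective (x∉ ∷ u) (suc i) zero    e = ⊥-elim (All.lookup x∉ (∈-lookup i) (sym e))
  lookup-injective (x∉ ∷ u) (suc i) (suc j) e = cong suc (lookup-injective u i j e)

  unique-short : ∀ {xs : List F} → Unique xs → length xs ℕ.≤ size
  unique-short {xs} u = Finₚ.injective⇒≤ {f = λ i → decode (List.lookup xs i)} (λ {i} {j} e → lookup-injective u i j (decode-injective e))

  exhaustive : ∀ {xs : List F} → Unique xs → length xs ≡ size → ∀ y → y ∈ xs
  exhaustive {xs} u len y with y ∈? xs
  ... | yes y∈ = y∈
  ... | no  y∉ = ⊥-elim (ℕₚ.1+n≰n (subst (λ n → ℕ.suc n ℕ.≤ size) len (unique-short (¬Any⇒All¬ xs y∉ ∷ u))))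

  missing : ∀ xs → length xs ℕ.< size → Σ F (_∉ xs)
  missing = short-list-misses _≟_ (Inverse.from enum) element-injective

  1≢0 : 1# ≢ 0#
  1≢0 e = 0≢1 (sym e)

  0-1-unique : Unique (0# ∷ 1# ∷ [])
  0-1-unique = (0≢1 ∷ []) ∷ [] ∷ []

  1+1≢1 : 1# + 1# ≢ 1#
  1+1≢1 e = 1≢0 (by₁ 1# e (solve 0 (:1 :- :0 := :1 :* (:1 :+ :1 :- :1)) refl))

  four-elements : 1# + 1# ≡ 0# → ∀ {x} → x ∉ (0# ∷ 1# ∷ []) → Unique (0# ∷ 1# ∷ x ∷ (1# + x) ∷ [])
  four-elements 2≡0 {x} x∉ = (0≢1 ∷ (λ e → x∉ (here (sym e))) ∷ (λ e → x∉ (there (here (by₂ (- 1#) 2≡0 (- 1#) e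
      (solve 1 (λ x → x :- :1 := (:- :1) :* (:1 :+ :1 :- :0) :+ (:- :1) :* (:0 :- (:1 :+ x))) refl x))))) ∷ []) ∷
    ((λ e → x∉ (there (here (sym e)))) ∷ (λ e → x∉ (here (by₁ (- 1#) e (solve 1 (λ x → x :- :0 := (:- :1) :* (:1 :- (:1 :+ x))) refl x)))) ∷ []) ∷
    ((λ e → 1≢0 (by₁ (- 1#) e (solve 1 (λ x → :1 :- :0 := (:- :1) :* (x :- (:1 :+ x))) refl x))) ∷ []) ∷ [] ∷ []

  module Size-two (size≡2 : size ≡ 2) where
    cover : ∀ y → y ∈ (0# ∷ 1# ∷ [])
    cover = exhaustive 0-1-unique (sym size≡2)

    2≡0 : 1# + 1# ≡ 0#
    2≡0 with cover (1# + 1#)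
    ... | here e         = e
    ... | there (here e) = ⊥-elim (1+1≢1 e)

    φ : Bool → F
    φ false = 0#
    φ true  = 1#

    presentation : Presentation Two.tables Fq
    presentation = record
      { φ = φ
      ; φ-+ = λ { false y → sym (R.+-identityˡ _) ; true false → sym (R.+-identityʳ _) ; true true → sym 2≡0 }
      ; φ-* = λ { false y → sym (R.zeroˡ _) ; true y → sym (R.*-identityˡ _) }
      ; φ-- = λ { false → solve 0 (:0 := :- :0) refl ; true → by₁ 1# 2≡0 (solve 0 (:1 :- (:- :1) := :1 :* (:1 :+ :1 :- :0)) refl) }
      ; φ-0 = refl
      ; φ-1 = refl
      ; ==-true = λ { false false _ → refl ; true true _ → refl }
      ; ==-false = λ { false true _ → 0≢1 ; true false _ → 1≢0 }
      ; surjective = λ y → preimage (cover y)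
      }
      where
      preimage : ∀ {y} → y ∈ (0# ∷ 1# ∷ []) → Σ Bool λ x → φ x ≡ y
      preimage (here refl)         = false , refl
      preimage (there (here refl)) = true , refl

  module Size-three (size≡3 : size ≡ 3) where
    -- In characteristic 2 a third element x would bring a fourth, 1 + x.
    2≢0 : 1# + 1# ≢ 0#
    2≢0 2≡0 with missing (0# ∷ 1# ∷ []) (subst (3 ℕ.≤_) (sym size≡3) ℕₚ.≤-refl)
    ... | x , x∉ = ℕₚ.1+n≰n (subst (4 ℕ.≤_) size≡3 (unique-short (four-elements 2≡0 x∉)))

    -1≢0 : - 1# ≢ 0#
    -1≢0 e = 1≢0 (by₁ (- 1#) e (solve 0 (:1 :- :0 := (:- :1) :* ((:- :1) :- :0)) refl))

    -1≢1 : - 1# ≢ 1#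
    -1≢1 e = 2≢0 (by₁ (- 1#) e (solve 0 ((:1 :+ :1) :- :0 := (:- :1) :* ((:- :1) :- :1)) refl))

    cover : ∀ y → y ∈ (0# ∷ 1# ∷ - 1# ∷ [])
    cover = exhaustive ((0≢1 ∷ (λ e → -1≢0 (sym e)) ∷ []) ∷ ((λ e → -1≢1 (sym e)) ∷ []) ∷ [] ∷ []) (sym size≡3)

    2≡-1 : 1# + 1# ≡ - 1#
    2≡-1 with cover (1# + 1#)
    ... | here e                 = ⊥-elim (2≢0 e)
    ... | there (here e)         = ⊥-elim (1+1≢1 e)
    ... | there (there (here e)) = e

    φ : Three → F
    φ zer = 0#
    φ one = 1#
    φ two = - 1#

    presentation : Presentation ThreeElements.tables Fq
    presentation = record
      { φ = φ
      ; φ-+ = λ { zer y → sym (R.+-identityˡ _) ; one zer → sym (R.+-identityʳ _) ; one one → sym 2≡-1 ; one two → sym (R.-‿inverseʳ 1#)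
                ; two zer → sym (R.+-identityʳ _) ; two one → sym (R.-‿inverseˡ 1#)
                ; two two → by₁ 1# 2≡-1 (solve 0 (:1 :- ((:- :1) :+ (:- :1)) := :1 :* (:1 :+ :1 :- (:- :1))) refl) }
      ; φ-* = λ { zer y → sym (R.zeroˡ _) ; one y → sym (R.*-identityˡ _) ; two zer → sym (R.zeroʳ _) ; two one → sym (R.*-identityʳ _)
                ; two two → solve 0 (:1 := (:- :1) :* (:- :1)) refl }
      ; φ-- = λ { zer → solve 0 (:0 := :- :0) refl ; one → refl ; two → solve 0 (:1 := :- (:- :1)) refl }
      ; φ-0 = refl
      ; φ-1 = refl
      ; ==-true = λ { zer zer _ → refl ; one one _ → refl ; two two _ → refl }
      ; ==-false = λ { zer one _ → 0≢1 ; zer two _ e → -1≢0 (sym e) ; one zer _ → 1≢0 ; one two _ e → -1≢1 (sym e) ; two zer _ → -1≢0 ; two one _ → -1≢1 }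
      ; surjective = λ y → preimage (cover y)
      }
      where
      preimage : ∀ {y} → y ∈ (0# ∷ 1# ∷ - 1# ∷ []) → Σ Three λ x → φ x ≡ y
      preimage (here refl)                 = zer , refl
      preimage (there (here refl))         = one , refl
      preimage (there (there (here refl))) = two , refl

  module Size-four (size≡4 : size ≡ 4) where
    -- Otherwise 0, 1, -1, y, -y would be five elements.
    2≡0 : 1# + 1# ≡ 0#
    2≡0 with (1# + 1#) ≟ 0#
    ... | yes e = e
    ... | no 2≢0 with missing (0# ∷ 1# ∷ - 1# ∷ []) (subst (4 ℕ.≤_) (sym size≡4) ℕₚ.≤-refl)
    ...   | y , y∉ = ⊥-elim (ℕₚ.1+n≰n (subst (5 ℕ.≤_) size≡4 (unique-short five)))
      where
      neg : ∀ {x z} → - x ≡ z → x ≡ - z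
      neg {x} {z} e = by₁ (- 1#) e (solve 2 (λ x z → x :- (:- z) := (:- :1) :* ((:- x) :- z)) refl x z)
      five : Unique (0# ∷ 1# ∷ - 1# ∷ y ∷ - y ∷ [])
      five = (0≢1 ∷ (λ e → 1≢0 (trans (neg (sym e)) (solve 0 (:- :0 := :0) refl))) ∷ (λ e → y∉ (here (sym e))) ∷
               (λ e → y∉ (here (trans (neg (sym e)) (solve 0 (:- :0 := :0) refl)))) ∷ []) ∷
             ((λ e → 2≢0 (by₁ 1# e (solve 0 ((:1 :+ :1) :- :0 := :1 :* (:1 :- (:- :1))) refl))) ∷ (λ e → y∉ (there (here (sym e)))) ∷
               (λ e → y∉ (there (there (here (neg (sym e)))))) ∷ []) ∷
             ((λ e → y∉ (there (there (here (sym e))))) ∷ (λ e → y∉ (there (here (trans (neg (sym e)) (solve 0 (:- (:- :1) := :1) refl))))) ∷ []) ∷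
             ((λ e → y∉ (here (no-zero-divisors 2≢0 (by₁ 1# e (solve 1 (λ y → (:1 :+ :1) :* y :- :0 := :1 :* (y :- (:- y))) refl y))))) ∷ []) ∷ [] ∷ []

    generator : Σ F (_∉ (0# ∷ 1# ∷ []))
    generator = missing (0# ∷ 1# ∷ []) (subst (3 ℕ.≤_) (sym size≡4) (ℕₚ.n≤1+n 3))

    ω : F
    ω = proj₁ generator

    ω≢0 : ω ≢ 0#
    ω≢0 e = proj₂ generator (here e)

    ω≢1 : ω ≢ 1#
    ω≢1 e = proj₂ generator (there (here e))

    cover : ∀ y → y ∈ (0# ∷ 1# ∷ ω ∷ (1# + ω) ∷ [])
    cover = exhaustive (four-elements 2≡0 (proj₂ generator)) (sym size≡4)

    -- The values 0 and ω are excluded by the absence of zero divisors, and the value 1 because (ω -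
    -- 1)² would vanish in characteristic 2.
    ω² : ω * ω ≡ 1# + ω
    ω² with cover (ω * ω)
    ... | here e                         = ⊥-elim (ω≢0 (square≡0⇒≡0 e))
    ... | there (here e)                 = ⊥-elim (ω≢1 (-≡0⇒≡ (square≡0⇒≡0 (by₂ 1# e (1# - ω) 2≡0
            (solve 1 (λ w → (w :- :1) :* (w :- :1) :- :0 := :1 :* (w :* w :- :1) :+ (:1 :- w) :* (:1 :+ :1 :- :0)) refl ω)))))
    ... | there (there (here e))         = ⊥-elim (ω≢1 (-≡0⇒≡ (no-zero-divisors ω≢0 (by₁ 1# e
            (solve 1 (λ w → w :* (w :- :1) :- :0 := :1 :* (w :* w :- w)) refl ω)))))
    ... | there (there (there (here e))) = e

    bit : Bool → F
    bit false = 0#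
    bit true  = 1#

    open import Data.Bool using (_xor_; _∧_)

    bit-+ : ∀ x y → bit (x xor y) ≡ bit x + bit y
    bit-+ false y     = sym (R.+-identityˡ _)
    bit-+ true  false = sym (R.+-identityʳ _)
    bit-+ true  true  = sym 2≡0

    bit-* : ∀ x y → bit (x ∧ y) ≡ bit x * bit y
    bit-* false y = sym (R.zeroˡ _)
    bit-* true  y = sym (R.*-identityˡ _)

    φ : Bool × Bool → F
    φ (x , y) = bit x + bit y * ω

    φ-* : ∀ x y → φ (Tables._*_ Four.tables x y) ≡ φ x * φ y
    φ-* (a , b) (c , d)
      rewrite bit-+ (a ∧ c) (b ∧ d) | bit-+ ((a ∧ d) xor (b ∧ c)) (b ∧ d) | bit-+ (a ∧ d) (b ∧ c) | bit-* a c | bit-* b d | bit-* a d | bit-* b c =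
      by₁ (- (bit b * bit d)) ω² (solve 5 (λ a b c d w → ((a :* c :+ b :* d) :+ ((a :* d :+ b :* c) :+ b :* d) :* w) :- (a :+ b :* w) :* (c :+ d :* w) :=
        (:- (b :* d)) :* (w :* w :- (:1 :+ w))) refl (bit a) (bit b) (bit c) (bit d) ω)

    bit-≢ : ∀ x y → (x xor y) ≡ true → φ (x , false) ≢ φ (y , false)
    bit-≢ true false _ e = 1≢0 (trans (solve 1 (λ w → :1 := :1 :+ :0 :* w) refl ω) (trans e (solve 1 (λ w → :0 :+ :0 :* w := :0) refl ω)))
    bit-≢ false true _ e = 0≢1 (trans (solve 1 (λ w → :0 := :0 :+ :0 :* w) refl ω) (trans e (solve 1 (λ w → :1 :+ :0 :* w := :1) refl ω)))

    φ-kernel : ∀ x → φ x ≡ 0# → x ≡ (false , false)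
    φ-kernel (false , false) _ = refl
    φ-kernel (true , false)  e = ⊥-elim (1≢0 (trans (solve 1 (λ w → :1 := :1 :+ :0 :* w) refl ω) e))
    φ-kernel (false , true)  e = ⊥-elim (ω≢0 (trans (solve 1 (λ w → w := :0 :+ :1 :* w) refl ω) e))
    φ-kernel (true , true)   e = ⊥-elim (ω≢1 (by₂ 1# e (- 1#) 2≡0 (solve 1 (λ w → w :- :1 := :1 :* ((:1 :+ :1 :* w) :- :0) :+ (:- :1) :* (:1 :+ :1 :- :0)) refl ω)))

    φ-+ : ∀ x y → φ (Tables._+_ Four.tables x y) ≡ φ x + φ y
    φ-+ (a , b) (c , d) rewrite bit-+ a c | bit-+ b d = solve 5 (λ a b c d w → (a :+ c) :+ (b :+ d) :* w := (a :+ b :* w) :+ (c :+ d :* w)) refl (bit a) (bit b) (bit c) (bit d) ω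

    φ-- : ∀ x → φ x ≡ - φ x
    φ-- x = by₁ (φ x) 2≡0 (solve 1 (λ x → x :- (:- x) := x :* (:1 :+ :1 :- :0)) refl (φ x))

    presentation : Presentation Four.tables Fq
    presentation = record
      { φ = φ
      ; φ-+ = φ-+
      ; φ-* = φ-*
      ; φ-- = φ--
      ; φ-0 = solve 1 (λ w → :0 :+ :0 :* w := :0) refl ω
      ; φ-1 = solve 1 (λ w → :1 :+ :0 :* w := :1) refl ω
      ; ==-true = λ { (false , false) (false , false) _ → refl ; (false , true) (false , true) _ → refl
                    ; (true , false) (true , false) _ → refl ; (true , true) (true , true) _ → refl }
      ; ==-false = λ x y h e → different x y h (φ-kernel _ (trans (φ-+ x y) (trans (cong (φ x +_) (φ-- y)) (≡⇒-≡0 e))))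
      ; surjective = λ y → preimage (cover y)
      }
      where
      different : ∀ x y → Tables._==_ Four.tables x y ≡ false → Tables._+_ Four.tables x y ≢ (false , false)
      different (a , b) (c , d) h e with a xor c | b xor d
      different (a , b) (c , d) () refl | false | false
      preimage : ∀ {y} → y ∈ (0# ∷ 1# ∷ ω ∷ (1# + ω) ∷ []) → Σ (Bool × Bool) λ x → φ x ≡ y
      preimage (here refl)                         = (false , false) , solve 1 (λ w → :0 :+ :0 :* w := :0) refl ω
      preimage (there (here refl))                 = (true , false) , solve 1 (λ w → :1 :+ :0 :* w := :1) refl ω
      preimage (there (there (here refl)))         = (false , true) , solve 1 (λ w → :0 :+ :1 :* w := w) refl ω
      preimage (there (there (there (here refl)))) = (true , true) , solve 1 (λ w → :1 :+ :1 :* w := :1 :+ w) refl ω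

-- Counting in fields with at least five elements

module LargeField (Fq : FiniteField) (r s : FiniteField.Carrier Fq) (irreducible : Irreducible Fq r s) (n : ℕ) (size≡ : FiniteField.size Fq ≡ 5 ℕ.+ n) where
  open GroundField Fq using (F; size; enum; element-injective) renaming (_≟_ to _≟F_)
  open QuadraticExtension Fq r s irreducible
  open HallPlane Fq r s irreducible using (scalar; scalar-fixed; fixed⇒scalar)
  open StarField starField
  open FieldLemmas starField
  open Coordinates starField
  open Existence starField

  elements : List F
  elements = List.tabulate (Inverse.from enum)

  element∈ : ∀ a → a ∈ elements
  element∈ a = subst (_∈ elements) (Inverse.strictlyInverseʳ enum a) (∈-tabulate⁺ (Inverse.to enum a))

  unit-of : F → K
  unit-of a = (scalar a - θ) * (scalar a - bar θ) ⁻¹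

  -- All elements of norm 1: the element 1 and the Cayley transforms of the elements of F.
  units : List K
  units = 1# ∷ List.map unit-of elements

  units-length : length units ≡ ℕ.suc size
  units-length = cong ℕ.suc (trans (Listₚ.length-map unit-of elements) (Listₚ.length-tabulate (Inverse.from enum)))

  units-complete : ∀ {η} → N η ≡ 1# → η ∈ units
  units-complete {η} unit = by-cases (η ≟ 1#)
    where
    by-cases : Dec (η ≡ 1#) → η ∈ units
    by-cases (yes e)  = here e
    by-cases (no η≢1) = there (subst (_∈ List.map unit-of elements) (sym η≡) (∈-map⁺ unit-of (element∈ (proj₁ m))))
      where
      open SlopeOfUnit unit η≢1
      m≡ : m ≡ scalar (proj₁ m)
      m≡ = fixed⇒scalar fixed
      module U = UnitOfSlope (scalar-fixed (proj₁ m))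
      η≡ : η ≡ unit-of (proj₁ m)
      η≡ = *-cancelˡ U.m-θ̄≢0 (trans (CommutativeRing.*-comm commutativeRing _ η)
        (trans (subst (λ z → η * (z - bar θ) ≡ z - θ) m≡ relation) (trans (sym U.relation) (CommutativeRing.*-comm commutativeRing U.ε _))))

  pair : Fin (size ℕ.* size) → K
  pair i = let a , b = Fin.remQuot {size} size i in Inverse.from enum a , Inverse.from enum b

  pair-injective : ∀ {i j} → pair i ≡ pair j → i ≡ j
  pair-injective {i} {j} e = trans (sym (Finₚ.combine-remQuot {size} size i)) (trans
    (cong₂ Fin.combine (element-injective (cong proj₁ e)) (element-injective (cong proj₂ e))) (Finₚ.combine-remQuot {size} size j))

  -- For |F| = 5 + n the right side exceeds the left by 5 + 7 n + n². For |F| = 4 the inequality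
  -- would read 17 ≤ 16.
  enough : ℕ.suc (ℕ.suc (3 ℕ.* length units)) ℕ.≤ size ℕ.* size
  enough = subst₂ (λ l m → ℕ.suc (ℕ.suc (3 ℕ.* l)) ℕ.≤ m ℕ.* m) (sym (trans units-length (cong ℕ.suc size≡))) (sym size≡)
    (ℕₚ.≤-trans (ℕₚ.m≤m+n (2 ℕ.+ 3 ℕ.* (6 ℕ.+ n)) (5 ℕ.+ 7 ℕ.* n ℕ.+ n ℕ.* n)) (ℕₚ.≤-reflexive
      (solve 1 (λ n → con 2 :+ con 3 :* (con 6 :+ n) :+ (con 5 :+ con 7 :* n :+ n :* n) := (con 5 :+ n) :* (con 5 :+ n)) refl n)))
    where open Data.Nat.Solver.+-*-Solver

  fresh : ∀ xs → length xs ℕ.≤ ℕ.suc (3 ℕ.* length units) → Σ K (_∉ xs)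
  fresh xs short = short-list-misses _≟_ pair pair-injective xs (ℕₚ.≤-trans (ℕ.s≤s short) enough)

  fresh-fixed : ∀ xs → length xs ℕ.≤ 4 → Σ K λ t → bar t ≡ t × t ∉ xs
  fresh-fixed xs short = let a , a∉ = scalar-missing in scalar a , scalar-fixed a , λ a∈ → a∉ (∈-map⁺ proj₁ a∈)
    where
    scalar-missing : Σ F (_∉ List.map proj₁ xs)
    scalar-missing = short-list-misses _≟F_ (Inverse.from enum) element-injective (List.map proj₁ xs)
      (subst₂ (λ l m → ℕ.suc l ℕ.≤ m) (sym (Listₚ.length-map proj₁ xs)) (sym size≡) (ℕₚ.≤-trans (ℕ.s≤s short) (ℕₚ.m≤m+n 5 n)))

  open Crossing.Fresh starField units units-complete fresh fresh-fixed

  linear-pairs : LinearPairs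
  linear-pairs k≢0 Nk≢1 b≢0 c≢0 1≢b 1≢c b≢c = linear-pair-exists k≢0 Nk≢1 1≢0 b≢0 c≢0 1≢b 1≢c b≢c

  mixed-pairs : MixedPairs
  mixed-pairs b≢0 c≢0 1≢b 1≢c b≢c = mixed-pair-exists 1≢0 b≢0 c≢0 1≢b 1≢c b≢c

module SmallField {A : Tables} {Fq : FiniteField} (P : Presentation A Fq) where
  open Presentation P
  open Search A

  linear-pairs : ∀ {strategy} → LinearVerified strategy → ∀ {r s} (irreducible : Irreducible Fq r s) →
    Existence.LinearPairs (QuadraticExtension.starField Fq r s irreducible)
  linear-pairs h {r} {s} = from (surjective r) (surjective s)
    where
    from : ∀ {r s} → Σ _ (λ x → φ x ≡ r) → Σ _ (λ y → φ y ≡ s) → (irreducible : Irreducible Fq r s) →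
      Existence.LinearPairs (QuadraticExtension.starField Fq r s irreducible)
    from (r₀ , refl) (s₀ , refl) irreducible = linear-test⇒config P r₀ s₀ irreducible h

  mixed-pairs : ∀ {strategy strategy′} → MixedVerified mixed-goal strategy ⊎ MixedVerified mixed-goal′ strategy′ → ∀ {r s} (irreducible : Irreducible Fq r s) →
    Existence.MixedPairs (QuadraticExtension.starField Fq r s irreducible)
  mixed-pairs {strategy} {strategy′} h {r} {s} = from h (surjective r) (surjective s)
    where
    from : MixedVerified mixed-goal strategy ⊎ MixedVerified mixed-goal′ strategy′ → ∀ {r s} → Σ _ (λ x → φ x ≡ r) → Σ _ (λ y → φ y ≡ s) →
      (irreducible : Irreducible Fq r s) → Existence.MixedPairs (QuadraticExtension.starField Fq r s irreducible)
    from (inj₁ h) (r₀ , refl) (s₀ , refl) irreducible = mixed-test⇒config P r₀ s₀ irreducible h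
    from (inj₂ h) (r₀ , refl) (s₀ , refl) irreducible = mixed-test′⇒config P r₀ s₀ irreducible h

-- Existence over every field, and the theorem

module AllFields (Fq : FiniteField) (r s : FiniteField.Carrier Fq) (irreducible : Irreducible Fq r s) where
  open QuadraticExtension Fq r s irreducible using (starField)
  open Existence starField

  pairs : LinearPairs × MixedPairs
  pairs = by-size (FiniteField.size Fq) refl
    where
    open FiniteField Fq
    by-size : ∀ n → size ≡ n → LinearPairs × MixedPairs
    by-size 0 e = ⊥-elim (no-element (subst Fin e (Inverse.to enum 0#)))
      where
      no-element : ¬ Fin 0
      no-element ()
    by-size 1 e = ⊥-elim (0≢1 (GroundField.decode-injective Fq (subst (λ n → (i j : Fin n) → i ≡ j) (sym e) only-one _ _)))
      where
      only-one : (i j : Fin 1) → i ≡ j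
      only-one zero zero = refl
    -- The empty strategy only completes the type of the alternative that is not taken.
    by-size 2 e = linear-pairs linear₂ irreducible , mixed-pairs {strategy′ = λ _ _ _ → []} (inj₁ mixed₂) irreducible
      where open SmallField {Two.tables} (Counting.Size-two.presentation Fq e)
    by-size 3 e = linear-pairs linear₃ irreducible , mixed-pairs {strategy′ = λ _ _ _ → []} (inj₁ mixed₃) irreducible
      where open SmallField {ThreeElements.tables} (Counting.Size-three.presentation Fq e)
    by-size 4 e = linear-pairs linear₄ irreducible , mixed-pairs {strategy = λ _ _ _ → []} (inj₂ mixed₄) irreducible
      where open SmallField {Four.tables} (Counting.Size-four.presentation Fq e)
    by-size (ℕ.suc (ℕ.suc (ℕ.suc (ℕ.suc (ℕ.suc n))))) e = LargeField.linear-pairs Fq r s irreducible n e , LargeField.mixed-pairs Fq r s irreducible n e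

theorem3p2 : (K : FiniteField) (r s : FiniteField.Carrier K) → Irreducible K r s →
    (ℓ₁ ℓ₂ : Line K r s) → ℓ₁ ≢ ℓ₂ →
    ((InBF K r s ℓ₁ × InBF K r s ℓ₂) ⊎ (InNBF K r s ℓ₁ × InNBF K r s ℓ₂) ⊎ (InNBF K r s ℓ₁ × InBF K r s ℓ₂)) →
    (A₁ B₁ C₁ : Point K r s) →
    _∈L_ K r s A₁ ℓ₁ → _∈L_ K r s B₁ ℓ₁ → _∈L_ K r s C₁ ℓ₁ →
    A₁ ≢ B₁ → A₁ ≢ C₁ → B₁ ≢ C₁ →
    ¬ _∈L_ K r s A₁ ℓ₂ → ¬ _∈L_ K r s B₁ ℓ₂ → ¬ _∈L_ K r s C₁ ℓ₂ →
    Σ (Point K r s) λ A₂ → Σ (Point K r s) λ B₂ → Σ (Point K r s) λ C₂ →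
    PappusConfig K r s ℓ₁ ℓ₂ A₁ B₁ C₁ A₂ B₂ C₂
theorem3p2 K r s irreducible ℓ₁ ℓ₂ ℓ₁≢ℓ₂ types A₁ B₁ C₁ A∈ B∈ C∈ A≢B A≢C B≢C A∉ B∉ C∉ =
  conclude (TL.two-lines M₁.direction M₁.constant M₂.direction M₂.constant (allowed types) (M₁.∈⇒On A∈) (M₁.∈⇒On B∈) (M₁.∈⇒On C∈)
    (λ o → A∉ (M₂.On⇒∈ o)) (λ o → B∉ (M₂.On⇒∈ o)) (λ o → C∉ (M₂.On⇒∈ o)) (coordinates-≢ A≢B) (coordinates-≢ A≢C) (coordinates-≢ B≢C))
  where
  open QuadraticExtension K r s irreducible using (starField)
  open HallPlane K r s irreducible
  open Plane starField
  open Coordinates starField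
  open TwoLines starField using (Opposite)
  module TL = TwoLines.Crossing-lines starField (proj₁ (AllFields.pairs K r s irreducible)) (proj₂ (AllFields.pairs K r s irreducible))
  module M₁ = LineModel (line-model ℓ₁)
  module M₂ = LineModel (line-model ℓ₂)

  allowed : _ → TL.crossing-or-parallel M₁.direction M₂.direction
  allowed (inj₁ (b₁ , b₂)) = both-semilinear _ _ (BF⇒semilinear ℓ₁ b₁) (BF⇒semilinear ℓ₂ b₂)
    where
    both-semilinear : ∀ d e → IsSemilinear d → IsSemilinear e → TL.crossing-or-parallel d e
    both-semilinear (semilinear _ _) (semilinear _ _) _ _ = tt
  allowed (inj₂ (inj₁ (n₁ , _))) = first-linear _ _ (NBF⇒linear ℓ₁ n₁)
    where
    first-linear : ∀ d e → IsLinear d → TL.crossing-or-parallel d e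
    first-linear (linear _ _ _) e _ = tt
  allowed (inj₂ (inj₂ (n₁ , _))) = first-linear _ _ (NBF⇒linear ℓ₁ n₁)
    where
    first-linear : ∀ d e → IsLinear d → TL.crossing-or-parallel d e
    first-linear (linear _ _ _) e _ = tt

  coordinates-≢ : ∀ {P Q} → P ≢ Q → coordinates P ≢ coordinates Q
  coordinates-≢ {P} {Q} P≢Q e = P≢Q (trans (sym (point-coordinates P)) (trans (cong point e) (point-coordinates Q)))

  point-≢ : ∀ {z w} → z ≢ w → point z ≢ point w
  point-≢ {z} {w} z≢w e = z≢w (trans (sym (coordinates-point z)) (trans (cong coordinates e) (coordinates-point w)))

  conclude : Config (Opposite M₁.direction M₁.constant M₂.direction M₂.constant) (coordinates A₁) (coordinates B₁) (coordinates C₁) →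
    Σ (Point K r s) λ A₂ → Σ (Point K r s) λ B₂ → Σ (Point K r s) λ C₂ → PappusConfig K r s ℓ₁ ℓ₂ A₁ B₁ C₁ A₂ B₂ C₂
  conclude (config A′ B′ C′ a b c ab ac bc n AB AC BC) = point A′ , point B′ , point C′ ,
    ℓ₁≢ℓ₂ , A∈ , B∈ , C∈ , on-second a , on-second b , on-second c , A≢B , A≢C , B≢C , point-≢ ab , point-≢ ac , point-≢ bc , A∉ , B∉ , C∉ ,
    off-first a , off-first b , off-first c , hall-projective n , meet AB , meet AC , meet BC
    where
    on-second : ∀ {z} → Opposite M₁.direction M₁.constant M₂.direction M₂.constant z → _∈L_ K r s (point z) ℓ₂
    on-second {z} (o , _) = M₂.On⇒∈ (subst (λ w → On w M₂.direction M₂.constant) (sym (coordinates-point z)) o)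
    off-first : ∀ {z} → Opposite M₁.direction M₁.constant M₂.direction M₂.constant z → ¬ _∈L_ K r s (point z) ℓ₁
    off-first {z} (_ , o) e = o (subst (λ w → On w M₁.direction M₁.constant) (coordinates-point z) (M₁.∈⇒On e))
    meet : ∀ {X Y Z W} → Meet (coordinates X) Y Z (coordinates W) n → MeetOn K r s (aff X) (aff (point Y)) (aff (point Z)) (aff W) (hall-projective n)
    meet {X} {Y} {Z} {W} m = subst₂ (λ X W → MeetOn K r s (aff X) (aff (point Y)) (aff (point Z)) (aff W) (hall-projective n))
      (point-coordinates X) (point-coordinates W) (Meet⇒MeetOn m)
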